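{- Let $q$ be a prime power and $\mathcal{H}_q$ the Hermitian curve with affine equation $X^{q+1}=Y^q+Y$. For a point $(a,b)\in\mathrm{AG}(2,\mathbb{F}_{q^6})$ put $$A:=\left(a^{q+1}-a^{q^2+q}\right)+\left(a^{q+1}-a^{q^2+q}\right)^{q^2}+\left(a^{q+1}-a^{q^2+q}\right)^{q^4}.$$ Through any point $(a,b)\in\mathrm{AG}(2,\mathbb{F}_{q^6})$ such that $A\neq 0$ there are at least $$q^3-3422q^{5/2}-5\cdot 60^{13/3}q^2-9q^2-\left(q^2+1499\cdot 1500\,q^{1/2}+5\cdot 1500^{13/3}q\right)-(q+1)$$ $\mathbb{F}_{q^6}$-rational $(q+1)$-secants to $\mathcal{H}_q(\mathbb{F}_{q^6})$.
   Context: A $(q+1)$-secant to $\mathcal{H}_q(\mathbb{F}_{q^6})$ is a line of $\mathrm{PG}(2,\mathbb{F}_{q^6})$ (defined over $\mathbb{F}_{q^6}$) meeting the set $\mathcal{H}_q(\mathbb{F}_{q^6})$ of $\mathbb{F}_{q^6}$-rational points of $\mathcal{H}_q$ in exactly $q+1$ distinct points. -}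

module Defs where

open import Level using (Level; _⊔_) renaming (suc to lsuc)
open import Algebra.Bundles using (CommutativeRing)
import Algebra.Bundles
open import Data.Nat as ℕ using (ℕ; zero; suc)
open import Data.Fin using (Fin)
open import Data.List using (List; length; filter)
open import Data.List.Base using (allFin)
open import Data.Nat.Primality using (Prime)
open import Data.Product using (Σ; _×_)
open import Data.Integer using (+_)
open import Data.Rational as ℚ using (ℚ; _/_)
open import Function.Bundles using (Inverse)
open import Relation.Binary.Definitions using (Decidable)
open import Relation.Binary.PropositionalEquality as ≡ using (_≡_)
open import Relation.Nullary using (¬_; Dec; yes; no)

[_]01 : ∀ {a} {P : Set a} → Dec P → ℕ
[ yes _ ]01 = 1
[ no _ ]01 = 0

IsPrimePower : ℕ → Set
IsPrimePower q = Σ ℕ λ p → Σ ℕ λ k → Prime p × (1 ℕ.≤ k) × (q ≡ p ℕ.^ k)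

record FiniteField (c ℓ : Level) (n : ℕ) : Set (lsuc (c ⊔ ℓ)) where
  field
    commRing : CommutativeRing c ℓ
  open CommutativeRing commRing public
  field
    0≉1   : ¬ (0# ≈ 1#)
    inv   : ∀ x → ¬ (x ≈ 0#) → Σ Carrier λ y → (x * y) ≈ 1#
    _≟_   : Decidable _≈_
    enum  : Inverse (≡.setoid (Fin n)) setoid

ℕ→ℚ : ℕ → ℚ
ℕ→ℚ n = (+ n) / 1

module Hermitian {c ℓ : Level} {n : ℕ} (F : FiniteField c ℓ n) (q : ℕ) where
  open FiniteField F
  open import Algebra.Definitions.RawSemiring (Algebra.Bundles.Semiring.rawSemiring semiring) using () renaming (_^_ to _^F_)
  open Inverse enum using (to)

  countF : (P : Carrier → Set ℓ) → (∀ x → Dec (P x)) → ℕ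
  countF P P? = length (filter (λ i → P? (to i)) (allFin n))

  OnH : Carrier → Carrier → Set ℓ
  OnH x y = (x ^F (q ℕ.+ 1)) ≈ ((y ^F q) + y)

  -- Lines of PG(2, F) through the affine point (a , b):
  --  * non-vertical lines  Y = b + m (X - a), m ∈ F : these contain no point of
  --    H_q at infinity (the only one is (0:1:0)), so their intersection with
  --    H_q(F) is the set of affine points (x , b + m(x - a)) on H_q.
  --  * the vertical line X = a (i.e. X = aZ), which contains the unique point
  --    (0:1:0) at infinity of H_q, plus the affine points (a , y) on H_q.
  lineMeet : Carrier → Carrier → Carrier → ℕ
  lineMeet a b m = countF (λ x → OnH x (b + (m * (x - a))))
                          (λ x → _≟_ (x ^F (q ℕ.+ 1)) (((b + (m * (x - a))) ^F q) + (b + (m * (x - a)))))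

  verticalMeet : Carrier → ℕ
  verticalMeet a = suc (countF (λ y → OnH a y) (λ y → _≟_ (a ^F (q ℕ.+ 1)) ((y ^F q) + y)))

  secantsThrough : Carrier → Carrier → ℕ
  secantsThrough a b =
    length (filter (λ i → lineMeet a b (to i) ℕ.≟ (q ℕ.+ 1)) (allFin n))
    ℕ.+ [ verticalMeet a ℕ.≟ (q ℕ.+ 1) ]01

  Aval : Carrier → Carrier
  Aval a = t + (t ^F (q ℕ.^ 2)) + (t ^F (q ℕ.^ 4))
    where t = (a ^F (q ℕ.+ 1)) - (a ^F ((q ℕ.^ 2) ℕ.+ q))

-- The bound  q^3 - 3422 q^(5/2) - 5·60^(13/3) q^2 - 9 q^2
--             - (q^2 + 1499·1500 q^(1/2) + 5·1500^(13/3) q) - (q+1)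
-- with q^(1/2) replaced by s, 60^(13/3) by t, 1500^(13/3) by u.
bound : ℕ → ℚ → ℚ → ℚ → ℚ
bound q s t u =
  ℕ→ℚ (q ℕ.^ 3)
  ℚ.- ℕ→ℚ 3422 ℚ.* ℕ→ℚ (q ℕ.^ 2) ℚ.* s
  ℚ.- ℕ→ℚ 5 ℚ.* t ℚ.* ℕ→ℚ (q ℕ.^ 2)
  ℚ.- ℕ→ℚ 9 ℚ.* ℕ→ℚ (q ℕ.^ 2)
  ℚ.- (ℕ→ℚ (q ℕ.^ 2) ℚ.+ ℕ→ℚ (1499 ℕ.* 1500) ℚ.* s ℚ.+ ℕ→ℚ 5 ℚ.* u ℚ.* ℕ→ℚ q)
  ℚ.- ℕ→ℚ (q ℕ.+ 1)

{-# OPTIONS --safe #-}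
module Submission where

-- Let K = 𝔽_{q⁶}, σ x = x^q, K₂ the fixed field of σ², and δ = a σa − b − σb; A ≠ 0 forces a ∉ K₂ and δ ≠ 0.
-- For (x, y, w) over K₂ with w ≠ 0, the Hermitian form of the curve at the point α (a, b, 1) + (σx, σy, σw)
-- of the line through (a, b) equals X σY + Y σX with X = α s + σk and Y = α m + 1 as soon as
--   m σs + s σm = δ,   a x − b w − y = s + m k,   x σx − y σw − w σy = k + σk   (k ∈ K₂),
-- and if s ∉ K₂ m this binary form has exactly q + 1 zeros, so the line is a (q+1)-secant.
-- With m = 1/t the first equation is solvable for s if and only if t is a zero of the quadratic form
-- Σᵢ (−1)ⁱ σⁱ(δ t σt) over 𝔽_q, which has about q⁵ zeros.  Since K = a K₂ ⊕ K₂ ⊕ m K₂ for most m, the second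
-- equation determines x, y, k from w, and the third becomes a Hermitian circle in w ∈ K₂, with at least q points.
-- A given line comes from at most (q + 1)(q² − 1) pairs (t, w), except for one line which may come from q² times
-- as many.  Hence there are at least q³ − 9 q² secants, and the other terms of the bound only decrease it.

open import Defs
open import Level using (Level; 0ℓ)
open import Algebra.Bundles using (CommutativeRing; RawRing; Semiring)
open import Algebra.Structures using (IsCommutativeRing)
open import Algebra.Morphism.Structures using (IsRingMonomorphism)
import Algebra.Morphism.RingMonomorphism as RingMonomorphism
open import Data.Nat as ℕ using (ℕ; zero; suc; _≤_; _<_; z≤n; s≤s; NonZero)
import Data.Nat.Properties as ℕ
open import Data.Nat.Combinatorics using (_C_; nCn≡1; nCk+nC[k+1]≡[n+1]C[k+1])
open import Data.Nat.Divisibility as ℕ using (divides; _∣_)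
open import Data.Nat.Primality using (Prime; euclidsLemma; ¬prime[0]; prime⇒nonTrivial)
open import Data.Nat.Solver using (module +-*-Solver)
open import Data.Integer as ℤ using (ℤ; -[1+_]; _⊖_) renaming (+_ to pos)
import Data.Integer.Properties as ℤ
open import Data.Rational as ℚ using (ℚ; toℚᵘ)
import Data.Rational.Properties as ℚ
open import Data.Rational.Unnormalised as ℚᵘ using (mkℚᵘ)
import Data.Rational.Unnormalised.Properties as ℚᵘ
open import Data.Fin as Fin using (Fin; zero; suc; toℕ; inject₁; fromℕ; punchIn)
import Data.Fin.Properties as Fin
open import Data.Fin.Permutation using (Permutation; permutation)
open import Data.List using (List; []; _∷_; _++_; length; filter; tabulate; allFin)
open import Data.List.Relation.Unary.All using (All; []; _∷_; all?)
open import Data.Maybe using (Maybe; just; nothing)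
open import Data.Vec using (Vec; []; _∷_; map; lookup)
import Data.Vec.Properties as Vec
open import Data.Vec.Functional using (replicate; removeAt)
open import Data.Product using (_×_; _,_; proj₁; proj₂; ∃)
open import Data.Sum using (_⊎_; inj₁; inj₂)
open import Function using (_∘_; id)
open import Function.Bundles using (Inverse)
open import Relation.Nullary using (Dec; yes; no; ¬_; ¬?; contradiction)
open import Relation.Nullary.Decidable using (_×-dec_; _⊎-dec_; True; toWitness)
open import Relation.Unary using (Decidable)
open import Relation.Binary.PropositionalEquality

-- The K₂-rational point enters through its conjugate (σx, σy, σw) because one more σ returns (x, y,
-- w): the coefficient of α is then K₂-linear in x, y, w. The zeros of X σY + Y σX are Y = 0 and the
-- solutions of X = ι Y with σι = - ι. The zero Y = 0 is α = - t, so a line and its K₂-rational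
-- point leave only q + 1 choices for t, which bounds the multiplicities. The obstacle is that the
-- circle in w must not degenerate. With a variable n homogenising the last two equations, they
-- describe a Hermitian form in five variables over K₂, restricted to the complement of v = (a, b,
-- 1, s, m) and its conjugates over K₂. The equation for s says that v is orthogonal to σv. Hence
-- among the products of v, σ²v, σ⁴v with σv, σ³v, σ⁵v only the conjugates of ϖ = ⟨v, σ³v⟩ survive,
-- and ϖ ≠ 0 is enough. A is the trace to K₂ of δ - σδ, which is why A ≠ 0 gives δ ≠ 0. All
-- cardinalities come from degrees of polynomials and the pigeonhole principle, so that the
-- characteristic never matters.

module Counting where
  open import Data.Nat using (_+_; _*_; _^_; >-nonZero)
  open import Data.Nat.Properties
  open import Algebra.Properties.CommutativeMonoid.Sum +-0-commutativeMonoid public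
    using (sum; ∑-comm; ∑-distrib-+; sum-cong-≗; sum-replicate-zero)

  private variable
    ℓ ℓ₁ ℓ₂ ℓ₃ : Level
    n m : ℕ

  sum-mono : {f g : Fin n → ℕ} → (∀ i → f i ≤ g i) → sum f ≤ sum g
  sum-mono {zero}  h = z≤n
  sum-mono {suc n} h = +-mono-≤ (h zero) (sum-mono (h ∘ suc))

  sum-const : ∀ n (k : ℕ) → sum {n} (λ _ → k) ≡ n * k
  sum-const zero    k = refl
  sum-const (suc n) k = cong (k +_) (sum-const n k)

  sum-*ʳ : (f : Fin n → ℕ) (k : ℕ) → sum (λ i → f i * k) ≡ sum f * k
  sum-*ʳ {zero}  f k = refl
  sum-*ʳ {suc n} f k = trans (cong (f zero * k +_) (sum-*ʳ (f ∘ suc) k)) (sym (*-distribʳ-+ k (f zero) _))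

  term≤sum : (f : Fin n → ℕ) (i : Fin n) → f i ≤ sum f
  term≤sum f zero    = m≤m+n _ _
  term≤sum f (suc i) = ≤-trans (term≤sum (f ∘ suc) i) (m≤n+m _ _)

  01-yes : {P : Set ℓ} (d : Dec P) → P → [ d ]01 ≡ 1
  01-yes (yes _) _ = refl
  01-yes (no ¬p) p = contradiction p ¬p

  01-no : {P : Set ℓ} (d : Dec P) → ¬ P → [ d ]01 ≡ 0
  01-no (yes p) ¬p = contradiction p ¬p
  01-no (no _)  _  = refl

  01-mono : {P : Set ℓ₁} {Q : Set ℓ₂} (p : Dec P) (q : Dec Q) → (P → Q) → [ p ]01 ≤ [ q ]01
  01-mono (yes p) d h = ≤-reflexive (sym (01-yes d (h p)))
  01-mono (no _)  d h = z≤n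

  01-⊎ : {P : Set ℓ₁} {Q : Set ℓ₂} {R : Set ℓ₃} (p : Dec P) (q : Dec Q) (r : Dec R) →
         (P → Q ⊎ R) → [ p ]01 ≤ [ q ]01 + [ r ]01
  01-⊎ (no _)  q r h = z≤n
  01-⊎ (yes p) q r h with h p
  ... | inj₁ x = ≤-trans (≤-reflexive (sym (01-yes q x))) (m≤m+n _ _)
  ... | inj₂ x = ≤-trans (≤-reflexive (sym (01-yes r x))) (m≤n+m _ _)

  -- A sum of indicators instead of the length of a filtered list: double counting is then the
  -- exchange of two sums, `∑-comm`, and inequalities can be proved term by term.
  # : {P : Fin n → Set ℓ} → Decidable P → ℕ
  # P? = sum (λ i → [ P? i ]01)

  length-filter-tabulate : {P : Fin m → Set ℓ} (P? : Decidable P) (f : Fin n → Fin m) →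
                           length (filter P? (tabulate f)) ≡ sum (λ i → [ P? (f i) ]01)
  length-filter-tabulate {n = zero}  P? f = refl
  length-filter-tabulate {n = suc n} P? f with P? (f zero)
  ... | yes _ = cong suc (length-filter-tabulate P? (f ∘ suc))
  ... | no _  = length-filter-tabulate P? (f ∘ suc)

  length-filter : {P : Fin n → Set ℓ} (P? : Decidable P) → length (filter P? (allFin n)) ≡ # P?
  length-filter P? = length-filter-tabulate P? id

  #-mono : {P : Fin n → Set ℓ₁} {Q : Fin n → Set ℓ₂} (P? : Decidable P) (Q? : Decidable Q) →
           (∀ i → P i → Q i) → # P? ≤ # Q?
  #-mono P? Q? h = sum-mono (λ i → 01-mono (P? i) (Q? i) (h i))

  #-cong : {P : Fin n → Set ℓ₁} {Q : Fin n → Set ℓ₂} (P? : Decidable P) (Q? : Decidable Q) →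
           (∀ i → P i → Q i) → (∀ i → Q i → P i) → # P? ≡ # Q?
  #-cong P? Q? h k = ≤-antisym (#-mono P? Q? h) (#-mono Q? P? k)

  #-⊎ : {P : Fin n → Set ℓ₁} {Q : Fin n → Set ℓ₂} {R : Fin n → Set ℓ₃}
        (P? : Decidable P) (Q? : Decidable Q) (R? : Decidable R) →
        (∀ i → P i → Q i ⊎ R i) → # P? ≤ # Q? + # R?
  #-⊎ P? Q? R? h = ≤-trans (sum-mono (λ i → 01-⊎ (P? i) (Q? i) (R? i) (h i)))
                           (≤-reflexive (∑-distrib-+ (λ i → [ Q? i ]01) (λ i → [ R? i ]01)))

  #-all : {P : Fin n → Set ℓ} (P? : Decidable P) → (∀ i → P i) → # P? ≡ n
  #-all {n = n} P? h = trans (sum-cong-≗ (λ i → 01-yes (P? i) (h i))) (trans (sum-const n 1) (*-identityʳ n))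

  #-none : {P : Fin n → Set ℓ} (P? : Decidable P) → (∀ i → ¬ P i) → # P? ≡ 0
  #-none {n = n} P? h = trans (sum-cong-≗ (λ i → 01-no (P? i) (h i))) (sum-replicate-zero n)

  #-positive : {P : Fin n → Set ℓ} (P? : Decidable P) {i : Fin n} → P i → 1 ≤ # P?
  #-positive P? {i} p = ≤-trans (≤-reflexive (sym (01-yes (P? i) p))) (term≤sum (λ j → [ P? j ]01) i)

  #-≡ : (x : Fin n) → # (x Fin.≟_) ≡ 1
  #-≡ {suc n} zero    = cong suc (#-none {n = n} {P = λ i → zero ≡ Fin.suc i} (λ i → zero Fin.≟ suc i) (λ _ ()))
  #-≡ {suc n} (suc x) = trans (#-cong (λ i → suc x Fin.≟ suc i) (x Fin.≟_) (λ _ → Fin.suc-injective) (λ _ → cong suc)) (#-≡ x)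

  01-fibre : {P : Set ℓ} (P? : Dec P) (x : Fin n) → [ P? ]01 ≤ sum (λ y → [ P? ×-dec (x Fin.≟ y) ]01)
  01-fibre (no _)  x = z≤n
  01-fibre (yes p) x = ≤-trans (≤-reflexive (sym (01-yes (yes p ×-dec (x Fin.≟ x)) (p , refl))))
                               (term≤sum (λ y → [ yes p ×-dec (x Fin.≟ y) ]01) x)

  #-fibres : {P : Fin n → Set ℓ} (P? : Decidable P) (f : Fin n → Fin m) →
             # P? ≤ sum (λ y → # (λ i → P? i ×-dec (f i Fin.≟ y)))
  #-fibres P? f = ≤-trans (sum-mono (λ i → 01-fibre (P? i) (f i)))
                          (≤-reflexive (∑-comm (λ i y → [ P? i ×-dec (f i Fin.≟ y) ]01)))

  01-scale : {P : Set ℓ} (P? : Dec P) {a k : ℕ} → (P → a ≤ k) → (¬ P → a ≡ 0) → a ≤ [ P? ]01 * k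
  01-scale (yes p) h _ = ≤-trans (h p) (≤-reflexive (sym (*-identityˡ _)))
  01-scale (no ¬p) _ h = ≤-reflexive (h ¬p)

  #-≤-fibre : {P : Fin n → Set ℓ₁} {Q : Fin m → Set ℓ₂} (P? : Decidable P) (Q? : Decidable Q) (f : Fin n → Fin m) (k : ℕ) →
              (∀ i → P i → Q (f i)) → (∀ y → Q y → # (λ i → P? i ×-dec (f i Fin.≟ y)) ≤ k) →
              # P? ≤ # Q? * k
  #-≤-fibre {Q = Q} P? Q? f k into small = ≤-trans (#-fibres P? f)
    -- Fibres over points outside `Q` are empty by `into`; each remaining one contributes at most
    -- `k`.
    (≤-trans (sum-mono (λ y → 01-scale (Q? y) (small y)
               (λ ¬q → #-none (λ i → P? i ×-dec (f i Fin.≟ y)) (λ i (p , e) → ¬q (subst Q e (into i p))))))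
             (≤-reflexive (sum-*ʳ (λ y → [ Q? y ]01) k)))

  #-injective : {P : Fin n → Set ℓ₁} {Q : Fin m → Set ℓ₂} (P? : Decidable P) (Q? : Decidable Q) (f : Fin n → Fin m) →
                (∀ i → P i → Q (f i)) → (∀ i j → P i → P j → f i ≡ f j → i ≡ j) → # P? ≤ # Q?
  #-injective P? Q? f into inj = ≤-trans (#-≤-fibre P? Q? f 1 into (λ y _ → fibre y)) (≤-reflexive (*-identityʳ _))
    where
    fibre : ∀ y → # (λ i → P? i ×-dec (f i Fin.≟ y)) ≤ 1
    fibre y with Fin.any? (λ i → P? i ×-dec (f i Fin.≟ y))
    ... | no ¬∃ = ≤-trans (≤-reflexive (#-none _ (λ i p → ¬∃ (i , p)))) z≤n
    ... | yes (i , p , e) = ≤-trans (#-mono _ (i Fin.≟_) (λ j (p′ , e′) → inj i j p p′ (trans e (sym e′)))) (≤-reflexive (#-≡ i))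

  #-singleton : {P : Fin n → Set ℓ} (P? : Decidable P) → (∀ i j → P i → P j → i ≡ j) → # P? ≤ 1
  #-singleton P? h with Fin.any? P?
  ... | no ¬∃ = ≤-trans (≤-reflexive (#-none P? (λ i p → ¬∃ (i , p)))) z≤n
  ... | yes (i , p) = ≤-trans (#-mono P? (i Fin.≟_) (λ j p′ → h i j p p′)) (≤-reflexive (#-≡ i))

  ∃-of-# : {P : Fin n → Set ℓ₁} {Q : Fin n → Set ℓ₂} (P? : Decidable P) (Q? : Decidable Q) →
           suc (# Q?) ≤ # P? → ∃ λ i → P i × ¬ Q i
  ∃-of-# P? Q? h with Fin.any? (λ i → P? i ×-dec ¬? (Q? i))
  ... | yes w = w
  ... | no ¬∃ = contradiction (≤-trans h (#-mono P? Q? sub)) (<-irrefl refl)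
    where
    sub : ∀ i → _ → _
    sub i p with Q? i
    ... | yes q = q
    ... | no ¬q = contradiction (i , p , ¬q) ¬∃

  #-disjoint : {P : Fin n → Set ℓ₁} {Q : Fin n → Set ℓ₂} {R : Fin n → Set ℓ₃}
               (P? : Decidable P) (Q? : Decidable Q) (R? : Decidable R) →
               (∀ i → P i → R i) → (∀ i → Q i → R i) → (∀ i → P i → ¬ Q i) → # P? + # Q? ≤ # R?
  #-disjoint P? Q? R? PR QR ¬PQ = ≤-trans (≤-reflexive (sym (∑-distrib-+ (λ i → [ P? i ]01) (λ i → [ Q? i ]01)))) (sum-mono term)
    where
    term : ∀ i → [ P? i ]01 + [ Q? i ]01 ≤ [ R? i ]01
    term i with P? i | Q? i
    ... | yes p | yes q = contradiction q (¬PQ i p)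
    ... | yes p | no  _ = ≤-reflexive (sym (01-yes (R? i) (PR i p)))
    ... | no  _ | yes q = ≤-reflexive (sym (01-yes (R? i) (QR i q)))
    ... | no  _ | no  _ = z≤n

  #-except : {P : Fin n → Set ℓ₁} {Q : Fin n → Set ℓ₂} (P? : Decidable P) (Q? : Decidable Q) →
             # P? ≤ # (λ i → P? i ×-dec ¬? (Q? i)) + # Q?
  #-except P? Q? = #-⊎ P? (λ i → P? i ×-dec ¬? (Q? i)) Q? split
    where
    split : ∀ i → _ → _
    split i p with Q? i
    ... | yes q = inj₂ q
    ... | no ¬q = inj₁ (p , ¬q)

  #-double : {P : Fin n → Set ℓ₁} {Q : Fin m → Set ℓ₂} {R : Fin n → Fin m → Set ℓ₃}
             (P? : Decidable P) (Q? : Decidable Q) (R? : ∀ i → Decidable (R i)) (j k : ℕ) →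
             (∀ i → P i → j ≤ # (λ y → Q? y ×-dec R? i y)) → (∀ y → Q y → # (λ i → R? i y) ≤ k) → # P? * j ≤ # Q? * k
  #-double P? Q? R? j k large small = begin
    # P? * j                                            ≡⟨ sum-*ʳ (λ i → [ P? i ]01) j ⟨
    -- Both ends estimate the number of related pairs `(i , y)` with `Q y`, counted by rows here and
    -- by columns after the exchange.
    sum (λ i → [ P? i ]01 * j)                          ≤⟨ sum-mono (λ i → term i (P? i)) ⟩
    sum (λ i → # (λ y → Q? y ×-dec R? i y))             ≡⟨ ∑-comm (λ i y → [ Q? y ×-dec R? i y ]01) ⟩
    sum (λ y → # (λ i → Q? y ×-dec R? i y))             ≤⟨ sum-mono (λ y → 01-scale (Q? y)
                                                             (λ q → ≤-trans (#-mono (λ i → Q? y ×-dec R? i y) (λ i → R? i y) (λ _ → proj₂)) (small y q))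
                                                             (λ ¬q → #-none (λ i → Q? y ×-dec R? i y) (λ _ (q , _) → ¬q q))) ⟩
    sum (λ y → [ Q? y ]01 * k)                          ≡⟨ sum-*ʳ (λ y → [ Q? y ]01) k ⟩
    # Q? * k                                            ∎
    where
    open ≤-Reasoning
    term : ∀ i (p : Dec _) → [ p ]01 * j ≤ # (λ y → Q? y ×-dec R? i y)
    term i (no _)  = z≤n
    term i (yes p) = ≤-trans (≤-reflexive (*-identityˡ j)) (large i p)

  #-cover : {P : Fin n → Set ℓ₁} {Q : Fin m → Set ℓ₂} {R : Fin n → Fin m → Set ℓ₃}
            (P? : Decidable P) (Q? : Decidable Q) (R? : ∀ i → Decidable (R i)) (k : ℕ) →
            (∀ i → P i → ∃ λ y → Q y × R i y) → (∀ y → Q y → # (λ i → R? i y) ≤ k) → # P? ≤ # Q? * k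
  #-cover P? Q? R? k cover small = ≤-trans (≤-reflexive (sym (*-identityʳ (# P?))))
    (#-double P? Q? R? 1 k (λ i p → #-positive (λ y → Q? y ×-dec R? i y) (proj₂ (cover i p))) small)

  -- Here `g` counts the good parameters `t` and `n` the secants. Since `(q + 1)² q³` exceeds `q⁵`
  -- by `2 q⁴ + q³`, the total defect is at most `4 q⁴ + 2 q³ + 4 q²`, which `8 q² (q + 1)²`
  -- absorbs; together with the `q²` charged to the exceptional line this makes up the 9.
  cubic-bound : ∀ q g n → 1 ≤ q → q ^ 5 ≤ g + (2 * q ^ 4 + q ^ 3 + 3 * q ^ 2 + 1) →
                g ≤ (q + 1) * (q + 1) * (n + q ^ 2) → q ^ 3 ≤ n + 9 * q ^ 2
  cubic-bound q g n 1≤q lower upper = *-cancelˡ-≤ ((q + 1) * (q + 1)) {{m*n≢0 (q + 1) (q + 1) {{suc≢0}} {{suc≢0}}}} (begin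
    (q + 1) * (q + 1) * q ^ 3
      ≡⟨ solve 1 (λ q → (q :+ con 1) :* (q :+ con 1) :* q :^ 3 := q :^ 5 :+ (con 2 :* q :^ 4 :+ q :^ 3)) refl q ⟩
    q ^ 5 + (2 * q ^ 4 + q ^ 3)
      ≤⟨ +-monoˡ-≤ _ (≤-trans lower (+-mono-≤ upper (+-monoʳ-≤ (2 * q ^ 4 + q ^ 3 + 3 * q ^ 2) (m^n>0 q {{>-nonZero 1≤q}} 2)))) ⟩
    (q + 1) * (q + 1) * (n + q ^ 2) + (2 * q ^ 4 + q ^ 3 + 3 * q ^ 2 + q ^ 2) + (2 * q ^ 4 + q ^ 3)
      ≤⟨ m≤m+n _ (4 * q ^ 4 + 14 * q ^ 3 + 4 * q ^ 2) ⟩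
    (q + 1) * (q + 1) * (n + q ^ 2) + (2 * q ^ 4 + q ^ 3 + 3 * q ^ 2 + q ^ 2) + (2 * q ^ 4 + q ^ 3) + (4 * q ^ 4 + 14 * q ^ 3 + 4 * q ^ 2)
      ≡⟨ solve 2 (λ q n → (q :+ con 1) :* (q :+ con 1) :* (n :+ q :^ 2) :+ (con 2 :* q :^ 4 :+ q :^ 3 :+ con 3 :* q :^ 2 :+ q :^ 2) :+ (con 2 :* q :^ 4 :+ q :^ 3)
           :+ (con 4 :* q :^ 4 :+ con 14 :* q :^ 3 :+ con 4 :* q :^ 2) := (q :+ con 1) :* (q :+ con 1) :* (n :+ con 9 :* q :^ 2)) refl q n ⟩
    (q + 1) * (q + 1) * (n + 9 * q ^ 2) ∎)
    where
    open +-*-Solver using (solve; con; _:=_; _:+_; _:*_; _:^_)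
    open ≤-Reasoning
    suc≢0 : NonZero (q + 1)
    suc≢0 = >-nonZero (m≤n+m 1 q)

open Counting


-- Fields carried by Fin N

record FinField (N : ℕ) : Set where
  field
    _+_ _*_ : Fin N → Fin N → Fin N
    -_      : Fin N → Fin N
    0# 1#   : Fin N
    isCommutativeRing : IsCommutativeRing _≡_ _+_ _*_ -_ 0# 1#
    0≢1     : 0# ≢ 1#
    recip   : ∀ x → x ≢ 0# → ∃ λ y → x * y ≡ 1#

module FieldOps {N : ℕ} (F : FinField N) where
  open FinField F using (isCommutativeRing; 0≢1; recip)

  K : Set
  K = Fin N

  commutativeRing : CommutativeRing 0ℓ 0ℓ
  commutativeRing = record { isCommutativeRing = isCommutativeRing }

  open CommutativeRing commutativeRing public
    using (_+_; _*_; -_; _-_; 0#; 1#; +-assoc; +-comm; +-identityˡ; +-identityʳ; -‿inverseˡ; -‿inverseʳ;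
           *-assoc; *-comm; *-identityˡ; *-identityʳ; distribˡ; zeroˡ; zeroʳ;
           semiring; commutativeSemiring; ring; *-commutativeMonoid; +-commutativeMonoid)
  open import Algebra.Properties.Ring ring public
    using (-‿distribˡ-*; -‿distribʳ-*; -0#≈0#; -‿involutive; x∙y⁻¹≈ε⇒x≈y)
    renaming (-‿+-comm to -‿distrib-+)
  open import Algebra.Properties.Semiring.Exp semiring public using (_^_; ^-homo-*; ^-assocʳ)
  open import Algebra.Properties.CommutativeSemiring.Exp commutativeSemiring public using (^-distrib-*)
  open import Algebra.Properties.Semiring.Mult.TCOptimised semiring using (×1-homo-*; ×-homo-+; 1+×) renaming (_×_ to _·_)
  open import Algebra.Solver.Ring.AlmostCommutativeRing using (fromCommutativeRing; _-Raw-AlmostCommutative⟶_)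

  x-y≡0⇒x≡y : ∀ {x y} → x - y ≡ 0# → x ≡ y
  x-y≡0⇒x≡y {x} {y} = x∙y⁻¹≈ε⇒x≈y x y

  x≡y⇒x-y≡0 : ∀ {x y} → x ≡ y → x - y ≡ 0#
  x≡y⇒x-y≡0 {x} refl = -‿inverseʳ x

  -- Integers are the coefficients of the ring solver: arithmetic on them computes, while the
  -- constants of an abstract field do not, and every ring endomorphism fixes their images (`φ-ℤ`).
  ⟦_⟧ℤ : ℤ → K
  ⟦ pos n ⟧ℤ      = n · 1#
  ⟦ -[1+ n ] ⟧ℤ = - (suc n · 1#)

  ⟦-+⟧ : ∀ n → ⟦ ℤ.- (pos n) ⟧ℤ ≡ - (n · 1#)
  ⟦-+⟧ zero    = sym -0#≈0#
  ⟦-+⟧ (suc n) = refl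

  ⟦⊖⟧ : ∀ m n → ⟦ m ⊖ n ⟧ℤ ≡ (m · 1#) - (n · 1#)
  ⟦⊖⟧ m zero = sym (trans (cong ((m · 1#) +_) -0#≈0#) (+-identityʳ _))
  ⟦⊖⟧ zero (suc n) = sym (+-identityˡ _)
  ⟦⊖⟧ (suc m) (suc n) = begin
    ⟦ suc m ⊖ suc n ⟧ℤ                    ≡⟨ cong ⟦_⟧ℤ (ℤ.[1+m]⊖[1+n]≡m⊖n m n) ⟩
    ⟦ m ⊖ n ⟧ℤ                            ≡⟨ ⟦⊖⟧ m n ⟩
    M - N′                                ≡⟨ cong (_- N′) (sym (+-identityʳ M)) ⟩
    (M + 0#) - N′                         ≡⟨ cong (λ z → (M + z) - N′) (sym (-‿inverseʳ 1#)) ⟩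
    (M + (1# - 1#)) - N′                  ≡⟨ cong (_- N′) (sym (+-assoc M 1# (- 1#))) ⟩
    ((M + 1#) - 1#) - N′                  ≡⟨ +-assoc (M + 1#) (- 1#) (- N′) ⟩
    (M + 1#) + (- 1# - N′)                ≡⟨ cong₂ _+_ (+-comm M 1#) (-‿distrib-+ 1# N′) ⟩
    (1# + M) - (1# + N′)                  ≡⟨ cong₂ _-_ (sym (1+× m 1#)) (sym (1+× n 1#)) ⟩
    (suc m · 1#) - (suc n · 1#)           ∎
    where
    open ≡-Reasoning
    M = m · 1#
    N′ = n · 1#

  ⟦+⟧ : ∀ i j → ⟦ i ℤ.+ j ⟧ℤ ≡ ⟦ i ⟧ℤ + ⟦ j ⟧ℤ
  ⟦+⟧ (pos m)    (pos n)    = ×-homo-+ 1# m n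
  ⟦+⟧ (pos m)    -[1+ n ] = ⟦⊖⟧ m (suc n)
  ⟦+⟧ -[1+ m ] (pos n)    = trans (⟦⊖⟧ n (suc m)) (+-comm _ _)
  ⟦+⟧ -[1+ m ] -[1+ n ] = trans (cong (λ k → - (k · 1#)) (sym (cong suc (ℕ.+-suc m n))))
    (trans (cong -_ (×-homo-+ 1# (suc m) (suc n))) (sym (-‿distrib-+ _ _)))

  ⟦*⟧ : ∀ i j → ⟦ i ℤ.* j ⟧ℤ ≡ ⟦ i ⟧ℤ * ⟦ j ⟧ℤ
  ⟦*⟧ (pos m)    (pos n)    = trans (cong ⟦_⟧ℤ (ℤ.+◃n≡+n (m ℕ.* n))) (×1-homo-* m n)
  ⟦*⟧ (pos m)    -[1+ n ] = trans (trans (cong ⟦_⟧ℤ (ℤ.-◃n≡-n (m ℕ.* suc n))) (⟦-+⟧ (m ℕ.* suc n)))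
    (trans (cong -_ (×1-homo-* m (suc n))) (-‿distribʳ-* _ _))
  ⟦*⟧ -[1+ m ] (pos n)    = trans (trans (cong ⟦_⟧ℤ (ℤ.-◃n≡-n (suc m ℕ.* n))) (⟦-+⟧ (suc m ℕ.* n)))
    (trans (cong -_ (×1-homo-* (suc m) n)) (-‿distribˡ-* _ _))
  ⟦*⟧ -[1+ m ] -[1+ n ] = trans (cong ⟦_⟧ℤ (ℤ.+◃n≡+n (suc m ℕ.* suc n))) (trans (×1-homo-* (suc m) (suc n))
    (trans (sym (-‿involutive _)) (trans (cong -_ (-‿distribˡ-* _ _)) (-‿distribʳ-* _ _))))

  ⟦-⟧ : ∀ i → ⟦ ℤ.- i ⟧ℤ ≡ - ⟦ i ⟧ℤ
  ⟦-⟧ (pos n)    = ⟦-+⟧ n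
  ⟦-⟧ -[1+ n ] = sym (-‿involutive _)

  ℤ-rawRing : RawRing 0ℓ 0ℓ
  ℤ-rawRing = CommutativeRing.rawRing ℤ.+-*-commutativeRing

  ℤ-morphism : ℤ-rawRing -Raw-AlmostCommutative⟶ fromCommutativeRing commutativeRing
  ℤ-morphism = record
    { ⟦_⟧ = ⟦_⟧ℤ ; +-homo = ⟦+⟧ ; *-homo = ⟦*⟧ ; -‿homo = ⟦-⟧ ; 0-homo = refl ; 1-homo = refl }

  ℤ-≟ : ∀ i j → Maybe (⟦ i ⟧ℤ ≡ ⟦ j ⟧ℤ)
  ℤ-≟ i j with i ℤ.≟ j
  ... | yes e = just (cong ⟦_⟧ℤ e)
  ... | no _  = nothing

  open import Algebra.Solver.Ring ℤ-rawRing (fromCommutativeRing commutativeRing) ℤ-morphism ℤ-≟ public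
    using (Polynomial; solve; _:=_; con; var; op; _:+_; _:*_; _:-_; :-_; _:^_; ⟦_⟧; [+]; [*])

  v : ∀ k {n} {k<n : True (k ℕ.<? n)} → Polynomial n
  v k {k<n = k<n} = var (Fin.#_ k {m<n = k<n})

  record RingHom (φ : K → K) : Set where
    field
      φ-+ : ∀ x y → φ (x + y) ≡ φ x + φ y
      φ-* : ∀ x y → φ (x * y) ≡ φ x * φ y
      φ-1 : φ 1# ≡ 1#

    φ-0 : φ 0# ≡ 0#
    φ-0 = begin
      φ 0#                     ≡⟨ sym (+-identityʳ _) ⟩
      φ 0# + 0#                ≡⟨ cong (φ 0# +_) (sym (-‿inverseʳ (φ 0#))) ⟩
      φ 0# + (φ 0# - φ 0#)     ≡⟨ sym (+-assoc _ _ _) ⟩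
      (φ 0# + φ 0#) - φ 0#     ≡⟨ cong (_- φ 0#) (sym (φ-+ 0# 0#)) ⟩
      φ (0# + 0#) - φ 0#       ≡⟨ cong (λ z → φ z - φ 0#) (+-identityʳ 0#) ⟩
      φ 0# - φ 0#              ≡⟨ -‿inverseʳ _ ⟩
      0#                       ∎ where open ≡-Reasoning

    φ-neg : ∀ x → φ (- x) ≡ - φ x
    φ-neg x = x-y≡0⇒x≡y (trans (cong (φ (- x) +_) (-‿involutive _))
      (trans (sym (φ-+ (- x) x)) (trans (cong φ (-‿inverseˡ x)) φ-0)))

    φ-× : ∀ n → φ (n · 1#) ≡ n · 1#
    φ-× zero    = φ-0
    φ-× (suc n) = trans (cong φ (1+× n 1#)) (trans (φ-+ _ _) (trans (cong₂ _+_ φ-1 (φ-× n)) (sym (1+× n 1#))))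

    φ-ℤ : ∀ i → φ ⟦ i ⟧ℤ ≡ ⟦ i ⟧ℤ
    φ-ℤ (pos n)    = φ-× n
    φ-ℤ -[1+ n ] = trans (φ-neg _) (cong -_ (φ-× (suc n)))

    φ-^ : ∀ x n → φ (x ^ n) ≡ φ x ^ n
    φ-^ x zero    = φ-1
    φ-^ x (suc n) = trans (φ-* _ _) (cong (φ x *_) (φ-^ x n))

    -- Pushes an endomorphism through a whole expression at once: the expression is quoted as a
    -- polynomial, and only its variables are conjugated. The conjugations by `σ` below rest on
    -- this.
    φ-eval : ∀ {n} (p : Polynomial n) (ρ : Vec K n) → φ (⟦ p ⟧ ρ) ≡ ⟦ p ⟧ (map φ ρ)
    φ-eval (op [+] p q) ρ = trans (φ-+ _ _) (cong₂ _+_ (φ-eval p ρ) (φ-eval q ρ))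
    φ-eval (op [*] p q) ρ = trans (φ-* _ _) (cong₂ _*_ (φ-eval p ρ) (φ-eval q ρ))
    φ-eval (con c)  ρ = φ-ℤ c
    φ-eval (var x)  ρ = sym (Vec.lookup-map x φ ρ)
    φ-eval (p :^ n) ρ = trans (φ-^ _ n) (cong (_^ n) (φ-eval p ρ))
    φ-eval (:- p)   ρ = trans (φ-neg _) (cong -_ (φ-eval p ρ))

  infix 4 _≟_
  _≟_ : (x y : K) → Dec (x ≡ y)
  _≟_ = Fin._≟_

  inv : K → K
  inv x with x ≟ 0#
  ... | yes _ = 0#
  ... | no x≢0 = proj₁ (recip x x≢0)

  inverseʳ : ∀ {x} → x ≢ 0# → x * inv x ≡ 1#
  inverseʳ {x} x≢0 with x ≟ 0#
  ... | yes e = contradiction e x≢0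
  ... | no  n = proj₂ (recip x n)

  inverseˡ : ∀ {x} → x ≢ 0# → inv x * x ≡ 1#
  inverseˡ h = trans (*-comm _ _) (inverseʳ h)

  *-cancelˡ : ∀ {x y z} → x ≢ 0# → x * y ≡ x * z → y ≡ z
  *-cancelˡ {x} {y} {z} h e = begin
    y               ≡⟨ sym (*-identityˡ y) ⟩
    1# * y          ≡⟨ cong (_* y) (sym (inverseˡ h)) ⟩
    inv x * x * y   ≡⟨ *-assoc _ _ _ ⟩
    inv x * (x * y) ≡⟨ cong (inv x *_) e ⟩
    inv x * (x * z) ≡⟨ sym (*-assoc _ _ _) ⟩
    inv x * x * z   ≡⟨ cong (_* z) (inverseˡ h) ⟩
    1# * z          ≡⟨ *-identityˡ z ⟩
    z               ∎ where open ≡-Reasoning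

  xy≡0⇒ : ∀ {x y} → x * y ≡ 0# → x ≢ 0# → y ≡ 0#
  xy≡0⇒ {x} e h = *-cancelˡ h (trans e (sym (zeroʳ x)))

  *-≢0 : ∀ {x y} → x ≢ 0# → y ≢ 0# → x * y ≢ 0#
  *-≢0 hx hy e = hy (xy≡0⇒ e hx)

  inv≢0 : ∀ {x} → x ≢ 0# → inv x ≢ 0#
  inv≢0 {x} h e = 0≢1 (trans (sym (zeroʳ x)) (trans (cong (x *_) (sym e)) (inverseʳ h)))

  neg≢0 : ∀ {x} → x ≢ 0# → - x ≢ 0#
  neg≢0 {x} h e = h (trans (sym (-‿involutive x)) (trans (cong -_ e) -0#≈0#))

  ^-≢0 : ∀ {x} n → x ≢ 0# → x ^ n ≢ 0#
  ^-≢0 zero    h e = 0≢1 (sym e)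
  ^-≢0 (suc n) h   = *-≢0 h (^-≢0 n h)

-- Frobenius maps

absorption : ∀ n k → suc k ℕ.* (suc n C suc k) ≡ suc n ℕ.* (n C k)
absorption zero    zero    = refl
absorption zero    (suc k) = ℕ.*-zeroʳ (suc (suc k))
absorption (suc n) zero    = begin
  1 ℕ.* (suc (suc n) C 1)               ≡⟨ cong (1 ℕ.*_) (sym (nCk+nC[k+1]≡[n+1]C[k+1] (suc n) 0)) ⟩
  1 ℕ.* (1 ℕ.+ (suc n C 1))             ≡⟨ cong (λ z → 1 ℕ.* (1 ℕ.+ z)) (trans (sym (ℕ.*-identityˡ _)) (absorption n 0)) ⟩
  1 ℕ.* (1 ℕ.+ suc n ℕ.* 1)             ≡⟨ ℕ.*-identityˡ _ ⟩
  suc (suc n) ℕ.* 1                     ∎ where open ≡-Reasoning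
absorption (suc n) (suc k) = begin
  suc (suc k) ℕ.* (suc (suc n) C suc (suc k)) ≡⟨ cong (suc (suc k) ℕ.*_) (sym (nCk+nC[k+1]≡[n+1]C[k+1] (suc n) (suc k))) ⟩
  suc (suc k) ℕ.* (X ℕ.+ Y)                   ≡⟨ solve 3 (λ k x y → (con 1 :+ k) :* (x :+ y) := x :+ k :* x :+ (con 1 :+ k) :* y) refl (suc k) X Y ⟩
  X ℕ.+ suc k ℕ.* X ℕ.+ suc (suc k) ℕ.* Y     ≡⟨ cong₂ (λ u v → X ℕ.+ u ℕ.+ v) (absorption n k) (absorption n (suc k)) ⟩
  X ℕ.+ suc n ℕ.* (n C k) ℕ.+ suc n ℕ.* (n C suc k)
    ≡⟨ solve 4 (λ x m a b → x :+ m :* a :+ m :* b := x :+ m :* (a :+ b)) refl X (suc n) (n C k) (n C suc k) ⟩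
  X ℕ.+ suc n ℕ.* ((n C k) ℕ.+ (n C suc k))   ≡⟨ cong (λ z → X ℕ.+ suc n ℕ.* z) (nCk+nC[k+1]≡[n+1]C[k+1] n k) ⟩
  suc (suc n) ℕ.* X                           ∎
  where
  open ≡-Reasoning
  open +-*-Solver
  X = suc n C suc k
  Y = suc n C suc (suc k)

-- By `absorption` the prime divides `(i + 1) * C(p, i + 1)`, and it cannot divide the smaller
-- positive number `i + 1`.
prime∣C : ∀ {m} → Prime (suc m) → ∀ (i : Fin m) → suc m ∣ (suc m C suc (toℕ i))
prime∣C {m} pr i with euclidsLemma (suc (toℕ i)) (suc m C suc (toℕ i)) pr
    (divides (m C toℕ i) (trans (absorption m (toℕ i)) (ℕ.*-comm (suc m) _)))
... | inj₁ d = contradiction (ℕ.∣⇒≤ d) (ℕ.<⇒≱ (ℕ.s≤s (Fin.toℕ<n i)))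
... | inj₂ d = d

module FrobeniusProperties {N : ℕ} (F : FinField N) where
  open FinField F using (0≢1)
  open FieldOps F
  open import Algebra.Properties.Semiring.Mult semiring
    using (×1-homo-*; ×-assocˡ; ×-assoc-*) renaming (_×_ to _·_)
  import Algebra.Properties.CommutativeMonoid.Sum +-commutativeMonoid as Σ
  import Algebra.Properties.CommutativeMonoid.Sum *-commutativeMonoid as Π
  import Algebra.Properties.CommutativeSemiring.Binomial commutativeSemiring as Binomial

  translation : Permutation N N
  translation = permutation (1# +_) ((- 1#) +_)
    (λ x → trans (sym (+-assoc _ _ _)) (trans (cong (_+ x) (-‿inverseʳ 1#)) (+-identityˡ x)))
    (λ x → trans (sym (+-assoc _ _ _)) (trans (cong (_+ x) (-‿inverseˡ 1#)) (+-identityˡ x)))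

  -- Translation by 1 permutes the field, so the sum of all elements does not change when 1 is added
  -- to each of its `N` terms.
  N×1≡0 : N · 1# ≡ 0#
  N×1≡0 = begin
    N · 1#                  ≡⟨ sym (Σ.sum-replicate N) ⟩
    s                       ≡⟨ sym (+-identityʳ s) ⟩
    s + 0#                  ≡⟨ cong (s +_) (sym (-‿inverseʳ t)) ⟩
    s + (t - t)             ≡⟨ sym (+-assoc s t (- t)) ⟩
    (s + t) - t             ≡⟨ cong (_- t) (sym (Σ.∑-distrib-+ (λ _ → 1#) id)) ⟩
    Σ.sum (1# +_) - t       ≡⟨ cong (_- t) (sym (Σ.sum-permute id translation)) ⟩
    t - t                   ≡⟨ -‿inverseʳ t ⟩
    0#                      ∎
    where
    open ≡-Reasoning
    s = Σ.sum {N} (replicate N 1#)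
    t = Σ.sum {N} id

  ×1-^ : ∀ p k → (p ℕ.^ k) · 1# ≡ (p · 1#) ^ k
  ×1-^ p zero    = +-identityʳ 1#
  ×1-^ p (suc k) = trans (×1-homo-* p (p ℕ.^ k)) (cong ((p · 1#) *_) (×1-^ p k))

  char : ∀ p k → N ≡ p ℕ.^ k → p · 1# ≡ 0#
  char p k e with p · 1# ≟ 0#
  ... | yes h = h
  ... | no  h = contradiction (trans (sym (×1-^ p k)) (subst (λ n → n · 1# ≡ 0#) e N×1≡0)) (^-≢0 k h)

  module _ (m : ℕ) (pr : Prime (suc m)) (char-p : suc m · 1# ≡ 0#) where

    p×≡0 : ∀ x → suc m · x ≡ 0#
    p×≡0 x = trans (cong (suc m ·_) (sym (*-identityˡ x)))
      (trans (sym (×-assoc-* (suc m) 1# x)) (trans (cong (_* x) char-p) (zeroˡ x)))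

    ∣×≡0 : ∀ {n} x → suc m ∣ n → n · x ≡ 0#
    ∣×≡0 x (divides c refl) = trans (cong (_· x) (ℕ.*-comm c (suc m)))
      (trans (sym (×-assocˡ x (suc m) c)) (p×≡0 (c · x)))

    frobenius-+ : ∀ x y → (x + y) ^ suc m ≡ x ^ suc m + y ^ suc m
    frobenius-+ x y = begin
      (x + y) ^ suc m                                            ≡⟨ Binomial.theorem (suc m) x y ⟩
      T zero + Σ.sum (T ∘ suc)                                   ≡⟨ cong (T zero +_) (Σ.sum-init-last (T ∘ suc)) ⟩
      T zero + (Σ.sum (λ i → T (suc (inject₁ i))) + T (suc (fromℕ m)))
        ≡⟨ cong₂ _+_ first (cong₂ _+_ (trans (Σ.sum-cong-≗ middle) (Σ.sum-replicate-zero m)) last) ⟩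
      y ^ suc m + (0# + x ^ suc m)                               ≡⟨ cong (y ^ suc m +_) (+-identityˡ _) ⟩
      y ^ suc m + x ^ suc m                                      ≡⟨ +-comm _ _ ⟩
      x ^ suc m + y ^ suc m                                      ∎
      where
      open ≡-Reasoning
      T : Fin (suc (suc m)) → K
      T = Binomial.binomialTerm x y (suc m)

      first : T zero ≡ y ^ suc m
      first = trans (+-identityʳ _) (*-identityˡ _)

      middle : ∀ i → T (suc (inject₁ i)) ≡ 0#
      middle i = ∣×≡0 _ (subst (λ k → suc m ∣ (suc m C suc k)) (sym (Fin.toℕ-inject₁ i)) (prime∣C pr i))

      last : T (suc (fromℕ m)) ≡ x ^ suc m
      last rewrite Fin.toℕ-fromℕ m | nCn≡1 (suc m) | ℕ.n∸n≡0 m = trans (+-identityʳ _) (*-identityʳ _)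

    frobenius-prime : RingHom (_^ suc m)
    frobenius-prime = record
      { φ-+ = frobenius-+
      ; φ-* = λ x y → ^-distrib-* x y (suc m)
      ; φ-1 = 1^ (suc m)
      }
      where
      1^ : ∀ n → 1# ^ n ≡ 1#
      1^ zero    = refl
      1^ (suc n) = trans (*-identityˡ _) (1^ n)

    frobenius-power : ∀ k → RingHom (_^ (suc m ℕ.^ k))
    frobenius-power zero    = record
      { φ-+ = λ x y → trans (*-identityʳ _) (sym (cong₂ _+_ (*-identityʳ x) (*-identityʳ y)))
      ; φ-* = λ x y → ^-distrib-* x y 1
      ; φ-1 = *-identityʳ 1#
      }
    frobenius-power (suc k) = record
      { φ-+ = λ x y → trans (sym (e (x + y))) (trans (cong (_^ (suc m ℕ.^ k)) (frobenius-+ x y))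
                (trans (RingHom.φ-+ (frobenius-power k) _ _) (cong₂ _+_ (e x) (e y))))
      ; φ-* = λ x y → ^-distrib-* x y (suc m ℕ.^ suc k)
      ; φ-1 = trans (sym (^-assocʳ 1# (suc m) (suc m ℕ.^ k)))
                (trans (cong (_^ (suc m ℕ.^ k)) (RingHom.φ-1 frobenius-prime)) (RingHom.φ-1 (frobenius-power k)))
      }
      where
      e : ∀ x → (x ^ suc m) ^ (suc m ℕ.^ k) ≡ x ^ (suc m ℕ.^ suc k)
      e x = ^-assocʳ x (suc m) (suc m ℕ.^ k)

  product-≢0 : ∀ {n} (f : Fin n → K) → (∀ i → f i ≢ 0#) → Π.sum f ≢ 0#
  product-≢0 {zero}  f h e = 0≢1 (sym e)
  product-≢0 {suc n} f h   = *-≢0 (h zero) (product-≢0 (f ∘ suc) (h ∘ suc))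

  product-const : ∀ n (a : K) → Π.sum {n} (λ _ → a) ≡ a ^ n
  product-const zero    a = refl
  product-const (suc n) a = cong (a *_) (product-const n a)

  product-almost-const : ∀ {n} (i : Fin n) (a : K) (c : Fin n → K) → c i ≡ 1# → (∀ j → j ≢ i → c j ≡ a) →
                         a * Π.sum c ≡ a ^ n
  product-almost-const {suc n} i a c ci cj = cong (a *_) (begin
    Π.sum c                         ≡⟨ Π.sum-remove {i = i} c ⟩
    c i * Π.sum (removeAt c i)      ≡⟨ cong₂ _*_ ci (Π.sum-cong-≗ (λ j → cj (punchIn i j) (Fin.punchInᵢ≢i i j))) ⟩
    1# * Π.sum {n} (λ _ → a)        ≡⟨ *-identityˡ _ ⟩
    Π.sum {n} (λ _ → a)             ≡⟨ product-const n a ⟩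
    a ^ n                           ∎)
    where open ≡-Reasoning

  private
    0^ : ∀ {n} → Fin n → 0# ^ n ≡ 0#
    0^ {suc n} _ = zeroˡ _

    unit-part : K → K
    unit-part x with x ≟ 0#
    ... | yes _ = 1#
    ... | no  _ = x

    unit-part≢0 : ∀ x → unit-part x ≢ 0#
    unit-part≢0 x with x ≟ 0#
    ... | yes _ = λ e → 0≢1 (sym e)
    ... | no  h = h

  -- Multiplication by `a` permutes the nonzero elements, so it preserves their product. To let the
  -- products run over all of `Fin N`, the factor at zero is replaced by 1 in both `unit-part` and
  -- `c`; the product of `c` is then the power with exponent `N - 1`, and one more factor `a` avoids
  -- the subtraction.
  fermat : ∀ x → x ^ N ≡ x
  fermat a with a ≟ 0#
  ... | yes refl = 0^ 0#
  ... | no a≢0 = begin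
    a ^ N          ≡⟨ sym (product-almost-const 0# a c c0 c≢0) ⟩
    a * Π.sum c    ≡⟨ cong (a *_) ∏c≡1 ⟩
    a * 1#         ≡⟨ *-identityʳ a ⟩
    a              ∎
    where
    open ≡-Reasoning
    c : K → K
    c x with x ≟ 0#
    ... | yes _ = 1#
    ... | no  _ = a

    c0 : c 0# ≡ 1#
    c0 with 0# ≟ 0#
    ... | yes _ = refl
    ... | no  h = contradiction refl h

    c≢0 : ∀ x → x ≢ 0# → c x ≡ a
    c≢0 x h with x ≟ 0#
    ... | yes e = contradiction e h
    ... | no  _ = refl

    dilation : Permutation N N
    dilation = permutation (a *_) (inv a *_)
      (λ x → trans (sym (*-assoc _ _ _)) (trans (cong (_* x) (inverseʳ a≢0)) (*-identityˡ x)))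
      (λ x → trans (sym (*-assoc _ _ _)) (trans (cong (_* x) (inverseˡ a≢0)) (*-identityˡ x)))

    scaled : ∀ x → unit-part (a * x) ≡ c x * unit-part x
    scaled x with x ≟ 0# | a * x ≟ 0#
    ... | yes e | yes _ = sym (*-identityˡ 1#)
    ... | yes e | no  h = contradiction (trans (cong (a *_) e) (zeroʳ a)) h
    ... | no  h | yes e = contradiction e (*-≢0 a≢0 h)
    ... | no  h | no  _ = refl

    u = Π.sum unit-part

    ∏c≡1 : Π.sum c ≡ 1#
    ∏c≡1 = *-cancelˡ (product-≢0 unit-part unit-part≢0) (begin
      u * Π.sum c                              ≡⟨ *-comm _ _ ⟩
      Π.sum c * u                              ≡⟨ sym (Π.∑-distrib-+ c unit-part) ⟩
      Π.sum (λ x → c x * unit-part x)          ≡⟨ Π.sum-cong-≗ (λ x → sym (scaled x)) ⟩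
      Π.sum (λ x → unit-part (a * x))          ≡⟨ sym (Π.sum-permute unit-part dilation) ⟩
      u                                        ≡⟨ sym (*-identityʳ u) ⟩
      u * 1#                                   ∎)

-- Numbers of roots

module RootBound {N : ℕ} (F : FinField N) where
  open FieldOps F

  eval : List K → K → K
  eval []       x = 0#
  eval (a ∷ cs) x = a + x * eval cs x

  -- Degree exactly `d` with leading coefficient `c`, coefficients being listed from the constant
  -- term upwards. The last entry need only equal `c` propositionally, since division by `x - r`
  -- reproduces it in an unsimplified form.
  data Leads (c : K) : ℕ → List K → Set where
    [_] : ∀ {a} → a ≡ c → Leads c 0 (a ∷ [])
    _∷_ : ∀ a {d cs} → Leads c d cs → Leads c (suc d) (a ∷ cs)

  quotient : K → List K → List K
  quotient r []           = []
  quotient r (a ∷ [])     = []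
  quotient r (a ∷ b ∷ cs) = eval (b ∷ cs) r ∷ quotient r (b ∷ cs)

  quotient-correct : ∀ r cs x → eval cs x - eval cs r ≡ (x - r) * eval (quotient r cs) x
  quotient-correct r []           x = trans (-‿inverseʳ 0#) (sym (zeroʳ _))
  quotient-correct r (a ∷ [])     x = solve 3 (λ a x r → (a :+ x :* con (ℤ.+ 0)) :- (a :+ r :* con (ℤ.+ 0)) := (x :- r) :* con (ℤ.+ 0)) refl a x r
  quotient-correct r (a ∷ b ∷ cs) x = begin
    (a + x * X) - (a + r * R)               ≡⟨ solve 5 (λ a x r X R → (a :+ x :* X) :- (a :+ r :* R) := (x :- r) :* R :+ x :* (X :- R)) refl a x r X R ⟩
    (x - r) * R + x * (X - R)               ≡⟨ cong (λ z → (x - r) * R + x * z) (quotient-correct r (b ∷ cs) x) ⟩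
    (x - r) * R + x * ((x - r) * Q)         ≡⟨ solve 4 (λ x r R Q → (x :- r) :* R :+ x :* ((x :- r) :* Q) := (x :- r) :* (R :+ x :* Q)) refl x r R Q ⟩
    (x - r) * (R + x * Q)                   ∎
    where
    open ≡-Reasoning
    X = eval (b ∷ cs) x
    R = eval (b ∷ cs) r
    Q = eval (quotient r (b ∷ cs)) x

  quotient-leads : ∀ r {c d cs} → Leads c (suc d) cs → Leads c d (quotient r cs)
  quotient-leads r (a ∷ [_] {b} e)  = [ trans (trans (cong (b +_) (zeroʳ r)) (+-identityʳ b)) e ]
  quotient-leads r (a ∷ (_∷_ b {cs = cs} l)) = eval (b ∷ cs) r ∷ quotient-leads r (b ∷ l)

  -- Induction on the degree: a root `r` splits off the factor `x - r`, and the quotient keeps the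
  -- leading coefficient.
  dense-roots : ∀ d {c cs} → c ≢ 0# → Leads c d cs → # (λ x → eval cs x ≟ 0#) ≤ d
  dense-roots zero    c≢0 ([_] {a} e) = ℕ.≤-reflexive (#-none _ (λ x h →
    c≢0 (trans (sym e) (trans (sym (trans (cong (a +_) (zeroʳ x)) (+-identityʳ a))) h))))
  dense-roots (suc d) {cs = cs} c≢0 l with Fin.any? (λ x → eval cs x ≟ 0#)
  ... | no ¬∃ = ℕ.≤-trans (ℕ.≤-reflexive (#-none _ (λ x h → ¬∃ (x , h)))) z≤n
  ... | yes (r , er) = ℕ.≤-trans (#-⊎ _ (r ≟_) (λ x → eval (quotient r cs) x ≟ 0#) split)
          (ℕ.+-mono-≤ (ℕ.≤-reflexive (#-≡ r)) (dense-roots d c≢0 (quotient-leads r l)))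
    where
    split : ∀ x → eval cs x ≡ 0# → r ≡ x ⊎ eval (quotient r cs) x ≡ 0#
    split x ex with r ≟ x
    ... | yes e = inj₁ e
    ... | no  h = inj₂ (xy≡0⇒ (trans (sym (quotient-correct r cs x)) (trans (cong₂ _-_ ex er) (-‿inverseʳ 0#)))
                              (λ z → h (sym (x-y≡0⇒x≡y z))))

  -- The polynomials that occur have a handful of terms with symbolic exponents such as
  -- `q ^ i + q ^ j`. They are written sparsely, without their leading term, and are expanded into
  -- coefficient lists only to bound the number of roots.
  Sparse : Set
  Sparse = List (K × ℕ)

  ⟪_⟫ : Sparse → K → K
  ⟪ [] ⟫           x = 0#
  ⟪ (c , e) ∷ es ⟫ x = c * x ^ e + ⟪ es ⟫ x

  addTerm : K → ℕ → List K → List K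
  addTerm a zero    []       = a ∷ []
  addTerm a zero    (b ∷ cs) = (a + b) ∷ cs
  addTerm a (suc e) []       = 0# ∷ addTerm a e []
  addTerm a (suc e) (b ∷ cs) = b ∷ addTerm a e cs

  eval-addTerm : ∀ a e cs x → eval (addTerm a e cs) x ≡ a * x ^ e + eval cs x
  eval-addTerm a zero    []       x = cong₂ _+_ (sym (*-identityʳ a)) (zeroʳ x)
  eval-addTerm a zero    (b ∷ cs) x = trans (+-assoc a b _) (cong (_+ (b + x * eval cs x)) (sym (*-identityʳ a)))
  eval-addTerm a (suc e) []       x = begin
    0# + x * eval (addTerm a e []) x   ≡⟨ +-identityˡ _ ⟩
    x * eval (addTerm a e []) x        ≡⟨ cong (x *_) (trans (eval-addTerm a e [] x) (+-identityʳ _)) ⟩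
    x * (a * x ^ e)                    ≡⟨ solve 3 (λ a x p → x :* (a :* p) := a :* (x :* p)) refl a x (x ^ e) ⟩
    a * (x * x ^ e)                    ≡⟨ sym (+-identityʳ _) ⟩
    a * (x * x ^ e) + 0#               ∎
    where open ≡-Reasoning
  eval-addTerm a (suc e) (b ∷ cs) x = trans (cong (λ z → b + x * z) (eval-addTerm a e cs x))
    (solve 5 (λ a b x p E → b :+ x :* (a :* p :+ E) := a :* (x :* p) :+ (b :+ x :* E)) refl a b x (x ^ e) (eval cs x))

  addTerm-leads : ∀ {c d cs} a e → e < d → Leads c d cs → Leads c d (addTerm a e cs)
  addTerm-leads a zero    (s≤s _) (b ∷ l) = (a + b) ∷ l
  addTerm-leads a (suc e) (s≤s h) (b ∷ l) = b ∷ addTerm-leads a e h l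

  monomial-leads : ∀ c d → Leads c d (addTerm c d [])
  monomial-leads c zero    = [ refl ]
  monomial-leads c (suc d) = 0# ∷ monomial-leads c d

  dense : K → ℕ → Sparse → List K
  dense c d []             = addTerm c d []
  dense c d ((a , e) ∷ es) = addTerm a e (dense c d es)

  dense-leads : ∀ c d es → All (λ (_ , e) → e < d) es → Leads c d (dense c d es)
  dense-leads c d []             []       = monomial-leads c d
  dense-leads c d ((a , e) ∷ es) (h ∷ hs) = addTerm-leads a e h (dense-leads c d es hs)

  eval-dense : ∀ c d es x → eval (dense c d es) x ≡ c * x ^ d + ⟪ es ⟫ x
  eval-dense c d []             x = eval-addTerm c d [] x
  eval-dense c d ((a , e) ∷ es) x = trans (eval-addTerm a e (dense c d es) x) (trans (cong (a * x ^ e +_) (eval-dense c d es x))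
    (solve 3 (λ t u v → t :+ (u :+ v) := u :+ (t :+ v)) refl (a * x ^ e) (c * x ^ d) (⟪ es ⟫ x)))

  root-bound : ∀ d c es → c ≢ 0# → All (λ (_ , e) → e < d) es → (f : K → K) →
               (∀ x → f x ≡ c * x ^ d + ⟪ es ⟫ x) → # (λ x → f x ≟ 0#) ≤ d
  root-bound d c es c≢0 h f eq = ℕ.≤-trans
    (#-mono _ (λ x → eval (dense c d es) x ≟ 0#) (λ x e → trans (eval-dense c d es x) (trans (sym (eq x)) e)))
    (dense-roots d c≢0 (dense-leads c d es h))

-- Conjugation on the field with q⁶ elements

module Conjugates (q : ℕ) (1<q : 1 < q) (F : FinField (q ℕ.^ 6))
  (σ-hom : FieldOps.RingHom F (λ x → FieldOps._^_ F x q))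
  (fermat : ∀ x → FieldOps._^_ F x (q ℕ.^ 6) ≡ x) where

  open FinField F using (0≢1)
  open FieldOps F public
  open RootBound F public

  instance
    q-nonZero : NonZero q
    q-nonZero = ℕ.>-nonZero (ℕ.<-trans (s≤s z≤n) 1<q)

  σ σ² σ³ σ⁴ σ⁵ : K → K
  σ  x = x ^ q
  σ² x = σ (σ x)
  σ³ x = σ (σ² x)
  σ⁴ x = σ (σ³ x)
  σ⁵ x = σ (σ⁴ x)

  module σ = RingHom σ-hom

  σ-eval : ∀ {n} (p : Polynomial n) (ρ : Vec K n) → σ (⟦ p ⟧ ρ) ≡ ⟦ p ⟧ (map σ ρ)
  σ-eval = σ.φ-eval

  σ-pow : ∀ i x → σ x ^ (q ℕ.^ i) ≡ x ^ (q ℕ.^ suc i)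
  σ-pow i x = ^-assocʳ x q (q ℕ.^ i)

  σ⁶ : ∀ x → σ (σ⁵ x) ≡ x
  σ⁶ x = trans (sym (trans (sym (σ-pow 5 x)) (trans (sym (σ-pow 4 (σ x))) (trans (sym (σ-pow 3 (σ² x)))
    (trans (sym (σ-pow 2 (σ³ x))) (trans (sym (σ-pow 1 (σ⁴ x))) (trans (sym (σ-pow 0 (σ⁵ x))) (*-identityʳ _)))))))) (fermat x)

  σ-injective : ∀ {x y} → σ x ≡ σ y → x ≡ y
  σ-injective {x} {y} e = trans (sym (σ⁶ x)) (trans (cong σ⁵ e) (σ⁶ y))

  σ-≢0 : ∀ {x} → x ≢ 0# → σ x ≢ 0#
  σ-≢0 h e = h (σ-injective (trans e (sym σ.φ-0)))

  conj : K → Vec K 6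
  conj x = x ∷ σ x ∷ σ² x ∷ σ³ x ∷ σ⁴ x ∷ σ⁵ x ∷ []

  powers : K → Vec K 6
  powers x = x ^ (q ℕ.^ 0) ∷ x ^ (q ℕ.^ 1) ∷ x ^ (q ℕ.^ 2) ∷ x ^ (q ℕ.^ 3) ∷ x ^ (q ℕ.^ 4) ∷ x ^ (q ℕ.^ 5) ∷ []

  conj≡powers : ∀ x → conj x ≡ powers x
  conj≡powers x = cong₂ _∷_ p0 (cong₂ _∷_ p1 (cong₂ _∷_ p2 (cong₂ _∷_ p3 (cong₂ _∷_ p4 (cong₂ _∷_ p5 refl)))))
    where
    step : ∀ {i} (f : K → K) → (∀ y → f y ≡ y ^ (q ℕ.^ i)) → f (σ x) ≡ x ^ (q ℕ.^ suc i)
    step {i} f h = trans (h (σ x)) (σ-pow i x)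
    z0 : ∀ y → y ≡ y ^ (q ℕ.^ 0)
    z0 y = sym (*-identityʳ y)
    z1 : ∀ y → σ y ≡ y ^ (q ℕ.^ 1)
    z1 y = trans (z0 (σ y)) (σ-pow 0 y)
    z2 : ∀ y → σ² y ≡ y ^ (q ℕ.^ 2)
    z2 y = trans (z1 (σ y)) (σ-pow 1 y)
    z3 : ∀ y → σ³ y ≡ y ^ (q ℕ.^ 3)
    z3 y = trans (z2 (σ y)) (σ-pow 2 y)
    z4 : ∀ y → σ⁴ y ≡ y ^ (q ℕ.^ 4)
    z4 y = trans (z3 (σ y)) (σ-pow 3 y)
    p0 = z0 x
    p1 = z1 x
    p2 = z2 x
    p3 = z3 x
    p4 = z4 x
    p5 = step {4} σ⁴ z4

  -- Degrees of additive and quadratic polynomials in the conjugates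

  ^-mono : ∀ {i j} → i < j → q ℕ.^ i < q ℕ.^ j
  ^-mono = ℕ.^-monoʳ-< q 1<q

  -- The linearised polynomials `c₀ x + c₁ x^q + c₂ x^(q²) + ...`.
  linear : List K → K → K
  linear []       x = 0#
  linear (c ∷ cs) x = c * x + linear cs (σ x)

  private
    terms : ℕ → List K → Sparse
    terms i []       = []
    terms i (c ∷ cs) = (c , q ℕ.^ i) ∷ terms (suc i) cs

    terms-bound : ∀ i cs → All (λ (_ , e) → e < q ℕ.^ (length cs ℕ.+ i)) (terms i cs)
    terms-bound i []       = []
    terms-bound i (c ∷ cs) = ^-mono (s≤s (ℕ.m≤n+m i (length cs))) ∷
      subst (λ m → All (λ (_ , e) → e < q ℕ.^ m) (terms (suc i) cs)) (ℕ.+-suc (length cs) i) (terms-bound (suc i) cs)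

    linear-terms : ∀ i cs c x → linear (cs ++ c ∷ []) (x ^ (q ℕ.^ i)) ≡ c * x ^ (q ℕ.^ (length cs ℕ.+ i)) + ⟪ terms i cs ⟫ x
    linear-terms i []       c x = refl
    linear-terms i (a ∷ cs) c x = begin
      a * y + linear (cs ++ c ∷ []) (σ y)                                                  ≡⟨ cong (λ z → a * y + linear (cs ++ c ∷ []) z) σy ⟩
      a * y + linear (cs ++ c ∷ []) (x ^ (q ℕ.^ suc i))                                    ≡⟨ cong (a * y +_) (linear-terms (suc i) cs c x) ⟩
      a * y + (c * x ^ (q ℕ.^ (length cs ℕ.+ suc i)) + ⟪ terms (suc i) cs ⟫ x)             ≡⟨ cong (λ m → a * y + (c * x ^ (q ℕ.^ m) + ⟪ terms (suc i) cs ⟫ x)) (ℕ.+-suc (length cs) i) ⟩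
      a * y + (c * x ^ (q ℕ.^ (suc (length cs) ℕ.+ i)) + ⟪ terms (suc i) cs ⟫ x)           ≡⟨ solve 3 (λ u v w → u :+ (v :+ w) := v :+ (u :+ w)) refl _ _ _ ⟩
      c * x ^ (q ℕ.^ (suc (length cs) ℕ.+ i)) + (a * y + ⟪ terms (suc i) cs ⟫ x)           ∎
      where
      open ≡-Reasoning
      y = x ^ (q ℕ.^ i)
      σy : σ y ≡ x ^ (q ℕ.^ suc i)
      σy = trans (^-assocʳ x (q ℕ.^ i) q) (cong (x ^_) (ℕ.*-comm (q ℕ.^ i) q))

  linear-roots : ∀ cs c k → c ≢ 0# → # (λ x → linear (cs ++ c ∷ []) x + k ≟ 0#) ≤ q ℕ.^ length cs
  linear-roots cs c k c≢0 = root-bound (q ℕ.^ length cs) c ((k , 0) ∷ terms 0 cs) c≢0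
    (ℕ.m^n>0 q (length cs) ∷ subst (λ m → All (λ (_ , e) → e < q ℕ.^ m) (terms 0 cs)) (ℕ.+-identityʳ (length cs)) (terms-bound 0 cs)) _
    (λ x → begin
      linear (cs ++ c ∷ []) x + k                                     ≡⟨ cong (λ y → linear (cs ++ c ∷ []) y + k) (sym (*-identityʳ x)) ⟩
      linear (cs ++ c ∷ []) (x ^ (q ℕ.^ 0)) + k                       ≡⟨ cong (_+ k) (linear-terms 0 cs c x) ⟩
      c * x ^ (q ℕ.^ (length cs ℕ.+ 0)) + ⟪ terms 0 cs ⟫ x + k         ≡⟨ cong (λ m → c * x ^ (q ℕ.^ m) + ⟪ terms 0 cs ⟫ x + k) (ℕ.+-identityʳ (length cs)) ⟩
      c * x ^ (q ℕ.^ length cs) + ⟪ terms 0 cs ⟫ x + k                 ≡⟨ solve 3 (λ u v k → u :+ v :+ k := u :+ (k :* con (ℤ.+ 1) :+ v)) refl _ _ k ⟩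
      c * x ^ (q ℕ.^ length cs) + (k * 1# + ⟪ terms 0 cs ⟫ x)          ∎)
    where open ≡-Reasoning

  infix 9 _⟨_⟩
  _⟨_⟩ : K → Fin 6 → K
  x ⟨ i ⟩ = lookup (conj x) i

  Quadratic : Set
  Quadratic = List (K × Fin 6 × Fin 6)

  quadratic : Quadratic → K → K → K
  quadratic []                 k x = k
  quadratic ((c , i , j) ∷ ts) k x = c * (x ⟨ i ⟩ * x ⟨ j ⟩) + quadratic ts k x

  -- Ensures `q ^ k + q ^ l < q ^ i + q ^ j` by comparing the indices alone, strictly in one place.
  -- For closed indices the test evaluates, so `quadratic-roots` finds its side condition by itself.
  Below : Fin 6 → Fin 6 → K × Fin 6 × Fin 6 → Set
  Below i j (_ , k , l) = (k Fin.< i × l Fin.≤ j) ⊎ (k Fin.≤ i × l Fin.< j)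

  below? : ∀ i j → Decidable (Below i j)
  below? i j (_ , k , l) = ((k Fin.<? i) ×-dec (l Fin.≤? j)) ⊎-dec ((k Fin.≤? i) ×-dec (l Fin.<? j))

  quadratic-roots : ∀ c i j ts k → c ≢ 0# → {below : True (all? (below? i j) ts)} →
                    # (λ x → quadratic ((c , i , j) ∷ ts) k x ≟ 0#) ≤ q ℕ.^ Fin.toℕ i ℕ.+ q ℕ.^ Fin.toℕ j
  quadratic-roots c i j ts k c≢0 {below} = root-bound _ c (sparse ts) c≢0 (bounds ts (toWitness below)) _
    (λ x → cong₂ _+_ (cong (c *_) (exponent i j x)) (sparse-correct ts x))
    where
    sparse : Quadratic → Sparse
    sparse []                 = (k , 0) ∷ []
    sparse ((c , i , j) ∷ ts) = (c , q ℕ.^ Fin.toℕ i ℕ.+ q ℕ.^ Fin.toℕ j) ∷ sparse ts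

    power : ∀ i x → lookup (powers x) i ≡ x ^ (q ℕ.^ Fin.toℕ i)
    power zero x = refl
    power (suc zero) x = refl
    power (suc (suc zero)) x = refl
    power (suc (suc (suc zero))) x = refl
    power (suc (suc (suc (suc zero)))) x = refl
    power (suc (suc (suc (suc (suc zero))))) x = refl

    exponent : ∀ i j x → x ⟨ i ⟩ * x ⟨ j ⟩ ≡ x ^ (q ℕ.^ Fin.toℕ i ℕ.+ q ℕ.^ Fin.toℕ j)
    exponent i j x = trans (cong₂ _*_ (e i) (e j)) (sym (^-homo-* x (q ℕ.^ Fin.toℕ i) (q ℕ.^ Fin.toℕ j)))
      where
      e : ∀ i → x ⟨ i ⟩ ≡ x ^ (q ℕ.^ Fin.toℕ i)
      e i = trans (cong (λ c → lookup c i) (conj≡powers x)) (power i x)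

    sparse-correct : ∀ ts x → quadratic ts k x ≡ ⟪ sparse ts ⟫ x
    sparse-correct []                 x = sym (trans (+-identityʳ _) (*-identityʳ k))
    sparse-correct ((c , i , j) ∷ ts) x = cong₂ _+_ (cong (c *_) (exponent i j x)) (sparse-correct ts x)

    bounds : ∀ ts → All (Below i j) ts → All (λ (_ , e) → e < q ℕ.^ Fin.toℕ i ℕ.+ q ℕ.^ Fin.toℕ j) (sparse ts)
    bounds []       []            = ℕ.<-≤-trans (ℕ.m^n>0 q (Fin.toℕ i)) (ℕ.m≤m+n _ _) ∷ []
    bounds (_ ∷ ts) (inj₁ (a , b) ∷ h) = ℕ.+-mono-<-≤ (^-mono a) (ℕ.^-monoʳ-≤ q b) ∷ bounds ts h
    bounds (_ ∷ ts) (inj₂ (a , b) ∷ h) = ℕ.+-mono-≤-< (ℕ.^-monoʳ-≤ q a) (^-mono b) ∷ bounds ts h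

  hermitian-roots : ∀ α β γ k → α ≢ 0# → # (λ x → α * (x * σ x) + β * x + γ * σ x + k ≟ 0#) ≤ q ℕ.+ 1
  hermitian-roots α β γ k α≢0 = root-bound (q ℕ.+ 1) α ((β , 1) ∷ (γ , q) ∷ (k , 0) ∷ []) α≢0
    (ℕ.≤-trans 1<q (ℕ.m≤m+n q 1) ∷ ℕ.≤-reflexive (ℕ.+-comm 1 q) ∷ ℕ.m≤n+m 1 q ∷ []) _
    (λ x → begin
      α * (x * σ x) + β * x + γ * σ x + k
        ≡⟨ solve 6 (λ x x₁ α β γ k → α :* (x :* x₁) :+ β :* x :+ γ :* x₁ :+ k
             := α :* (x₁ :* (x :* con (ℤ.+ 1))) :+ (β :* (x :* con (ℤ.+ 1)) :+ (γ :* x₁ :+ (k :* con (ℤ.+ 1) :+ con (ℤ.+ 0))))) refl x (σ x) α β γ k ⟩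
      α * (σ x * (x * 1#)) + (β * (x * 1#) + (γ * σ x + (k * 1# + 0#)))
        ≡⟨ cong (λ p → α * p + (β * (x * 1#) + (γ * σ x + (k * 1# + 0#)))) (sym (^-homo-* x q 1)) ⟩
      α * x ^ (q ℕ.+ 1) + (β * (x * 1#) + (γ * σ x + (k * 1# + 0#))) ∎)
    where open ≡-Reasoning

  -- Subfields, elements negated by σ, and traces

  Fq K₂ Anti : K → Set
  Fq   x = σ x ≡ x
  K₂   x = σ² x ≡ x
  Anti x = σ x ≡ - x

  Fq? : Decidable Fq
  Fq? x = σ x ≟ x

  K₂? : Decidable K₂
  K₂? x = σ² x ≟ x

  Anti? : Decidable Anti
  Anti? x = σ x ≟ - x

  #Fq≤q : # Fq? ≤ q
  #Fq≤q = ℕ.≤-trans (#-mono Fq? (λ x → linear (- 1# ∷ 1# ∷ []) x + 0# ≟ 0#)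
    (λ x e → trans (solve 2 (λ x y → (:- con (ℤ.+ 1)) :* x :+ (con (ℤ.+ 1) :* y :+ con (ℤ.+ 0)) :+ con (ℤ.+ 0) := y :- x) refl x (σ x)) (x≡y⇒x-y≡0 e)))
    (ℕ.≤-trans (linear-roots (- 1# ∷ []) 1# 0# (λ e → 0≢1 (sym e))) (ℕ.≤-reflexive (ℕ.*-identityʳ q)))

  #Anti≤q : # Anti? ≤ q
  #Anti≤q = ℕ.≤-trans (#-mono Anti? (λ x → linear (1# ∷ 1# ∷ []) x + 0# ≟ 0#)
    (λ x e → trans (solve 2 (λ x y → con (ℤ.+ 1) :* x :+ (con (ℤ.+ 1) :* y :+ con (ℤ.+ 0)) :+ con (ℤ.+ 0) := y :- (:- x)) refl x (σ x)) (x≡y⇒x-y≡0 e)))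
    (ℕ.≤-trans (linear-roots (1# ∷ []) 1# 0# (λ e → 0≢1 (sym e))) (ℕ.≤-reflexive (ℕ.*-identityʳ q)))

  #K₂≤q² : # K₂? ≤ q ℕ.^ 2
  #K₂≤q² = ℕ.≤-trans (#-mono K₂? (λ x → linear (- 1# ∷ 0# ∷ 1# ∷ []) x + 0# ≟ 0#)
    (λ x e → trans (solve 3 (λ x y z → (:- con (ℤ.+ 1)) :* x :+ (con (ℤ.+ 0) :* y :+ (con (ℤ.+ 1) :* z :+ con (ℤ.+ 0))) :+ con (ℤ.+ 0) := z :- x) refl x (σ x) (σ² x)) (x≡y⇒x-y≡0 e)))
    (linear-roots (- 1# ∷ 0# ∷ []) 1# 0# (λ e → 0≢1 (sym e)))

  -- Pigeonhole: `q ^ 6` elements spread over fibres of size at most `q ^ i` need at least `q ^ j`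
  -- values. Degree bounds on fibres thus become lower bounds for the size of a subfield.
  large-image : ∀ {P : K → Set} (P? : Decidable P) (f : K → K) i j → i ℕ.+ j ≡ 6 → (∀ x → P (f x)) →
                (∀ y → # (λ x → f x ≟ y) ≤ q ℕ.^ i) → q ℕ.^ j ≤ # P?
  large-image P? f i j ij into fibre = ℕ.*-cancelʳ-≤ (q ℕ.^ j) (# P?) (q ℕ.^ i) {{ℕ.m^n≢0 q i}} (begin
    q ℕ.^ j ℕ.* q ℕ.^ i    ≡⟨ sym (ℕ.^-distribˡ-+-* q j i) ⟩
    q ℕ.^ (j ℕ.+ i)        ≡⟨ cong (q ℕ.^_) (trans (ℕ.+-comm j i) ij) ⟩
    q ℕ.^ 6                ≡⟨ sym (#-all {n = q ℕ.^ 6} {P = λ _ → 0# ≡ 0#} (λ _ → 0# ≟ 0#) (λ _ → refl)) ⟩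
    # {n = q ℕ.^ 6} (λ _ → 0# ≟ 0#)      ≤⟨ #-≤-fibre (λ _ → 0# ≟ 0#) P? f (q ℕ.^ i) (λ x _ → into x)
                                (λ y _ → ℕ.≤-trans (#-mono _ (λ x → f x ≟ y) (λ x → proj₂)) (fibre y)) ⟩
    # P? ℕ.* q ℕ.^ i       ∎)
    where open ℕ.≤-Reasoning

  -- `altTrace` is the trace for the twisted action `x ↦ - σ x`. Its values are negated by `σ`, and
  -- its kernel is the image of `x ↦ x + σ x`, see `+σ-surjective`.
  trace trace₂ altTrace : K → K
  trace    x = x + σ x + σ² x + σ³ x + σ⁴ x + σ⁵ x
  trace₂   x = x + σ² x + σ⁴ x
  altTrace x = x - σ x + σ² x - σ³ x + σ⁴ x - σ⁵ x

  trace-fibre : ∀ y → # (λ x → trace x ≟ y) ≤ q ℕ.^ 5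
  trace-fibre y = ℕ.≤-trans (#-mono _ (λ x → linear (1# ∷ 1# ∷ 1# ∷ 1# ∷ 1# ∷ 1# ∷ []) x + - y ≟ 0#)
    (λ x e → trans (solve 7 (λ a b c d e f y → let I = con (ℤ.+ 1) in
        I :* a :+ (I :* b :+ (I :* c :+ (I :* d :+ (I :* e :+ (I :* f :+ con (ℤ.+ 0)))))) :- y
        := (a :+ b :+ c :+ d :+ e :+ f) :- y) refl x (σ x) (σ² x) (σ³ x) (σ⁴ x) (σ⁵ x) y) (x≡y⇒x-y≡0 e)))
    (linear-roots (1# ∷ 1# ∷ 1# ∷ 1# ∷ 1# ∷ []) 1# (- y) (λ e → 0≢1 (sym e)))

  altTrace-fibre : ∀ y → # (λ x → altTrace x ≟ y) ≤ q ℕ.^ 5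
  altTrace-fibre y = ℕ.≤-trans (#-mono _ (λ x → linear (1# ∷ - 1# ∷ 1# ∷ - 1# ∷ 1# ∷ - 1# ∷ []) x + - y ≟ 0#)
    (λ x e → trans (solve 7 (λ a b c d e f y → let I = con (ℤ.+ 1); J = :- con (ℤ.+ 1) in
        I :* a :+ (J :* b :+ (I :* c :+ (J :* d :+ (I :* e :+ (J :* f :+ con (ℤ.+ 0)))))) :- y
        := (a :- b :+ c :- d :+ e :- f) :- y) refl x (σ x) (σ² x) (σ³ x) (σ⁴ x) (σ⁵ x) y) (x≡y⇒x-y≡0 e)))
    (linear-roots (1# ∷ - 1# ∷ 1# ∷ - 1# ∷ 1# ∷ []) (- 1#) (- y) (neg≢0 (λ e → 0≢1 (sym e))))

  trace₂-fibre : ∀ y → # (λ x → trace₂ x ≟ y) ≤ q ℕ.^ 4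
  trace₂-fibre y = ℕ.≤-trans (#-mono _ (λ x → linear (1# ∷ 0# ∷ 1# ∷ 0# ∷ 1# ∷ []) x + - y ≟ 0#)
    (λ x e → trans (solve 6 (λ a b c d e y → let I = con (ℤ.+ 1); O = con (ℤ.+ 0) in
        I :* a :+ (O :* b :+ (I :* c :+ (O :* d :+ (I :* e :+ O)))) :- y
        := (a :+ c :+ e) :- y) refl x (σ x) (σ² x) (σ³ x) (σ⁴ x) y) (x≡y⇒x-y≡0 e)))
    (linear-roots (1# ∷ 0# ∷ 1# ∷ 0# ∷ []) 1# (- y) (λ e → 0≢1 (sym e)))

  trace∈Fq : ∀ x → Fq (trace x)
  trace∈Fq x = trans (σ-eval (v 0 :+ v 1 :+ v 2 :+ v 3 :+ v 4 :+ v 5) (conj x))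
    (trans (cong (σ x + σ² x + σ³ x + σ⁴ x + σ⁵ x +_) (σ⁶ x))
      (solve 6 (λ a b c d e f → b :+ c :+ d :+ e :+ f :+ a := a :+ b :+ c :+ d :+ e :+ f) refl x (σ x) (σ² x) (σ³ x) (σ⁴ x) (σ⁵ x)))

  altTrace∈Anti : ∀ x → Anti (altTrace x)
  altTrace∈Anti x = trans (σ-eval (v 0 :- v 1 :+ v 2 :- v 3 :+ v 4 :- v 5) (conj x))
    (trans (cong (λ z → σ x - σ² x + σ³ x - σ⁴ x + σ⁵ x - z) (σ⁶ x))
      (solve 6 (λ a b c d e f → b :- c :+ d :- e :+ f :- a := :- (a :- b :+ c :- d :+ e :- f)) refl x (σ x) (σ² x) (σ³ x) (σ⁴ x) (σ⁵ x)))

  trace₂∈K₂ : ∀ x → K₂ (trace₂ x)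
  trace₂∈K₂ x = trans (cong σ (σ-eval (v 0 :+ v 2 :+ v 4) (conj x)))
    (trans (σ-eval (v 0 :+ v 2 :+ v 4) (conj (σ x)))
    (trans (cong (σ² x + σ⁴ x +_) (σ⁶ x)) (solve 3 (λ a c e → c :+ e :+ a := a :+ c :+ e) refl x (σ² x) (σ⁴ x))))

  q≤#Anti : q ≤ # Anti?
  q≤#Anti = ℕ.≤-trans (ℕ.≤-reflexive (sym (ℕ.*-identityʳ q))) (large-image Anti? altTrace 5 1 refl altTrace∈Anti altTrace-fibre)

  q²≤#K₂ : q ℕ.^ 2 ≤ # K₂?
  q²≤#K₂ = large-image K₂? trace₂ 4 2 refl trace₂∈K₂ trace₂-fibre

  Fq-0 : Fq 0#
  Fq-0 = σ.φ-0

  K₂-σ : ∀ {x} → K₂ x → K₂ (σ x)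
  K₂-σ = cong σ

  Fq⇒K₂ : ∀ {x} → Fq x → K₂ x
  Fq⇒K₂ e = trans (cong σ e) e

  Anti⇒K₂ : ∀ {x} → Anti x → K₂ x
  Anti⇒K₂ {x} e = trans (cong σ e) (trans (σ.φ-neg x) (trans (cong -_ e) (-‿involutive x)))

  Fq-inv : ∀ {x} → x ≢ 0# → Fq x → Fq (inv x)
  Fq-inv {x} h e = *-cancelˡ h (trans (cong (_* σ (inv x)) (sym e)) (trans (sym (σ.φ-* x (inv x)))
    (trans (cong σ (inverseʳ h)) (trans σ.φ-1 (sym (inverseʳ h))))))

  σ-inv : ∀ {x} → x ≢ 0# → σ (inv x) ≡ inv (σ x)
  σ-inv {x} h = *-cancelˡ (σ-≢0 h) (trans (sym (σ.φ-* x (inv x)))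
    (trans (cong σ (inverseʳ h)) (trans σ.φ-1 (sym (inverseʳ (σ-≢0 h))))))

  -- The quadratic form altTrace (δ t σt)

  σ⁵-hom : RingHom σ⁵
  σ⁵-hom = record
    { φ-+ = λ x y → trans (cong (λ z → σ (σ (σ (σ z)))) (σ.φ-+ x y)) (trans (cong (λ z → σ (σ (σ z))) (σ.φ-+ _ _))
        (trans (cong (λ z → σ (σ z)) (σ.φ-+ _ _)) (trans (cong σ (σ.φ-+ _ _)) (σ.φ-+ _ _))))
    ; φ-* = λ x y → trans (cong (λ z → σ (σ (σ (σ z)))) (σ.φ-* x y)) (trans (cong (λ z → σ (σ (σ z))) (σ.φ-* _ _))
        (trans (cong (λ z → σ (σ z)) (σ.φ-* _ _)) (trans (cong σ (σ.φ-* _ _)) (σ.φ-* _ _))))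
    ; φ-1 = trans (cong (λ z → σ (σ (σ (σ z)))) σ.φ-1) (trans (cong (λ z → σ (σ (σ z))) σ.φ-1)
        (trans (cong (λ z → σ (σ z)) σ.φ-1) (trans (cong σ σ.φ-1) σ.φ-1)))
    }

  altTrace-+ : ∀ x y → altTrace (x + y) ≡ altTrace x + altTrace y
  altTrace-+ x y = begin
    altTrace (x + y)
      ≡⟨ cong (λ (a , b , c , d , e) → x + y - a + b - c + d - e)
           (cong₂ _,_ e1 (cong₂ _,_ e2 (cong₂ _,_ e3 (cong₂ _,_ e4 e5)))) ⟩
    x + y - (σ x + σ y) + (σ² x + σ² y) - (σ³ x + σ³ y) + (σ⁴ x + σ⁴ y) - (σ⁵ x + σ⁵ y)
      ≡⟨ solve 12 (λ a b c d e f a′ b′ c′ d′ e′ f′ →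
           a :+ a′ :- (b :+ b′) :+ (c :+ c′) :- (d :+ d′) :+ (e :+ e′) :- (f :+ f′)
           := (a :- b :+ c :- d :+ e :- f) :+ (a′ :- b′ :+ c′ :- d′ :+ e′ :- f′)) refl
           x (σ x) (σ² x) (σ³ x) (σ⁴ x) (σ⁵ x) y (σ y) (σ² y) (σ³ y) (σ⁴ y) (σ⁵ y) ⟩
    altTrace x + altTrace y ∎
    where
    open ≡-Reasoning
    e1 = σ.φ-+ x y
    e2 = trans (cong σ e1) (σ.φ-+ _ _)
    e3 = trans (cong σ e2) (σ.φ-+ _ _)
    e4 = trans (cong σ e3) (σ.φ-+ _ _)
    e5 = trans (cong σ e4) (σ.φ-+ _ _)

  altTrace-* : ∀ {c} → Fq c → ∀ x → altTrace (c * x) ≡ c * altTrace x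
  altTrace-* {c} h x = begin
    altTrace (c * x)
      ≡⟨ cong (λ (a , b , p , d , e) → c * x - a + b - p + d - e)
           (cong₂ _,_ e1 (cong₂ _,_ e2 (cong₂ _,_ e3 (cong₂ _,_ e4 e5)))) ⟩
    c * x - c * σ x + c * σ² x - c * σ³ x + c * σ⁴ x - c * σ⁵ x
      ≡⟨ solve 7 (λ k a b c d e f → k :* a :- k :* b :+ k :* c :- k :* d :+ k :* e :- k :* f
           := k :* (a :- b :+ c :- d :+ e :- f)) refl c x (σ x) (σ² x) (σ³ x) (σ⁴ x) (σ⁵ x) ⟩
    c * altTrace x ∎
    where
    open ≡-Reasoning
    step : ∀ y → σ (c * y) ≡ c * σ y
    step y = trans (σ.φ-* c y) (cong (_* σ y) h)
    e1 = step x
    e2 = trans (cong σ e1) (step (σ x))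
    e3 = trans (cong σ e2) (step (σ² x))
    e4 = trans (cong σ e3) (step (σ³ x))
    e5 = trans (cong σ e4) (step (σ⁴ x))

  altTrace-σ⁵ : ∀ x → altTrace (σ⁵ x) ≡ - altTrace x
  altTrace-σ⁵ x = begin
    altTrace (σ⁵ x)
      ≡⟨ cong (λ z → σ⁵ x - z + σ z - σ² z + σ³ z - σ⁴ z) (σ⁶ x) ⟩
    σ⁵ x - x + σ x - σ² x + σ³ x - σ⁴ x
      ≡⟨ solve 6 (λ a b c d e f → f :- a :+ b :- c :+ d :- e := :- (a :- b :+ c :- d :+ e :- f)) refl
           x (σ x) (σ² x) (σ³ x) (σ⁴ x) (σ⁵ x) ⟩
    - altTrace x ∎
    where open ≡-Reasoning

  module _ (δ : K) (δ≢0 : δ ≢ 0#) where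

    Q : K → K
    Q t = altTrace (δ * (t * σ t))

    polar : K → K → K
    polar u v = altTrace (δ * (u * σ v + v * σ u))

    gradient : K → K
    gradient v = δ * σ v - σ⁵ (δ * v)

    Q-line : ∀ {c} → Fq c → ∀ u v → Q (u + c * v) ≡ Q u + c * polar u v + (c * c) * Q v
    Q-line {c} h u v = begin
      altTrace (δ * ((u + c * v) * σ (u + c * v)))
        ≡⟨ cong (λ z → altTrace (δ * ((u + c * v) * z))) (trans (σ.φ-+ u (c * v)) (cong (σ u +_) (trans (σ.φ-* c v) (cong (_* σ v) h)))) ⟩
      altTrace (δ * ((u + c * v) * (σ u + c * σ v)))
        ≡⟨ cong altTrace (solve 6 (λ d c u v u′ v′ → d :* ((u :+ c :* v) :* (u′ :+ c :* v′))
             := d :* (u :* u′) :+ c :* (d :* (u :* v′ :+ v :* u′)) :+ (c :* c) :* (d :* (v :* v′))) refl δ c u v (σ u) (σ v)) ⟩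
      altTrace (δ * (u * σ u) + c * (δ * (u * σ v + v * σ u)) + (c * c) * (δ * (v * σ v)))
        ≡⟨ trans (altTrace-+ _ _) (cong₂ _+_ (trans (altTrace-+ _ _) (cong (Q u +_) (altTrace-* h _))) (altTrace-* cc _)) ⟩
      Q u + c * polar u v + (c * c) * Q v ∎
      where
      open ≡-Reasoning
      cc : Fq (c * c)
      cc = trans (σ.φ-* c c) (cong₂ _*_ h h)

    -- `altTrace` changes sign under `σ⁵`, the inverse of `σ`; applying this to the second summand
    -- takes `σ` off `u`. So `v` lies in the radical of the polar form if its gradient vanishes, and
    -- a nonzero gradient leaves at most `q⁵` vectors orthogonal to `v`.
    polar-gradient : ∀ u v → polar u v ≡ altTrace (u * gradient v)
    polar-gradient u v = begin
      altTrace (δ * (u * σ v + v * σ u))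
        ≡⟨ cong altTrace (solve 5 (λ d u v u′ v′ → d :* (u :* v′ :+ v :* u′) := u :* (d :* v′) :+ (d :* v) :* u′) refl δ u v (σ u) (σ v)) ⟩
      altTrace (u * (δ * σ v) + (δ * v) * σ u)
        ≡⟨ trans (altTrace-+ _ _) (cong (altTrace (u * (δ * σ v)) +_) shift) ⟩
      altTrace (u * (δ * σ v)) + altTrace (- (σ⁵ (δ * v) * u))
        ≡⟨ sym (altTrace-+ _ _) ⟩
      altTrace (u * (δ * σ v) + - (σ⁵ (δ * v) * u))
        ≡⟨ cong altTrace (solve 3 (λ u a b → u :* a :+ :- (b :* u) := u :* (a :- b)) refl u (δ * σ v) (σ⁵ (δ * v))) ⟩
      altTrace (u * gradient v) ∎
      where
      open ≡-Reasoning
      altTrace-neg : ∀ x → altTrace (- x) ≡ - altTrace x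
      altTrace-neg x = trans (cong altTrace (solve 1 (λ x → :- x := (:- con (ℤ.+ 1)) :* x) refl x))
        (trans (altTrace-* (trans (σ.φ-neg 1#) (cong -_ σ.φ-1)) x) (solve 1 (λ x → (:- con (ℤ.+ 1)) :* x := :- x) refl _))
      shift : altTrace ((δ * v) * σ u) ≡ altTrace (- (σ⁵ (δ * v) * u))
      shift = begin
        altTrace ((δ * v) * σ u)                  ≡⟨ sym (-‿involutive _) ⟩
        - - altTrace ((δ * v) * σ u)              ≡⟨ cong -_ (sym (altTrace-σ⁵ _)) ⟩
        - altTrace (σ⁵ ((δ * v) * σ u))           ≡⟨ cong (λ z → - altTrace z) (trans (RingHom.φ-* σ⁵-hom _ _) (cong (σ⁵ (δ * v) *_) (σ⁶ u))) ⟩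
        - altTrace (σ⁵ (δ * v) * u)               ≡⟨ sym (altTrace-neg _) ⟩
        altTrace (- (σ⁵ (δ * v) * u))             ∎

    #-proportional : # (λ t → σ δ * σ² t ≟ δ * t) ≤ q ℕ.^ 2
    #-proportional = ℕ.≤-trans (#-mono _ (λ t → linear (- δ ∷ 0# ∷ σ δ ∷ []) t + 0# ≟ 0#) (λ t e →
        trans (solve 5 (λ d d₁ t t₁ t₂ → (:- d) :* t :+ (con (ℤ.+ 0) :* t₁ :+ (d₁ :* t₂ :+ con (ℤ.+ 0))) :+ con (ℤ.+ 0) := d₁ :* t₂ :- d :* t) refl δ (σ δ) t (σ t) (σ² t))
          (x≡y⇒x-y≡0 e)))
      (linear-roots (- δ ∷ 0# ∷ []) (σ δ) 0# (σ-≢0 δ≢0))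

    #-gradient-zero : # (λ t → gradient t ≟ 0#) ≤ q ℕ.^ 2
    #-gradient-zero = ℕ.≤-trans (#-mono _ (λ t → σ δ * σ² t ≟ δ * t) (λ t e →
      -- Applying `σ` to `δ σt = σ⁵ (δ t)` turns the vanishing of the gradient into an equation of
      -- degree `q²`. The same equation returns in `Good`, where it detects `s ∈ K₂ m`.
      trans (sym (σ.φ-* δ (σ t))) (trans (cong σ (x-y≡0⇒x≡y e)) (σ⁶ (δ * t))))) #-proportional

    Q-expand : ∀ t → Q t ≡ δ * (t * σ t) - σ δ * (σ t * σ² t) + σ² δ * (σ² t * σ³ t)
                           - σ³ δ * (σ³ t * σ⁴ t) + σ⁴ δ * (σ⁴ t * σ⁵ t) - σ⁵ δ * (σ⁵ t * t)
    Q-expand t = cong (λ (a , b , c , d , e) → δ * (t * σ t) - a + b - c + d - e)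
      (cong₂ _,_ e1 (cong₂ _,_ e2 (cong₂ _,_ e3 (cong₂ _,_ e4 e5))))
      where
      step : ∀ d x y → σ (d * (x * y)) ≡ σ d * (σ x * σ y)
      step d x y = trans (σ.φ-* d _) (cong (σ d *_) (σ.φ-* x y))
      e1 = step δ t (σ t)
      e2 = trans (cong σ e1) (step (σ δ) (σ t) (σ² t))
      e3 = trans (cong σ e2) (step (σ² δ) (σ² t) (σ³ t))
      e4 = trans (cong σ e3) (step (σ³ δ) (σ³ t) (σ⁴ t))
      e5 = trans (trans (cong σ e4) (step (σ⁴ δ) (σ⁴ t) (σ⁵ t))) (cong (λ z → σ⁵ δ * (σ⁵ t * z)) (σ⁶ t))

    -- The last summand wraps around to `t σ⁵t` because `σ⁶` is the identity, so the largest
    -- exponent is `q⁴ + q⁵`, with coefficient `σ⁴ δ`.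
    Q-fibre : ∀ y → # (λ t → Q t ≟ y) ≤ q ℕ.^ 4 ℕ.+ q ℕ.^ 5
    Q-fibre y = ℕ.≤-trans (#-mono _ (λ t → quadratic ((σ⁴ δ , Fin.#_ 4 , Fin.#_ 5) ∷ ts) (- y) t ≟ 0#)
      (λ t e → trans (trans (cong₂ (λ (b , d) f → σ⁴ δ * (σ⁴ t * σ⁵ t) + (δ * (t * σ t) + (b + (σ² δ * (σ² t * σ³ t) + (d + (f - y))))))
             (cong₂ _,_ (sym (-‿distribˡ-* _ _)) (sym (-‿distribˡ-* _ _))) (trans (sym (-‿distribˡ-* _ _)) (cong (λ z → - (σ⁵ δ * z)) (*-comm t (σ⁵ t)))))
           (solve 7 (λ a b c d e f y → e :+ (a :+ (:- b :+ (c :+ (:- d :+ (:- f :- y))))) := (a :- b :+ c :- d :+ e :- f) :- y) refl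
             (δ * (t * σ t)) (σ δ * (σ t * σ² t)) (σ² δ * (σ² t * σ³ t)) (σ³ δ * (σ³ t * σ⁴ t)) (σ⁴ δ * (σ⁴ t * σ⁵ t)) (σ⁵ δ * (σ⁵ t * t)) y))
         (x≡y⇒x-y≡0 (trans (sym (Q-expand t)) e))))
      (quadratic-roots (σ⁴ δ) (Fin.#_ 4) (Fin.#_ 5) ts (- y) (σ-≢0 (σ-≢0 (σ-≢0 (σ-≢0 δ≢0)))))
      where
      
      ts = (δ , Fin.#_ 0 , Fin.#_ 1) ∷ (- σ δ , Fin.#_ 1 , Fin.#_ 2) ∷ (σ² δ , Fin.#_ 2 , Fin.#_ 3) ∷ (- σ³ δ , Fin.#_ 3 , Fin.#_ 4) ∷ (- σ⁵ δ , Fin.#_ 0 , Fin.#_ 5) ∷ []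

    isotropic? : ∀ t → Dec (Q t ≡ 0#)
    isotropic? t = Q t ≟ 0#

    private
      Anti-nonzero? : ∀ y → Dec (Anti y × y ≢ 0#)
      Anti-nonzero? y = Anti? y ×-dec ¬? (y ≟ 0#)

      #Anti-nonzero : # Anti-nonzero? ℕ.+ 1 ≤ q
      #Anti-nonzero = ℕ.≤-trans (ℕ.≤-trans (ℕ.≤-reflexive (cong (# Anti-nonzero? ℕ.+_) (sym (#-≡ 0#))))
        (#-disjoint Anti-nonzero? (0# ≟_) Anti? (λ _ → proj₁) (λ { _ refl → trans σ.φ-0 (sym -0#≈0#) }) (λ _ (_ , h) e → h (sym e)))) #Anti≤q

      -- A crude first count: `Q` has at most `q - 1` nonzero values, each taken at most `q⁴ + q⁵`
      -- times, and `q⁶ - (q - 1)(q⁴ + q⁵) = q⁴`. This exceeds the bound `q²` for the zeros of the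
      -- gradient, so some isotropic vector has a nonzero gradient; the sharp count starts from it.
      q⁴≤#isotropic : q ℕ.^ 4 ≤ # isotropic?
      q⁴≤#isotropic = ℕ.+-cancelʳ-≤ (M ℕ.* (q ℕ.^ 4 ℕ.+ q ℕ.^ 5)) _ _ (ℕ.≤-trans cap total)
        where
        M = # Anti-nonzero?
        total : q ℕ.^ 6 ≤ # isotropic? ℕ.+ M ℕ.* (q ℕ.^ 4 ℕ.+ q ℕ.^ 5)
        total = begin
          q ℕ.^ 6                                                        ≡⟨ sym (#-all {n = q ℕ.^ 6} (λ t → 0# ≟ 0#) (λ _ → refl)) ⟩
          # {n = q ℕ.^ 6} (λ t → 0# ≟ 0#)                                ≤⟨ #-⊎ _ isotropic? (λ t → ¬? (isotropic? t)) split ⟩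
          # isotropic? ℕ.+ # (λ t → ¬? (isotropic? t))                   ≤⟨ ℕ.+-monoʳ-≤ (# isotropic?) (#-≤-fibre (λ t → ¬? (isotropic? t)) Anti-nonzero? Q _
                                                                              (λ t h → altTrace∈Anti _ , h) (λ y _ → ℕ.≤-trans (#-mono _ (λ t → Q t ≟ y) (λ _ → proj₂)) (Q-fibre y))) ⟩
          # isotropic? ℕ.+ M ℕ.* (q ℕ.^ 4 ℕ.+ q ℕ.^ 5)                   ∎
          where
          open ℕ.≤-Reasoning
          split : ∀ t → 0# ≡ 0# → Q t ≡ 0# ⊎ Q t ≢ 0#
          split t _ with isotropic? t
          ... | yes e = inj₁ e
          ... | no  h = inj₂ h
        cap : q ℕ.^ 4 ℕ.+ M ℕ.* (q ℕ.^ 4 ℕ.+ q ℕ.^ 5) ≤ q ℕ.^ 6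
        cap = ℕ.+-cancelʳ-≤ (q ℕ.^ 5) _ _ (begin
          q ℕ.^ 4 ℕ.+ M ℕ.* (q ℕ.^ 4 ℕ.+ q ℕ.^ 5) ℕ.+ q ℕ.^ 5    ≡⟨ +-*-Solver.solve 3 (λ x y m → x ∶+ m ∶* (x ∶+ y) ∶+ y ∶= (m ∶+ +-*-Solver.con 1) ∶* (x ∶+ y)) refl (q ℕ.^ 4) (q ℕ.^ 5) M ⟩
          (M ℕ.+ 1) ℕ.* (q ℕ.^ 4 ℕ.+ q ℕ.^ 5)                    ≤⟨ ℕ.*-monoˡ-≤ _ #Anti-nonzero ⟩
          q ℕ.* (q ℕ.^ 4 ℕ.+ q ℕ.^ 5)                            ≡⟨ trans (ℕ.*-distribˡ-+ q (q ℕ.^ 4) (q ℕ.^ 5)) (ℕ.+-comm (q ℕ.^ 5) (q ℕ.^ 6)) ⟩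
          q ℕ.^ 6 ℕ.+ q ℕ.^ 5                                    ∎)
          where
          open ℕ.≤-Reasoning
          open +-*-Solver using () renaming (_:+_ to _∶+_; _:*_ to _∶*_; _:=_ to _∶=_)

      regular-isotropic : ∃ λ v → Q v ≡ 0# × gradient v ≢ 0#
      regular-isotropic = ∃-of-# isotropic? (λ v → gradient v ≟ 0#)
        (ℕ.≤-trans (s≤s #-gradient-zero) (ℕ.≤-trans (^-mono {2} {4} (s≤s (s≤s (s≤s z≤n)))) q⁴≤#isotropic))

      Anti-ratio : ∀ {b c} → b ≢ 0# → Anti b → Anti (c * b) → Fq c
      Anti-ratio {b} {c} h eb ecb = *-cancelˡ (neg≢0 h) (begin
        (- b) * σ c      ≡⟨ cong (_* σ c) (sym eb) ⟩
        σ b * σ c        ≡⟨ trans (*-comm _ _) (sym (σ.φ-* c b)) ⟩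
        σ (c * b)        ≡⟨ ecb ⟩
        - (c * b)        ≡⟨ solve 2 (λ b c → :- (c :* b) := (:- b) :* c) refl b c ⟩
        (- b) * c        ∎)
        where open ≡-Reasoning

    -- Every u with polar(u, v) ≠ 0 lies on a line through the isotropic vector v that carries a second isotropic vector.
    #isotropic-from : ∀ v₀ → Q v₀ ≡ 0# → gradient v₀ ≢ 0# → q ℕ.^ 6 ≤ # isotropic? ℕ.* q ℕ.+ q ℕ.^ 5
    #isotropic-from v₀ Qv g≢0 = begin
      q ℕ.^ 6                                               ≡⟨ sym (#-all {n = q ℕ.^ 6} (λ t → 0# ≟ 0#) (λ _ → refl)) ⟩
      # {n = q ℕ.^ 6} (λ t → 0# ≟ 0#)                       ≤⟨ #-⊎ _ (λ u → ¬? (orthogonal? u)) orthogonal? split ⟩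
      # (λ u → ¬? (orthogonal? u)) ℕ.+ # orthogonal?        ≤⟨ ℕ.+-mono-≤ (#-≤-fibre (λ u → ¬? (orthogonal? u)) isotropic? project q project-isotropic (λ y _ → fibre y)) #orthogonal ⟩
      # isotropic? ℕ.* q ℕ.+ q ℕ.^ 5                         ∎
      where
      open ℕ.≤-Reasoning
      orthogonal? : ∀ u → Dec (polar u v₀ ≡ 0#)
      orthogonal? u = polar u v₀ ≟ 0#

      split : ∀ u → 0# ≡ 0# → polar u v₀ ≢ 0# ⊎ polar u v₀ ≡ 0#
      split u _ with orthogonal? u
      ... | yes e = inj₂ e
      ... | no  h = inj₁ h

      #orthogonal : # orthogonal? ≤ q ℕ.^ 5
      #orthogonal = ℕ.≤-trans (#-injective orthogonal? (λ x → altTrace x ≟ 0#) (_* gradient v₀)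
        (λ u e → trans (sym (polar-gradient u v₀)) e)
        (λ i j _ _ e → *-cancelˡ g≢0 (trans (*-comm _ i) (trans e (*-comm j _))))) (altTrace-fibre 0#)

      c : K → K
      c u = - (Q u * inv (polar u v₀))

      project : K → K
      project u = u + c u * v₀

      c-polar : ∀ u → polar u v₀ ≢ 0# → c u * polar u v₀ ≡ - Q u
      c-polar u h = trans (solve 3 (λ a i b → (:- (a :* i)) :* b := :- (a :* (b :* i))) refl (Q u) (inv (polar u v₀)) (polar u v₀))
        (cong -_ (trans (cong (Q u *_) (inverseʳ h)) (*-identityʳ _)))

      -- `Q u` and `polar u v₀` are both negated by `σ`, so their quotient is fixed. This is what
      -- makes `Q-line` applicable, and it leaves at most `q` vectors `u` over each projection.
      c∈Fq : ∀ u → polar u v₀ ≢ 0# → Fq (c u)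
      c∈Fq u h = Anti-ratio h (altTrace∈Anti _) (trans (cong σ (c-polar u h)) (trans (σ.φ-neg (Q u))
        (trans (cong -_ (altTrace∈Anti _)) (sym (cong -_ (c-polar u h))))))

      project-isotropic : ∀ u → polar u v₀ ≢ 0# → Q (project u) ≡ 0#
      project-isotropic u h = trans (Q-line (c∈Fq u h) u v₀)
        (trans (cong₂ (λ x y → Q u + x + (c u * c u) * y) (c-polar u h) Qv)
          (solve 2 (λ a c → a :+ (:- a) :+ c :* con (ℤ.+ 0) := con (ℤ.+ 0)) refl (Q u) (c u * c u)))

      fibre : ∀ y → # (λ u → ¬? (orthogonal? u) ×-dec (project u ≟ y)) ≤ q
      fibre y = ℕ.≤-trans (#-injective (λ u → ¬? (orthogonal? u) ×-dec (project u ≟ y)) Fq? c (λ u (h , _) → c∈Fq u h)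
        (λ i j (_ , ei) (_ , ej) e → +-cancelʳ i j (c j * v₀)
          (trans (cong (λ z → i + z * v₀) (sym e)) (trans ei (sym ej))))) #Fq≤q
        where
        +-cancelʳ : ∀ a b k → a + k ≡ b + k → a ≡ b
        +-cancelʳ a b k e = trans (solve 2 (λ a k → a := (a :+ k) :- k) refl a k) (trans (cong (_- k) e) (solve 2 (λ a k → (a :+ k) :- k := a) refl b k))

    #isotropic-bound : q ℕ.^ 6 ≤ # isotropic? ℕ.* q ℕ.+ q ℕ.^ 5
    #isotropic-bound = #isotropic-from (proj₁ regular-isotropic) (proj₁ (proj₂ regular-isotropic)) (proj₂ (proj₂ regular-isotropic))

  -- Hermitian circles in K₂

  module _ (α κ γ : K) (α∈Fq : Fq α) (κ∈Fq : Fq κ) (γ∈K₂ : K₂ γ) (nondegenerate : γ * σ γ ≢ α * κ) where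

    private
      f : K → K
      f w = α * (w * σ w) + γ * w + σ γ * σ w

    OnCircle : K → Set
    OnCircle w = K₂ w × α * (w * σ w) + γ * w + σ γ * σ w + κ ≡ 0#

    onCircle? : ∀ w → Dec (OnCircle w)
    onCircle? w = K₂? w ×-dec (α * (w * σ w) + γ * w + σ γ * σ w + κ ≟ 0#)

    private
      f∈Fq : ∀ w → K₂ w → Fq (f w)
      f∈Fq w h = trans (σ-eval (v 0 :* (v 1 :* v 2) :+ v 3 :* v 1 :+ v 4 :* v 2) (α ∷ w ∷ σ w ∷ γ ∷ σ γ ∷ []))
        (trans (cong₂ (λ a (w₂ , γ₂) → a * (σ w * w₂) + σ γ * σ w + γ₂ * w₂) α∈Fq (cong₂ _,_ h γ∈K₂))
          (solve 5 (λ a w w₁ g g₁ → a :* (w₁ :* w) :+ g₁ :* w₁ :+ g :* w := a :* (w :* w₁) :+ g :* w :+ g₁ :* w₁) refl α w (σ w) γ (σ γ)))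

      -- The equation is f w = − κ; the other values of f are spread over the q − 1 other elements of Fq.
      others? : ∀ w → Dec (K₂ w × f w ≢ - κ)
      others? w = K₂? w ×-dec ¬? (f w ≟ - κ)

      K₂-split : q ℕ.^ 2 ≤ # onCircle? ℕ.+ # others?
      K₂-split = ℕ.≤-trans q²≤#K₂ (#-⊎ K₂? onCircle? others? split)
        where
        split : ∀ w → K₂ w → OnCircle w ⊎ (K₂ w × f w ≢ - κ)
        split w h with f w ≟ - κ
        ... | yes e = inj₁ (h , trans (cong (_+ κ) e) (-‿inverseˡ κ))
        ... | no  n = inj₂ (h , n)

      -κ∈Fq : Fq (- κ)
      -κ∈Fq = trans (σ.φ-neg κ) (cong -_ κ∈Fq)

      Fq-not? : ∀ y → Dec (Fq y × y ≢ - κ)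
      Fq-not? y = Fq? y ×-dec ¬? (y ≟ - κ)

      #Fq-not : # Fq-not? ℕ.+ 1 ≤ q
      #Fq-not = ℕ.≤-trans (ℕ.≤-trans (ℕ.≤-reflexive (cong (# Fq-not? ℕ.+_) (sym (#-≡ (- κ)))))
        (#-disjoint Fq-not? (- κ ≟_) Fq? (λ _ → proj₁) (λ { _ refl → -κ∈Fq }) (λ _ (_ , h) e → h (sym e)))) #Fq≤q

      -- Without the quadratic term `f` is additive and nonzero, with fibres of size at most `q`:
      -- what remains is `q² - (q - 1) q = q`.
      degenerate : α ≡ 0# → q ≤ # onCircle?
      degenerate refl = ℕ.+-cancelʳ-≤ (M ℕ.* q) _ _ (begin
        q ℕ.+ M ℕ.* q                           ≡⟨ cong (ℕ._* q) (ℕ.+-comm 1 M) ⟩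
        (M ℕ.+ 1) ℕ.* q                         ≤⟨ ℕ.*-monoˡ-≤ q #Fq-not ⟩
        q ℕ.* q                                 ≡⟨ cong (q ℕ.*_) (sym (ℕ.*-identityʳ q)) ⟩
        q ℕ.^ 2                                 ≤⟨ K₂-split ⟩
        # onCircle? ℕ.+ # others?               ≤⟨ ℕ.+-monoʳ-≤ (# onCircle?) (#-≤-fibre others? Fq-not? f q (λ w (h , n) → f∈Fq w h , n) (λ y _ → fibre y)) ⟩
        # onCircle? ℕ.+ M ℕ.* q                 ∎)
        where
        open ℕ.≤-Reasoning
        M = # Fq-not?
        γ≢0 : γ ≢ 0#
        γ≢0 refl = nondegenerate (trans (zeroˡ _) (sym (zeroˡ κ)))
        fibre : ∀ y → # (λ w → others? w ×-dec (f w ≟ y)) ≤ q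
        fibre y = ℕ.≤-trans (#-mono _ (λ w → linear (γ ∷ σ γ ∷ []) w + (- y) ≟ 0#)
          (λ w (_ , e) → trans (solve 5 (λ w w₁ g g₁ y → g :* w :+ (g₁ :* w₁ :+ con (ℤ.+ 0)) :- y := con (ℤ.+ 0) :* (w :* w₁) :+ g :* w :+ g₁ :* w₁ :- y) refl w (σ w) γ (σ γ) y)
            (x≡y⇒x-y≡0 e)))
          (ℕ.≤-trans (linear-roots (γ ∷ []) (σ γ) (- y) (σ-≢0 γ≢0)) (ℕ.≤-reflexive (ℕ.*-identityʳ q)))

      -- Completing the square gives `α f w + γ σγ = (α w + σγ) σ(α w + σγ)`. The value `centre`,
      -- where this norm is zero, is taken at most once, and nondegeneracy says exactly that it
      -- differs from `- κ`. The at most `q - 2` other wrong values have fibres of size at most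
      -- `q + 1`, leaving `q² - 1 - (q - 2)(q + 1) = q + 1` points.
      module Proper (α≢0 : α ≢ 0#) where
        centre : K
        centre = - (γ * σ γ) * inv α

        α-centre : α * centre ≡ - (γ * σ γ)
        α-centre = trans (solve 3 (λ a i n → a :* (n :* i) := n :* (a :* i)) refl α (inv α) (- (γ * σ γ)))
          (trans (cong (- (γ * σ γ) *_) (inverseʳ α≢0)) (*-identityʳ _))

        Value : K → Set
        Value y = (Fq y × y ≢ - κ) × y ≢ centre

        value? : ∀ y → Dec (Value y)
        value? y = Fq-not? y ×-dec ¬? (y ≟ centre)

        centre∈Fq : Fq centre
        centre∈Fq = *-cancelˡ α≢0 (begin
          α * σ centre            ≡⟨ cong (_* σ centre) (sym α∈Fq) ⟩
          σ α * σ centre          ≡⟨ trans (sym (σ.φ-* α centre)) (cong σ α-centre) ⟩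
          σ (- (γ * σ γ))         ≡⟨ trans (σ.φ-neg _) (cong -_ (trans (σ.φ-* γ (σ γ)) (trans (cong (σ γ *_) γ∈K₂) (*-comm _ _)))) ⟩
          - (γ * σ γ)             ≡⟨ sym α-centre ⟩
          α * centre              ∎)
          where open ≡-Reasoning

        centre≢-κ : centre ≢ - κ
        centre≢-κ e = nondegenerate (begin
          γ * σ γ          ≡⟨ sym (-‿involutive _) ⟩
          - - (γ * σ γ)    ≡⟨ cong -_ (sym α-centre) ⟩
          - (α * centre)   ≡⟨ cong (λ z → - (α * z)) e ⟩
          - (α * - κ)      ≡⟨ solve 2 (λ a k → :- (a :* (:- k)) := a :* k) refl α κ ⟩
          α * κ            ∎)
          where open ≡-Reasoning

        #value : # value? ℕ.+ 2 ≤ q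
        #value = begin
          # value? ℕ.+ 2                ≡⟨ sym (ℕ.+-assoc (# value?) 1 1) ⟩
          # value? ℕ.+ 1 ℕ.+ 1          ≡⟨ cong (λ z → # value? ℕ.+ z ℕ.+ 1) (sym (#-≡ centre)) ⟩
          # value? ℕ.+ # (centre ≟_) ℕ.+ 1
            ≤⟨ ℕ.+-monoˡ-≤ 1 (#-disjoint value? (centre ≟_) Fq-not? (λ _ → proj₁) (λ { _ refl → centre∈Fq , centre≢-κ }) (λ _ (_ , h) e → h (sym e))) ⟩
          # Fq-not? ℕ.+ 1               ≤⟨ #Fq-not ⟩
          q                             ∎
          where open ℕ.≤-Reasoning

        fibre : ∀ y → # (λ w → f w ≟ y) ≤ q ℕ.+ 1
        fibre y = ℕ.≤-trans (#-mono _ (λ w → f w + - y ≟ 0#) (λ w → x≡y⇒x-y≡0)) (hermitian-roots α γ (σ γ) (- y) α≢0)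

        centre-fibre : # (λ w → K₂? w ×-dec (f w ≟ centre)) ≤ 1
        centre-fibre = #-singleton _ (λ i j h k → *-cancelˡ α≢0 (+-cancel (trans (vanish i h) (sym (vanish j k)))))
          where
          +-cancel : ∀ {x y} → x + σ γ ≡ y + σ γ → x ≡ y
          +-cancel {x} {y} e = trans (solve 2 (λ x g → x := x :+ g :- g) refl x (σ γ)) (trans (cong (_- σ γ) e) (solve 2 (λ x g → x :+ g :- g := x) refl y (σ γ)))
          vanish : ∀ w → K₂ w × f w ≡ centre → α * w + σ γ ≡ 0#
          vanish w (h , e) = norm-zero (begin
            (α * w + σ γ) * σ (α * w + σ γ)
              ≡⟨ cong ((α * w + σ γ) *_) (trans (σ.φ-+ _ _) (cong₂ _+_ (trans (σ.φ-* α w) (cong (_* σ w) α∈Fq)) γ∈K₂)) ⟩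
            (α * w + σ γ) * (α * σ w + γ)
              ≡⟨ solve 5 (λ a w w₁ g g₁ → (a :* w :+ g₁) :* (a :* w₁ :+ g) := a :* (a :* (w :* w₁) :+ g :* w :+ g₁ :* w₁) :+ g :* g₁) refl α w (σ w) γ (σ γ) ⟩
            α * f w + γ * σ γ              ≡⟨ cong (λ z → α * z + γ * σ γ) e ⟩
            α * centre + γ * σ γ           ≡⟨ cong (_+ γ * σ γ) α-centre ⟩
            - (γ * σ γ) + γ * σ γ          ≡⟨ -‿inverseˡ _ ⟩
            0#                             ∎)
            where
            open ≡-Reasoning
            norm-zero : ∀ {x} → x * σ x ≡ 0# → x ≡ 0#
            norm-zero {x} e with x ≟ 0#
            ... | yes z = z
            ... | no  n = contradiction e (*-≢0 n (σ-≢0 n))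

        #others : # others? ≤ 1 ℕ.+ # value? ℕ.* (q ℕ.+ 1)
        #others = ℕ.≤-trans (#-⊎ others? (λ w → K₂? w ×-dec (f w ≟ centre)) (λ w → others? w ×-dec ¬? (f w ≟ centre)) split)
          (ℕ.+-mono-≤ centre-fibre (#-≤-fibre (λ w → others? w ×-dec ¬? (f w ≟ centre)) value? f (q ℕ.+ 1)
            (λ w ((h , n) , n′) → (f∈Fq w h , n) , n′) (λ y _ → ℕ.≤-trans (#-mono _ (λ w → f w ≟ y) (λ _ → proj₂)) (fibre y))))
          where
          split : ∀ w → K₂ w × f w ≢ - κ → (K₂ w × f w ≡ centre) ⊎ ((K₂ w × f w ≢ - κ) × f w ≢ centre)
          split w (h , n) with f w ≟ centre
          ... | yes e = inj₁ (h , e)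
          ... | no n′ = inj₂ ((h , n) , n′)

        proper : q ≤ # onCircle?
        proper = ℕ.≤-trans (ℕ.m≤n+m q 1) (ℕ.+-cancelʳ-≤ (1 ℕ.+ M ℕ.* (q ℕ.+ 1)) _ _ (begin
          1 ℕ.+ q ℕ.+ (1 ℕ.+ M ℕ.* (q ℕ.+ 1))          ≡⟨ +-*-Solver.solve 2 (λ q M → N.con 1 N.:+ q N.:+ (N.con 1 N.:+ M N.:* (q N.:+ N.con 1)) N.:= N.con 1 N.:+ (M N.:+ N.con 1) N.:* (q N.:+ N.con 1)) refl q M ⟩
          1 ℕ.+ (M ℕ.+ 1) ℕ.* (q ℕ.+ 1)                ≤⟨ square ⟩
          q ℕ.^ 2                                      ≤⟨ K₂-split ⟩
          # onCircle? ℕ.+ # others?                    ≤⟨ ℕ.+-monoʳ-≤ (# onCircle?) #others ⟩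
          # onCircle? ℕ.+ (1 ℕ.+ M ℕ.* (q ℕ.+ 1))      ∎))
          where
          open ℕ.≤-Reasoning
          module N = +-*-Solver
          M = # value?
          square : 1 ℕ.+ (M ℕ.+ 1) ℕ.* (q ℕ.+ 1) ≤ q ℕ.^ 2
          square = ℕ.+-cancelʳ-≤ (q ℕ.+ 0) _ _ (begin
            1 ℕ.+ (M ℕ.+ 1) ℕ.* (q ℕ.+ 1) ℕ.+ (q ℕ.+ 0)   ≡⟨ N.solve 2 (λ q M → N.con 1 N.:+ (M N.:+ N.con 1) N.:* (q N.:+ N.con 1) N.:+ (q N.:+ N.con 0) N.:= (M N.:+ N.con 2) N.:* (q N.:+ N.con 1)) refl q M ⟩
            (M ℕ.+ 2) ℕ.* (q ℕ.+ 1)                       ≤⟨ ℕ.*-monoˡ-≤ (q ℕ.+ 1) #value ⟩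
            q ℕ.* (q ℕ.+ 1)                               ≡⟨ N.solve 1 (λ q → q N.:* (q N.:+ N.con 1) N.:= q N.:* (q N.:* N.con 1) N.:+ (q N.:+ N.con 0)) refl q ⟩
            q ℕ.^ 2 ℕ.+ (q ℕ.+ 0)                         ∎)

    q≤#onCircle : q ≤ # onCircle?
    q≤#onCircle = by (α ≟ 0#)
      where
      by : Dec (α ≡ 0#) → q ≤ # onCircle?
      by (yes e) = degenerate e
      by (no  h) = Proper.proper h

  -- Tangency

  -- Up to sign, the determinant of the conjugates of 1, `x`, `y` under `σ²`: it is nonzero exactly
  -- when these are independent over `K₂`. It lies in `K₂` because `σ²` permutes the three columns
  -- cyclically.
  det : K → K → K
  det x y = (x - σ² x) * (σ² y - σ⁴ y) - (y - σ² y) * (σ² x - σ⁴ x)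

  σ²-eval : ∀ {n} (p : Polynomial n) (ρ : Vec K n) → σ² (⟦ p ⟧ ρ) ≡ ⟦ p ⟧ (map σ (map σ ρ))
  σ²-eval p ρ = trans (cong σ (σ-eval p ρ)) (σ-eval p (map σ ρ))

  det∈K₂ : ∀ x y → K₂ (det x y)
  det∈K₂ x y = trans (σ²-eval ((v 0 :- v 1) :* (v 2 :- v 3) :- (v 4 :- v 2) :* (v 1 :- v 5)) (x ∷ σ² x ∷ σ² y ∷ σ⁴ y ∷ y ∷ σ⁴ x ∷ []))
    (trans (cong₂ (λ x′ y′ → (σ² x - σ⁴ x) * (σ⁴ y - y′) - (σ² y - σ⁴ y) * (σ⁴ x - x′)) (σ⁶ x) (σ⁶ y))
      (solve 6 (λ x x₂ x₄ y y₂ y₄ → (x₂ :- x₄) :* (y₄ :- y) :- (y₂ :- y₄) :* (x₄ :- x) := (x :- x₂) :* (y₂ :- y₄) :- (y :- y₂) :* (x₂ :- x₄)) refl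
        x (σ² x) (σ⁴ x) y (σ² y) (σ⁴ y)))

  K₂-+ : ∀ {x y} → K₂ x → K₂ y → K₂ (x + y)
  K₂-+ {x} {y} h k = trans (σ²-eval (v 0 :+ v 1) (x ∷ y ∷ [])) (cong₂ _+_ h k)

  K₂-* : ∀ {x y} → K₂ x → K₂ y → K₂ (x * y)
  K₂-* {x} {y} h k = trans (σ²-eval (v 0 :* v 1) (x ∷ y ∷ [])) (cong₂ _*_ h k)

  K₂-inv : ∀ {x} → x ≢ 0# → K₂ x → K₂ (inv x)
  K₂-inv {x} h e = trans (cong σ (σ-inv h)) (trans (σ-inv (σ-≢0 h)) (cong inv e))

  -- K is the direct sum of a K₂, K₂ and m K₂ when det m a ≠ 0.
  module Frame (a m : K) (𝒟≢0 : det m a ≢ 0#) where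

    -- Cramer's rule. Subtracting conjugates in `g = a A - B - m C` eliminates `B`, and the two
    -- equations obtained for `g - σ² g` and `σ² g - σ⁴ g` determine `A` and `C`. The signs are
    -- those of the relation `a x - b w - y = s + m k`.
    A B C : K → K
    A g = det m g * inv (det m a)
    C g = det a g * inv (det m a)
    B g = a * A g - m * C g - g

    A∈K₂ : ∀ g → K₂ (A g)
    A∈K₂ g = K₂-* (det∈K₂ m g) (K₂-inv 𝒟≢0 (det∈K₂ m a))

    C∈K₂ : ∀ g → K₂ (C g)
    C∈K₂ g = K₂-* (det∈K₂ a g) (K₂-inv 𝒟≢0 (det∈K₂ m a))

    B∈K₂ : ∀ g → K₂ (B g)
    B∈K₂ g = trans (σ²-eval (v 0 :* v 1 :- v 2 :* v 3 :- v 4) (a ∷ A g ∷ m ∷ C g ∷ g ∷ []))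
      (trans (cong₂ (λ x z → σ² a * x - σ² m * z - σ² g) (A∈K₂ g) (C∈K₂ g))
        (sym (x-y≡0⇒x≡y (begin
          (a * A g - m * C g - g) - (σ² a * A g - σ² m * C g - σ² g)
            ≡⟨ solve 8 (λ a a₂ m m₂ g g₂ x z → (a :* x :- m :* z :- g) :- (a₂ :* x :- m₂ :* z :- g₂) := ((a :- a₂) :* x :- (m :- m₂) :* z) :- (g :- g₂)) refl
                 a (σ² a) m (σ² m) g (σ² g) (A g) (C g) ⟩
          ((a - σ² a) * A g - (m - σ² m) * C g) - (g - σ² g)
            ≡⟨ solve 7 (λ a a′ m m′ g g′ i → (a :* ((m :* g′ :- g :* m′) :* i) :- m :* ((a :* g′ :- g :* a′) :* i)) :- g := g :* ((m :* a′ :- a :* m′) :* i) :- g) refl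
                 (a - σ² a) (σ² a - σ⁴ a) (m - σ² m) (σ² m - σ⁴ m) (g - σ² g) (σ² g - σ⁴ g) (inv (det m a)) ⟩
          (g - σ² g) * (det m a * inv (det m a)) - (g - σ² g)
            ≡⟨ cong (λ z → (g - σ² g) * z - (g - σ² g)) (inverseʳ 𝒟≢0) ⟩
          (g - σ² g) * 1# - (g - σ² g)
            ≡⟨ x≡y⇒x-y≡0 (*-identityʳ _) ⟩
          0# ∎))))
      where open ≡-Reasoning

    decompose : ∀ g → a * A g - B g - m * C g ≡ g
    decompose g = solve 3 (λ x z g → x :- (x :- z :- g) :- z := g) refl (a * A g) (m * C g) g

    independent : ∀ {x y z} → K₂ x → K₂ y → K₂ z → a * x - y - m * z ≡ 0# → x ≡ 0# × y ≡ 0# × z ≡ 0#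
    independent {x} {y} {z} hx hy hz e = x≡0 , y≡0 , z≡0
      where
      open ≡-Reasoning
      conjugate : ∀ {a m} → a * x - y - m * z ≡ 0# → σ² a * x - y - σ² m * z ≡ 0#
      conjugate {a} {m} e = trans (cong₂ (λ x (y , z) → σ² a * x - y - σ² m * z) (sym hx) (cong₂ _,_ (sym hy) (sym hz)))
        (trans (sym (σ²-eval (v 0 :* v 1 :- v 2 :- v 3 :* v 4) (a ∷ x ∷ y ∷ m ∷ z ∷ []))) (trans (cong σ² e) (trans (cong σ σ.φ-0) σ.φ-0)))
      e₂ = conjugate e
      e₄ = conjugate e₂
      combine : ∀ {E E₂ E₄} (p r : K) → E ≡ 0# → E₂ ≡ 0# → E₄ ≡ 0# → p * (E₂ - E₄) - r * (E - E₂) ≡ 0#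
      combine p r refl refl refl = solve 2 (λ p r → p :* (con (ℤ.+ 0) :- con (ℤ.+ 0)) :- r :* (con (ℤ.+ 0) :- con (ℤ.+ 0)) := con (ℤ.+ 0)) refl p r
      x≡0 = xy≡0⇒ (begin
        det m a * x
          ≡⟨ solve 9 (λ a a₂ a₄ m m₂ m₄ x y z →
               let E = a :* x :- y :- m :* z; E₂ = a₂ :* x :- y :- m₂ :* z; E₄ = a₄ :* x :- y :- m₄ :* z in
               ((m :- m₂) :* (a₂ :- a₄) :- (a :- a₂) :* (m₂ :- m₄)) :* x := (m :- m₂) :* (E₂ :- E₄) :- (m₂ :- m₄) :* (E :- E₂)) refl
               a (σ² a) (σ⁴ a) m (σ² m) (σ⁴ m) x y z ⟩
        _ ≡⟨ combine (m - σ² m) (σ² m - σ⁴ m) e e₂ e₄ ⟩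
        0# ∎) 𝒟≢0
      z≡0 = xy≡0⇒ (begin
        det m a * z
          ≡⟨ solve 9 (λ a a₂ a₄ m m₂ m₄ x y z →
               let E = a :* x :- y :- m :* z; E₂ = a₂ :* x :- y :- m₂ :* z; E₄ = a₄ :* x :- y :- m₄ :* z in
               ((m :- m₂) :* (a₂ :- a₄) :- (a :- a₂) :* (m₂ :- m₄)) :* z := (a :- a₂) :* (E₂ :- E₄) :- (a₂ :- a₄) :* (E :- E₂)) refl
               a (σ² a) (σ⁴ a) m (σ² m) (σ⁴ m) x y z ⟩
        _ ≡⟨ combine (a - σ² a) (σ² a - σ⁴ a) e e₂ e₄ ⟩
        0# ∎) 𝒟≢0
      y≡0 = begin
        y                                      ≡⟨ solve 3 (λ p y r → y := p :- r :- (p :- y :- r)) refl (a * x) y (m * z) ⟩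
        a * x - m * z - (a * x - y - m * z)    ≡⟨ cong₂ (λ (x , z) t → a * x - m * z - t) (cong₂ _,_ x≡0 z≡0) e ⟩
        a * 0# - m * 0# - 0#                   ≡⟨ solve 2 (λ a m → a :* con (ℤ.+ 0) :- m :* con (ℤ.+ 0) :- con (ℤ.+ 0) := con (ℤ.+ 0)) refl a m ⟩
        0#                                     ∎

  -- The symmetric bilinear form in five variables behind the three defining equations: the form of
  -- the curve in the first three coordinates and a hyperbolic plane in the last two. Pairing with
  -- `(a, b, 1, s, m)` gives the linear equation, pairing a vector with its conjugate gives the norm
  -- equation, and `n = 1` dehomogenises.
  form : (p y w k n X Y W L N : K) → K
  form p y w k n X Y W L N = p * X - y * W - w * Y - k * N - n * L

  form-step : ∀ p y w k n h a b s m X Y W L N →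
    form p y w k n (h * a + X) (h * b + Y) (h + W) (h * s + L) (h * m + N)
    ≡ h * form p y w k n a b 1# s m + form p y w k n X Y W L N
  form-step = solve 15 (λ p y w k n h a b s m X Y W L N →
    p :* (h :* a :+ X) :- y :* (h :+ W) :- w :* (h :* b :+ Y) :- k :* (h :* m :+ N) :- n :* (h :* s :+ L)
    := h :* (p :* a :- y :* con (ℤ.+ 1) :- w :* b :- k :* m :- n :* s) :+ (p :* X :- y :* W :- w :* Y :- k :* N :- n :* L)) refl

  module Touch (a b m s : K) (𝒟≢0 : det m a ≢ 0#)
    (tangent : m * σ s + σ m * s ≡ a * σ a - b - σ b)
    (ϖ≢0 : a * σ³ a - b - σ³ b - (s * σ³ m + σ³ s * m) ≢ 0#) where

    open Frame a m 𝒟≢0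

    -- The coefficients of `w σw`, 1 and `w` after substituting `x = A s + A b w`,
    -- `y = B s + B b w`, `k = C s + C b w` in the norm equation. Equivalently, the Gram matrix of
    -- the restricted Hermitian form in the coordinates `(w, n)`.
    α κ γ : K
    α = A b * σ (A b) - B b - σ (B b)
    κ = A s * σ (A s) - C s - σ (C s)
    γ = A b * σ (A s) - σ (B s) - C b

    norm∈Fq : ∀ {x y} → K₂ x → K₂ y → Fq (x * σ x - y - σ y)
    norm∈Fq {x} {y} hx hy = trans (σ-eval (v 0 :* v 1 :- v 2 :- v 3) (x ∷ σ x ∷ y ∷ σ y ∷ []))
      (trans (cong₂ (λ x₂ y₂ → σ x * x₂ - σ y - y₂) hx hy)
        (solve 4 (λ x x₁ y y₁ → x₁ :* x :- y₁ :- y := x :* x₁ :- y :- y₁) refl x (σ x) y (σ y)))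

    σγ : σ γ ≡ σ (A b) * A s - B s - σ (C b)
    σγ = trans (σ-eval (v 0 :* v 1 :- v 2 :- v 3) (A b ∷ σ (A s) ∷ σ (B s) ∷ C b ∷ []))
      (cong₂ (λ x y → σ (A b) * x - y - σ (C b)) (A∈K₂ s) (B∈K₂ s))

    γ∈K₂ : K₂ γ
    γ∈K₂ = trans (cong σ σγ) (trans (σ-eval (v 0 :* v 1 :- v 2 :- v 3) (σ (A b) ∷ A s ∷ B s ∷ σ (C b) ∷ []))
      (cong₂ (λ x z → x * σ (A s) - σ (B s) - z) (A∈K₂ b) (C∈K₂ b)))

    combination∈K₂ : ∀ {c d x y} → K₂ c → K₂ d → K₂ x → K₂ y → K₂ (x * c + y * d)
    combination∈K₂ hc hd hx hy = K₂-+ (K₂-* hx hc) (K₂-* hy hd)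

    -- A radical vector u of the Hermitian form on the K₂-span of the coordinates of b and s would be
    -- orthogonal to every K₂-rational vector orthogonal to the conjugates of (a, b, 1, s, m); those
    -- vectors supply all linear conditions on (w₀, n₀).
    module Radical (w₀ n₀ : K) (w₀∈K₂ : K₂ w₀) (n₀∈K₂ : K₂ n₀)
      (radical₁ : α * w₀ + σ γ * n₀ ≡ 0#) (radical₂ : γ * w₀ + κ * n₀ ≡ 0#) where

      x y k : K
      x = A b * w₀ + A s * n₀
      y = B b * w₀ + B s * n₀
      k = C b * w₀ + C s * n₀

      orthogonal : form x y w₀ k n₀ a b 1# s m ≡ 0#
      orthogonal = begin
        x * a - y * 1# - w₀ * b - k * m - n₀ * s
          ≡⟨ solve 12 (λ w n Ab As Bb Bs Cb Cs a b s m →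
               (Ab :* w :+ As :* n) :* a :- (Bb :* w :+ Bs :* n) :* con (ℤ.+ 1) :- w :* b :- (Cb :* w :+ Cs :* n) :* m :- n :* s
               := w :* (a :* Ab :- Bb :- m :* Cb :- b) :+ n :* (a :* As :- Bs :- m :* Cs :- s)) refl
               w₀ n₀ (A b) (A s) (B b) (B s) (C b) (C s) a b s m ⟩
        w₀ * (a * A b - B b - m * C b - b) + n₀ * (a * A s - B s - m * C s - s)
          ≡⟨ cong₂ (λ x y → w₀ * x + n₀ * y) (x≡y⇒x-y≡0 (decompose b)) (x≡y⇒x-y≡0 (decompose s)) ⟩
        w₀ * 0# + n₀ * 0#
          ≡⟨ solve 2 (λ x y → x :* con (ℤ.+ 0) :+ y :* con (ℤ.+ 0) := con (ℤ.+ 0)) refl w₀ n₀ ⟩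
        0# ∎
        where open ≡-Reasoning

      orthogonal-σ² : ∀ {a b s m} → form x y w₀ k n₀ a b 1# s m ≡ 0# → form x y w₀ k n₀ (σ² a) (σ² b) 1# (σ² s) (σ² m) ≡ 0#
      orthogonal-σ² {a} {b} {s} {m} e = begin
        form x y w₀ k n₀ (σ² a) (σ² b) 1# (σ² s) (σ² m)
          ≡⟨ cong₂ (λ (x , y) (w , k , n) → form x y w k n (σ² a) (σ² b) 1# (σ² s) (σ² m))
               (cong₂ _,_ (sym (combination∈K₂ w₀∈K₂ n₀∈K₂ (A∈K₂ _) (A∈K₂ _))) (sym (combination∈K₂ w₀∈K₂ n₀∈K₂ (B∈K₂ _) (B∈K₂ _))))
               (cong₂ _,_ (sym w₀∈K₂) (cong₂ _,_ (sym (combination∈K₂ w₀∈K₂ n₀∈K₂ (C∈K₂ _) (C∈K₂ _))) (sym n₀∈K₂))) ⟩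
        form (σ² x) (σ² y) (σ² w₀) (σ² k) (σ² n₀) (σ² a) (σ² b) 1# (σ² s) (σ² m)
          ≡⟨ sym (σ²-eval (v 0 :* v 1 :- v 2 :* con (ℤ.+ 1) :- v 3 :* v 4 :- v 5 :* v 6 :- v 7 :* v 8) (x ∷ a ∷ y ∷ w₀ ∷ b ∷ k ∷ m ∷ n₀ ∷ s ∷ [])) ⟩
        σ² (form x y w₀ k n₀ a b 1# s m)          ≡⟨ cong σ² e ⟩
        σ² 0#                                     ≡⟨ trans (cong σ σ.φ-0) σ.φ-0 ⟩
        0#                                        ∎
        where open ≡-Reasoning

      -- Let `v = (a, b, 1, s, m)`. The test vector is the sum of the conjugates of `h v` over `K₂`,
      -- plus `(0, η₁, 0, η₂, 0)`. The sum pairs to zero with the radical vector, so the whole pairs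
      -- to `- (w₀ η₁ + n₀ η₂)`; and `h` is chosen to make the vector orthogonal to `σ v`, which
      -- forces the same pairing to vanish.
      module Test (η₁ η₂ : K) (η₁∈Fq : Fq η₁) (η₂∈Fq : Fq η₂) where

        ϖ g h : K
        ϖ = a * σ³ a - b - σ³ b - (s * σ³ m + σ³ s * m)
        g = η₁ + η₂ * m
        h = σ³ g * inv ϖ

        X Y W L N : K
        X = h * a + (σ² h * σ² a + (σ⁴ h * σ⁴ a + 0#))
        Y = h * b + (σ² h * σ² b + (σ⁴ h * σ⁴ b + η₁))
        W = h + (σ² h + (σ⁴ h + 0#))
        L = h * s + (σ² h * σ² s + (σ⁴ h * σ⁴ s + η₂))
        N = h * m + (σ² h * σ² m + (σ⁴ h * σ⁴ m + 0#))

        twisted-sum∈K₂ : ∀ z η → Fq η → K₂ (h * z + (σ² h * σ² z + (σ⁴ h * σ⁴ z + η)))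
        twisted-sum∈K₂ z η e = trans (σ²-eval (v 0 :* v 1 :+ (v 2 :* v 3 :+ (v 4 :* v 5 :+ v 6))) (h ∷ z ∷ σ² h ∷ σ² z ∷ σ⁴ h ∷ σ⁴ z ∷ η ∷ []))
          (trans (cong₂ (λ (h′ , z′) η′ → σ² h * σ² z + (σ⁴ h * σ⁴ z + (h′ * z′ + η′))) (cong₂ _,_ (σ⁶ h) (σ⁶ z)) (Fq⇒K₂ e))
            (solve 4 (λ x y z e → x :+ (y :+ (z :+ e)) := z :+ (x :+ (y :+ e))) refl (σ² h * σ² z) (σ⁴ h * σ⁴ z) (h * z) η))

        W∈K₂ : K₂ W
        W∈K₂ = trans (σ²-eval (v 0 :+ (v 1 :+ (v 2 :+ con (ℤ.+ 0)))) (h ∷ σ² h ∷ σ⁴ h ∷ []))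
          (trans (cong (λ z → σ² h + (σ⁴ h + (z + 0#))) (σ⁶ h))
            (solve 3 (λ x y z → x :+ (y :+ (z :+ con (ℤ.+ 0))) := z :+ (x :+ (y :+ con (ℤ.+ 0)))) refl (σ² h) (σ⁴ h) h))

        expand : ∀ p y w k n → form p y w k n X Y W L N ≡
          h * form p y w k n a b 1# s m + (σ² h * form p y w k n (σ² a) (σ² b) 1# (σ² s) (σ² m)
            + (σ⁴ h * form p y w k n (σ⁴ a) (σ⁴ b) 1# (σ⁴ s) (σ⁴ m) + form p y w k n 0# η₁ 0# η₂ 0#))
        expand p y w k n = trans (form-step p y w k n _ _ _ _ _ _ _ _ _ _) (cong (h * form p y w k n a b 1# s m +_)
          (trans (form-step p y w k n _ _ _ _ _ _ _ _ _ _) (cong (σ² h * form p y w k n (σ² a) (σ² b) 1# (σ² s) (σ² m) +_)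
            (form-step p y w k n _ _ _ _ _ _ _ _ _ _))))

        conclusion : form x y w₀ k n₀ X Y W L N ≡ - (w₀ * η₁ + n₀ * η₂)
        conclusion = begin
          form x y w₀ k n₀ X Y W L N ≡⟨ expand x y w₀ k n₀ ⟩
          _ ≡⟨ cong₂ (λ e (e₂ , e₄) → h * e + (σ² h * e₂ + (σ⁴ h * e₄ + form x y w₀ k n₀ 0# η₁ 0# η₂ 0#)))
                 orthogonal (cong₂ _,_ (orthogonal-σ² orthogonal) (orthogonal-σ² (orthogonal-σ² orthogonal))) ⟩
          h * 0# + (σ² h * 0# + (σ⁴ h * 0# + form x y w₀ k n₀ 0# η₁ 0# η₂ 0#))
            ≡⟨ solve 10 (λ h h₂ h₄ x y w k n e f → let O = con (ℤ.+ 0) in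
                 h :* O :+ (h₂ :* O :+ (h₄ :* O :+ (x :* O :- y :* O :- w :* e :- k :* O :- n :* f))) := :- (w :* e :+ n :* f)) refl
                 h (σ² h) (σ⁴ h) x y w₀ k n₀ η₁ η₂ ⟩
          - (w₀ * η₁ + n₀ * η₂) ∎
          where open ≡-Reasoning

        hϖ : h * ϖ ≡ σ³ g
        hϖ = trans (*-assoc _ _ _) (trans (cong (σ³ g *_) (inverseˡ ϖ≢0)) (*-identityʳ _))

        -- `ϖ` is the product of `v` with `σ³ v`; since `σ³` interchanges the two and the form is
        -- symmetric, `σ³` fixes `ϖ`.
        σ⁴ϖ : σ⁴ ϖ ≡ σ ϖ
        σ⁴ϖ = cong σ (begin
          σ³ ϖ
            ≡⟨ cong (λ z → σ z) (σ²-eval p ρ) ⟩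
          σ (⟦ p ⟧ (map σ (map σ ρ)))
            ≡⟨ σ-eval p (map σ (map σ ρ)) ⟩
          ⟦ p ⟧ (map σ (map σ (map σ ρ)))
            ≡⟨ cong₂ (λ (a′ , b′) (s′ , m′) → σ³ a * a′ - σ³ b - b′ - (σ³ s * m′ + s′ * σ³ m)) (cong₂ _,_ (σ⁶ a) (σ⁶ b)) (cong₂ _,_ (σ⁶ s) (σ⁶ m)) ⟩
          σ³ a * a - σ³ b - b - (σ³ s * m + s * σ³ m)
            ≡⟨ solve 8 (λ a a₃ b b₃ s s₃ m m₃ → a₃ :* a :- b₃ :- b :- (s₃ :* m :+ s :* m₃) := a :* a₃ :- b :- b₃ :- (s :* m₃ :+ s₃ :* m)) refl
                 a (σ³ a) b (σ³ b) s (σ³ s) m (σ³ m) ⟩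
          ϖ ∎)
          where
          open ≡-Reasoning
          p : Polynomial 8
          p = v 0 :* v 1 :- v 2 :- v 3 :- (v 4 :* v 7 :+ v 5 :* v 6)
          ρ = a ∷ σ³ a ∷ b ∷ σ³ b ∷ s ∷ σ³ s ∷ m ∷ σ³ m ∷ []

        h₄ϖ₁ : σ⁴ h * σ ϖ ≡ σ g
        h₄ϖ₁ = begin
          σ⁴ h * σ ϖ        ≡⟨ cong (σ⁴ h *_) (sym σ⁴ϖ) ⟩
          σ⁴ h * σ⁴ ϖ       ≡⟨ sym (trans (cong σ² (σ²-eval (v 0 :* v 1) (h ∷ ϖ ∷ []))) (σ²-eval (v 0 :* v 1) (σ² h ∷ σ² ϖ ∷ []))) ⟩
          σ⁴ (h * ϖ)        ≡⟨ cong σ⁴ hϖ ⟩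
          σ⁴ (σ³ g)         ≡⟨ cong σ (σ⁶ g) ⟩
          σ g               ∎
          where open ≡-Reasoning

        σg : σ g ≡ η₁ + η₂ * σ m
        σg = trans (σ-eval (v 0 :+ v 1 :* v 2) (η₁ ∷ η₂ ∷ m ∷ [])) (cong₂ (λ x y → x + y * σ m) η₁∈Fq η₂∈Fq)

        adjacent : a * σ a - b - σ b - (m * σ s + σ m * s) ≡ 0#
        adjacent = x≡y⇒x-y≡0 (sym tangent)

        σ-adjacent : σ a * σ² a - σ b - σ² b - (σ m * σ² s + σ² m * σ s) ≡ 0#
        σ-adjacent = trans (sym (σ-eval (v 0 :* v 1 :- v 2 :- v 3 :- (v 4 :* v 7 :+ v 5 :* v 6)) (a ∷ σ a ∷ b ∷ σ b ∷ m ∷ σ m ∷ s ∷ σ s ∷ [])))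
          (trans (cong σ adjacent) σ.φ-0)

        -- The products of `σ v` with `v` and `σ² v` vanish by `tangent` and its conjugate. The
        -- product with `σ⁴ v` is `σ ϖ`, and by the choice of `h` its contribution `σ g` cancels
        -- that of the correction by `η₁` and `η₂`.
        conjugate-orthogonal : form (σ a) (σ b) 1# (σ s) (σ m) X Y W L N ≡ 0#
        conjugate-orthogonal = begin
          form (σ a) (σ b) 1# (σ s) (σ m) X Y W L N ≡⟨ expand (σ a) (σ b) 1# (σ s) (σ m) ⟩
          _ ≡⟨ cong₂ (λ e (e₂ , e₄) → h * e + (σ² h * e₂ + (σ⁴ h * e₄ + form (σ a) (σ b) 1# (σ s) (σ m) 0# η₁ 0# η₂ 0#)))
                 (trans (solve 8 (λ a a₁ b b₁ s s₁ m m₁ → let I = con (ℤ.+ 1) in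
                      a₁ :* a :- b₁ :* I :- I :* b :- s₁ :* m :- m₁ :* s := a :* a₁ :- b :- b₁ :- (m :* s₁ :+ m₁ :* s)) refl
                      a (σ a) b (σ b) s (σ s) m (σ m)) adjacent)
                 (cong₂ _,_
                   (trans (solve 8 (λ a a₁ b b₁ s s₁ m m₁ → let I = con (ℤ.+ 1) in
                      a :* a₁ :- b :* I :- I :* b₁ :- s :* m₁ :- m :* s₁ := a :* a₁ :- b :- b₁ :- (m :* s₁ :+ m₁ :* s)) refl
                      (σ a) (σ² a) (σ b) (σ² b) (σ s) (σ² s) (σ m) (σ² m)) σ-adjacent)
                   (trans (solve 8 (λ a a₁ b b₁ s s₁ m m₁ → let I = con (ℤ.+ 1) in
                      a :* a₁ :- b :* I :- I :* b₁ :- s :* m₁ :- m :* s₁ := a :* a₁ :- b :- b₁ :- (s :* m₁ :+ s₁ :* m)) refl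
                      (σ a) (σ⁴ a) (σ b) (σ⁴ b) (σ s) (σ⁴ s) (σ m) (σ⁴ m))
                     (sym (σ-eval (v 0 :* v 1 :- v 2 :- v 3 :- (v 4 :* v 7 :+ v 5 :* v 6)) (a ∷ σ³ a ∷ b ∷ σ³ b ∷ s ∷ σ³ s ∷ m ∷ σ³ m ∷ []))))) ⟩
          h * 0# + (σ² h * 0# + (σ⁴ h * σ ϖ + form (σ a) (σ b) 1# (σ s) (σ m) 0# η₁ 0# η₂ 0#))
            ≡⟨ cong (λ z → h * 0# + (σ² h * 0# + (z + form (σ a) (σ b) 1# (σ s) (σ m) 0# η₁ 0# η₂ 0#))) (trans h₄ϖ₁ σg) ⟩
          h * 0# + (σ² h * 0# + (η₁ + η₂ * σ m + form (σ a) (σ b) 1# (σ s) (σ m) 0# η₁ 0# η₂ 0#))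
            ≡⟨ solve 8 (λ h h₂ a b s m e f → let O = con (ℤ.+ 0); I = con (ℤ.+ 1) in
                 h :* O :+ (h₂ :* O :+ (e :+ f :* m :+ (a :* O :- b :* O :- I :* e :- s :* O :- m :* f))) := O) refl
                 h (σ² h) (σ a) (σ b) (σ s) (σ m) η₁ η₂ ⟩
          0# ∎
          where open ≡-Reasoning

        -- The conjugated test vector is `K₂`-rational and orthogonal to `v`, so it lies in the
        -- plane parametrised by its third and fifth coordinates. Only there can the two radical
        -- equations be applied to it.
        coordinates : σ X ≡ A b * σ W + A s * σ N × σ Y ≡ B b * σ W + B s * σ N × σ L ≡ C b * σ W + C s * σ N
        coordinates = x-y≡0⇒x≡y (proj₁ zeros) , x-y≡0⇒x≡y (proj₁ (proj₂ zeros)) , x-y≡0⇒x≡y (proj₂ (proj₂ zeros))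
          where
          open ≡-Reasoning
          difference∈K₂ : ∀ {x c d} → K₂ x → K₂ c → K₂ d → K₂ (σ x - (c * σ W + d * σ N))
          difference∈K₂ {x} {c} {d} hx hc hd = trans (σ²-eval (v 0 :- (v 1 :* v 2 :+ v 3 :* v 4)) (σ x ∷ c ∷ σ W ∷ d ∷ σ N ∷ []))
            (cong₂ (λ x ((c , w) , (d , n)) → x - (c * w + d * n)) (K₂-σ hx) (cong₂ _,_ (cong₂ _,_ hc (K₂-σ W∈K₂)) (cong₂ _,_ hd (K₂-σ (twisted-sum∈K₂ m 0# Fq-0)))))
          zeros = independent (difference∈K₂ (twisted-sum∈K₂ a 0# Fq-0) (A∈K₂ b) (A∈K₂ s)) (difference∈K₂ (twisted-sum∈K₂ b η₁ η₁∈Fq) (B∈K₂ b) (B∈K₂ s))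
                    (difference∈K₂ (twisted-sum∈K₂ s η₂ η₂∈Fq) (C∈K₂ b) (C∈K₂ s)) (begin
            a * (σ X - (A b * σ W + A s * σ N)) - (σ Y - (B b * σ W + B s * σ N)) - m * (σ L - (C b * σ W + C s * σ N))
              ≡⟨ solve 13 (λ a m X Y L W N Ab As Bb Bs Cb Cs →
                   a :* (X :- (Ab :* W :+ As :* N)) :- (Y :- (Bb :* W :+ Bs :* N)) :- m :* (L :- (Cb :* W :+ Cs :* N))
                   := a :* X :- Y :- m :* L :- W :* (a :* Ab :- Bb :- m :* Cb) :- N :* (a :* As :- Bs :- m :* Cs)) refl
                   a m (σ X) (σ Y) (σ L) (σ W) (σ N) (A b) (A s) (B b) (B s) (C b) (C s) ⟩
            a * σ X - σ Y - m * σ L - σ W * (a * A b - B b - m * C b) - σ N * (a * A s - B s - m * C s)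
              ≡⟨ cong₂ (λ b s → a * σ X - σ Y - m * σ L - σ W * b - σ N * s) (decompose b) (decompose s) ⟩
            a * σ X - σ Y - m * σ L - σ W * b - σ N * s
              ≡⟨ solve 9 (λ a m b s X Y L W N → a :* X :- Y :- m :* L :- W :* b :- N :* s
                   := a :* X :- b :* W :- con (ℤ.+ 1) :* Y :- s :* N :- m :* L) refl a m b s (σ X) (σ Y) (σ L) (σ W) (σ N) ⟩
            form a b 1# s m (σ X) (σ Y) (σ W) (σ L) (σ N)
              ≡⟨ σ-injective (trans (σ-eval (v 0 :* v 1 :- v 2 :* v 3 :- con (ℤ.+ 1) :* v 4 :- v 5 :* v 6 :- v 7 :* v 8)
                   (a ∷ σ X ∷ b ∷ σ W ∷ σ Y ∷ s ∷ σ N ∷ m ∷ σ L ∷ []))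
                   (trans (cong₂ (λ (X , Y) (W , L , N) → form (σ a) (σ b) 1# (σ s) (σ m) X Y W L N)
                      (cong₂ _,_ (twisted-sum∈K₂ a 0# Fq-0) (twisted-sum∈K₂ b η₁ η₁∈Fq)) (cong₂ _,_ W∈K₂ (cong₂ _,_ (twisted-sum∈K₂ s η₂ η₂∈Fq) (twisted-sum∈K₂ m 0# Fq-0))))
                     (trans conjugate-orthogonal (sym σ.φ-0)))) ⟩
            0# ∎)

        recover : ∀ {x c d} → K₂ x → σ x ≡ c * σ W + d * σ N → x ≡ σ c * W + σ d * N
        recover {x} {c} {d} hx e = trans (sym hx) (trans (cong σ e) (trans (σ-eval (v 0 :* v 1 :+ v 2 :* v 3) (c ∷ σ W ∷ d ∷ σ N ∷ []))
          (cong₂ (λ w n → σ c * w + σ d * n) W∈K₂ (twisted-sum∈K₂ m 0# Fq-0))))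

        vanishes : form x y w₀ k n₀ X Y W L N ≡ 0#
        vanishes = begin
          form x y w₀ k n₀ X Y W L N
            ≡⟨ cong₂ (λ X (Y , L) → form x y w₀ k n₀ X Y W L N) (recover (twisted-sum∈K₂ a 0# Fq-0) (proj₁ coordinates))
                 (cong₂ _,_ (recover (twisted-sum∈K₂ b η₁ η₁∈Fq) (proj₁ (proj₂ coordinates))) (recover (twisted-sum∈K₂ s η₂ η₂∈Fq) (proj₂ (proj₂ coordinates)))) ⟩
          form x y w₀ k n₀ (σ (A b) * W + σ (A s) * N) (σ (B b) * W + σ (B s) * N) W (σ (C b) * W + σ (C s) * N) N
            ≡⟨ solve 16 (λ w n W N Ab Ab₁ As As₁ Bb Bb₁ Bs Bs₁ Cb Cb₁ Cs Cs₁ →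
                 (Ab :* w :+ As :* n) :* (Ab₁ :* W :+ As₁ :* N) :- (Bb :* w :+ Bs :* n) :* W :- w :* (Bb₁ :* W :+ Bs₁ :* N)
                   :- (Cb :* w :+ Cs :* n) :* N :- n :* (Cb₁ :* W :+ Cs₁ :* N)
                 := ((Ab :* Ab₁ :- Bb :- Bb₁) :* w :+ (Ab₁ :* As :- Bs :- Cb₁) :* n) :* W
                   :+ ((Ab :* As₁ :- Bs₁ :- Cb) :* w :+ (As :* As₁ :- Cs :- Cs₁) :* n) :* N) refl
                 w₀ n₀ W N (A b) (σ (A b)) (A s) (σ (A s)) (B b) (σ (B b)) (B s) (σ (B s)) (C b) (σ (C b)) (C s) (σ (C s)) ⟩
          (α * w₀ + (σ (A b) * A s - B s - σ (C b)) * n₀) * W + (γ * w₀ + κ * n₀) * N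
            ≡⟨ cong₂ (λ r₁ r₂ → r₁ * W + r₂ * N) (trans (cong (λ z → α * w₀ + z * n₀) (sym σγ)) radical₁) radical₂ ⟩
          0# * W + 0# * N
            ≡⟨ solve 2 (λ W N → con (ℤ.+ 0) :* W :+ con (ℤ.+ 0) :* N := con (ℤ.+ 0)) refl W N ⟩
          0# ∎
          where open ≡-Reasoning

        relation : w₀ * η₁ + n₀ * η₂ ≡ 0#
        relation = trans (sym (-‿involutive _)) (trans (cong -_ (trans (sym conclusion) vanishes)) -0#≈0#)

      w₀≡0 : w₀ ≡ 0#
      w₀≡0 = trans (solve 2 (λ w n → w := w :* con (ℤ.+ 1) :+ n :* con (ℤ.+ 0)) refl w₀ n₀) (Test.relation 1# 0# σ.φ-1 Fq-0)

      n₀≡0 : n₀ ≡ 0#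
      n₀≡0 = trans (solve 2 (λ w n → n := w :* con (ℤ.+ 0) :+ n :* con (ℤ.+ 1)) refl w₀ n₀) (Test.relation 0# 1# Fq-0 σ.φ-1)

    α∈Fq : Fq α
    α∈Fq = norm∈Fq (A∈K₂ b) (B∈K₂ b)

    κ∈Fq : Fq κ
    κ∈Fq = norm∈Fq (A∈K₂ s) (C∈K₂ s)

    -- A vanishing determinant yields a radical vector: `(- σγ, α)` if `α` is nonzero, and otherwise
    -- `(1, 0)`, since then the norm of `γ`, and with it `γ`, is zero too.
    nondegenerate : γ * σ γ ≢ α * κ
    nondegenerate e = by (α ≟ 0#)
      where
      by : ¬ Dec (α ≡ 0#)
      by (no α≢0) = α≢0 (Radical.n₀≡0 (- σ γ) α
        (trans (cong σ² (solve 1 (λ x → :- x := (:- con (ℤ.+ 1)) :* x) refl (σ γ))) (trans (σ²-eval ((:- con (ℤ.+ 1)) :* v 0) (σ γ ∷ []))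
          (trans (cong (λ z → - 1# * z) (K₂-σ γ∈K₂)) (solve 1 (λ x → (:- con (ℤ.+ 1)) :* x := :- x) refl (σ γ))))) (Fq⇒K₂ α∈Fq)
        (solve 2 (λ a g → a :* (:- g) :+ g :* a := con (ℤ.+ 0)) refl α (σ γ))
        (trans (solve 4 (λ a g g₁ k → g :* (:- g₁) :+ k :* a := a :* k :- g :* g₁) refl α γ (σ γ) κ) (x≡y⇒x-y≡0 (sym e))))
      by (yes α≡0) = FinField.0≢1 F (sym (Radical.w₀≡0 1# 0# (Fq⇒K₂ σ.φ-1) (Fq⇒K₂ Fq-0)
        (trans (cong (λ z → z * 1# + σ γ * 0#) α≡0) (solve 1 (λ x → con (ℤ.+ 0) :* con (ℤ.+ 1) :+ x :* con (ℤ.+ 0) := con (ℤ.+ 0)) refl (σ γ)))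
        (trans (cong (λ z → z * 1# + κ * 0#) γ≡0) (solve 1 (λ x → con (ℤ.+ 0) :* con (ℤ.+ 1) :+ x :* con (ℤ.+ 0) := con (ℤ.+ 0)) refl κ))))
        where
        γ≡0 : γ ≡ 0#
        γ≡0 = vanish (γ ≟ 0#)
          where
          vanish : Dec (γ ≡ 0#) → γ ≡ 0#
          vanish (yes z) = z
          vanish (no h)  = contradiction (trans e (trans (cong (_* κ) α≡0) (zeroˡ κ))) (*-≢0 h (σ-≢0 h))

    onTangentCircle? : ∀ w → Dec (OnCircle α κ γ α∈Fq κ∈Fq γ∈K₂ nondegenerate w)
    onTangentCircle? = onCircle? α κ γ α∈Fq κ∈Fq γ∈K₂ nondegenerate

    q≤#tangentCircle : q ≤ # onTangentCircle?
    q≤#tangentCircle = q≤#onCircle α κ γ α∈Fq κ∈Fq γ∈K₂ nondegenerate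

    tangent-point : ∀ {w} → OnCircle α κ γ α∈Fq κ∈Fq γ∈K₂ nondegenerate w →
      ∃ λ x → ∃ λ y → ∃ λ k → (K₂ x × K₂ y × K₂ k) × a * x - b * w - y ≡ s + m * k × x * σ x - y * σ w - σ y * w ≡ k + σ k
    tangent-point {w} (w∈K₂ , onCircle) = x , y , k ,
      (K₂-+ (A∈K₂ s) (K₂-* (A∈K₂ b) w∈K₂) , K₂-+ (B∈K₂ s) (K₂-* (B∈K₂ b) w∈K₂) , K₂-+ (C∈K₂ s) (K₂-* (C∈K₂ b) w∈K₂)) ,
      linear-relation , norm-relation
      where
      open ≡-Reasoning
      x = A s + A b * w
      y = B s + B b * w
      k = C s + C b * w
      linear-relation = begin
        a * x - b * w - y
          ≡⟨ solve 11 (λ a b m s w Ab As Bb Bs Cb Cs → a :* (As :+ Ab :* w) :- b :* w :- (Bs :+ Bb :* w)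
               := (a :* As :- Bs :- m :* Cs) :+ w :* ((a :* Ab :- Bb :- m :* Cb) :- b) :+ m :* (Cs :+ Cb :* w)) refl
               a b m s w (A b) (A s) (B b) (B s) (C b) (C s) ⟩
        (a * A s - B s - m * C s) + w * ((a * A b - B b - m * C b) - b) + m * k
          ≡⟨ cong₂ (λ s z → s + w * z + m * k) (decompose s) (x≡y⇒x-y≡0 (decompose b)) ⟩
        s + w * 0# + m * k
          ≡⟨ solve 3 (λ s w z → s :+ w :* con (ℤ.+ 0) :+ z := s :+ z) refl s w (m * k) ⟩
        s + m * k ∎
      conj-of : ∀ c d → σ (c + d * w) ≡ σ c + σ d * σ w
      conj-of c d = σ-eval (v 0 :+ v 1 :* v 2) (c ∷ d ∷ w ∷ [])
      norm-relation = x-y≡0⇒x≡y (begin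
        x * σ x - y * σ w - σ y * w - (k + σ k)
          ≡⟨ cong₂ (λ x₁ (y₁ , k₁) → x * x₁ - y * σ w - y₁ * w - (k + k₁)) (conj-of _ _) (cong₂ _,_ (conj-of _ _) (conj-of _ _)) ⟩
        x * (σ (A s) + σ (A b) * σ w) - y * σ w - (σ (B s) + σ (B b) * σ w) * w - (k + (σ (C s) + σ (C b) * σ w))
          ≡⟨ solve 14 (λ w w₁ Ab Ab₁ As As₁ Bb Bb₁ Bs Bs₁ Cb Cb₁ Cs Cs₁ →
               (As :+ Ab :* w) :* (As₁ :+ Ab₁ :* w₁) :- (Bs :+ Bb :* w) :* w₁ :- (Bs₁ :+ Bb₁ :* w₁) :* w :- (Cs :+ Cb :* w :+ (Cs₁ :+ Cb₁ :* w₁))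
               := (Ab :* Ab₁ :- Bb :- Bb₁) :* (w :* w₁) :+ (Ab :* As₁ :- Bs₁ :- Cb) :* w :+ (Ab₁ :* As :- Bs :- Cb₁) :* w₁ :+ (As :* As₁ :- Cs :- Cs₁)) refl
               w (σ w) (A b) (σ (A b)) (A s) (σ (A s)) (B b) (σ (B b)) (B s) (σ (B s)) (C b) (σ (C b)) (C s) (σ (C s)) ⟩
        α * (w * σ w) + γ * w + (σ (A b) * A s - B s - σ (C b)) * σ w + κ
          ≡⟨ cong (λ z → α * (w * σ w) + γ * w + z * σ w + κ) (sym σγ) ⟩
        α * (w * σ w) + γ * w + σ γ * σ w + κ
          ≡⟨ onCircle ⟩
        0# ∎)

  -- Good tangents

  -- The trace has at most `q⁵` zeros, fewer than `q⁶`; a nonzero value can be normalised because it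
  -- lies in `Fq`.
  unit-trace : ∃ λ θ → trace θ ≡ 1#
  unit-trace = inv c * u , (begin
    trace (inv c * u)
      ≡⟨ cong (λ (a , b , p , d , e) → inv c * u + a + b + p + d + e) (cong₂ _,_ e₁ (cong₂ _,_ e₂ (cong₂ _,_ e₃ (cong₂ _,_ e₄ e₅)))) ⟩
    inv c * u + inv c * σ u + inv c * σ² u + inv c * σ³ u + inv c * σ⁴ u + inv c * σ⁵ u
      ≡⟨ solve 7 (λ k a b c d e f → k :* a :+ k :* b :+ k :* c :+ k :* d :+ k :* e :+ k :* f := k :* (a :+ b :+ c :+ d :+ e :+ f)) refl
           (inv c) u (σ u) (σ² u) (σ³ u) (σ⁴ u) (σ⁵ u) ⟩
    inv c * c
      ≡⟨ inverseˡ c≢0 ⟩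
    1# ∎)
    where
    open ≡-Reasoning
    witness = ∃-of-# {P = λ _ → 0# ≡ 0#} (λ _ → 0# ≟ 0#) (λ x → trace x ≟ 0#)
      (ℕ.≤-trans (s≤s (trace-fibre 0#)) (ℕ.≤-trans (^-mono {5} {6} ℕ.≤-refl) (ℕ.≤-reflexive (sym (#-all {n = q ℕ.^ 6} (λ _ → 0# ≟ 0#) (λ _ → refl))))))
    u = proj₁ witness
    c = trace u
    c≢0 : c ≢ 0#
    c≢0 = proj₂ (proj₂ witness)
    step : ∀ y → σ (inv c * y) ≡ inv c * σ y
    step y = trans (σ.φ-* _ y) (cong (_* σ y) (Fq-inv c≢0 (trace∈Fq u)))
    e₁ = step u
    e₂ = trans (cong σ e₁) (step (σ u))
    e₃ = trans (cong σ e₂) (step (σ² u))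
    e₄ = trans (cong σ e₃) (step (σ³ u))
    e₅ = trans (cong σ e₄) (step (σ⁴ u))

  -- The additive form of Hilbert 90 for x ↦ x + σ x.
  +σ-surjective : ∀ ε → altTrace ε ≡ 0# → ∃ λ τ → τ + σ τ ≡ ε
  +σ-surjective ε h = τ , (begin
    τ + σ τ
      ≡⟨ cong (τ +_) (trans (σ-eval p ρ) (cong₂ (λ θ₀ ε₅ → ⟦ p ⟧ (σ ε ∷ σ² ε ∷ σ³ ε ∷ σ⁴ ε ∷ ε₅ ∷ σ² θ ∷ σ³ θ ∷ σ⁴ θ ∷ σ⁵ θ ∷ θ₀ ∷ [])) (σ⁶ θ) σ⁵ε)) ⟩
    τ + ⟦ p ⟧ (σ ε ∷ σ² ε ∷ σ³ ε ∷ σ⁴ ε ∷ (ε - σ ε + σ² ε - σ³ ε + σ⁴ ε) ∷ σ² θ ∷ σ³ θ ∷ σ⁴ θ ∷ σ⁵ θ ∷ θ ∷ [])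
      ≡⟨ solve 11 (λ e₀ e₁ e₂ e₃ e₄ t₀ t₁ t₂ t₃ t₄ t₅ →
           let e₅ = e₀ :- e₁ :+ e₂ :- e₃ :+ e₄ in
           (e₀ :* t₁ :+ (e₀ :- e₁) :* t₂ :+ (e₀ :- e₁ :+ e₂) :* t₃ :+ (e₀ :- e₁ :+ e₂ :- e₃) :* t₄ :+ (e₀ :- e₁ :+ e₂ :- e₃ :+ e₄) :* t₅)
           :+ (e₁ :* t₂ :+ (e₁ :- e₂) :* t₃ :+ (e₁ :- e₂ :+ e₃) :* t₄ :+ (e₁ :- e₂ :+ e₃ :- e₄) :* t₅ :+ (e₁ :- e₂ :+ e₃ :- e₄ :+ e₅) :* t₀)
           := e₀ :* (t₀ :+ t₁ :+ t₂ :+ t₃ :+ t₄ :+ t₅)) refl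
           ε (σ ε) (σ² ε) (σ³ ε) (σ⁴ ε) θ (σ θ) (σ² θ) (σ³ θ) (σ⁴ θ) (σ⁵ θ) ⟩
    ε * trace θ
      ≡⟨ cong (ε *_) (proj₂ unit-trace) ⟩
    ε * 1#
      ≡⟨ *-identityʳ ε ⟩
    ε ∎)
    where
    open ≡-Reasoning
    θ = proj₁ unit-trace
    p : Polynomial 10
    -- The coefficients of the conjugates of `θ` are the alternating partial sums of the conjugates
    -- of `ε`. In `τ + σ τ` they telescope to `ε`, and the hypothesis on `altTrace ε` closes the
    -- cycle at `σ⁵ ε`.
    p = v 0 :* v 5 :+ (v 0 :- v 1) :* v 6 :+ (v 0 :- v 1 :+ v 2) :* v 7 :+ (v 0 :- v 1 :+ v 2 :- v 3) :* v 8 :+ (v 0 :- v 1 :+ v 2 :- v 3 :+ v 4) :* v 9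
    ρ = ε ∷ σ ε ∷ σ² ε ∷ σ³ ε ∷ σ⁴ ε ∷ σ θ ∷ σ² θ ∷ σ³ θ ∷ σ⁴ θ ∷ σ⁵ θ ∷ []
    τ = ⟦ p ⟧ ρ
    σ⁵ε : σ⁵ ε ≡ ε - σ ε + σ² ε - σ³ ε + σ⁴ ε
    σ⁵ε = sym (x-y≡0⇒x≡y h)

  module Good (a b : K) (a∉K₂ : σ² a ≢ a) (δ≢0 : a * σ a - b - σ b ≢ 0#) where

    δ ρ : K
    δ = a * σ a - b - σ b
    ρ = a * σ³ a - b - σ³ b

    -- t = 1/m; the last two conditions are ϖ ≠ 0 and det m a ≠ 0 with denominators cleared.
    ϖ-numerator det-numerator : K → K
    ϖ-numerator t = δ * (t * σ t) - σ δ * (σ t * σ² t) + σ² δ * (σ² t * σ³ t) - ρ * (t * σ³ t)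
    det-numerator t = (σ² t - t) * σ⁴ t * (σ² a - σ⁴ a) - (a - σ² a) * ((σ⁴ t - σ² t) * t)

    δ-isotropic? : ∀ t → Dec (Q δ δ≢0 t ≡ 0#)
    δ-isotropic? = isotropic? δ δ≢0

    -- The third condition keeps `s` out of `K₂ m`, so that the two linear factors of the binary
    -- form are independent. All conditions are stated through `t` alone: `τ` is chosen only
    -- afterwards, and is determined only up to elements negated by `σ`.
    Good : K → Set
    Good t = ((((Q δ δ≢0 t ≡ 0#) × t ≢ 0#) × σ δ * σ² t ≢ δ * t) × ϖ-numerator t ≢ 0#) × det-numerator t ≢ 0#

    good? : ∀ t → Dec (Good t)
    good? t = (((isotropic? δ δ≢0 t ×-dec ¬? (t ≟ 0#)) ×-dec ¬? (σ δ * σ² t ≟ δ * t)) ×-dec ¬? (ϖ-numerator t ≟ 0#)) ×-dec ¬? (det-numerator t ≟ 0#)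

    #ϖ-zero : # (λ t → ϖ-numerator t ≟ 0#) ≤ q ℕ.^ 2 ℕ.+ q ℕ.^ 3
    #ϖ-zero = ℕ.≤-trans (#-mono _ (λ t → quadratic ((σ² δ , Fin.#_ 2 , Fin.#_ 3) ∷ ts) 0# t ≟ 0#)
      (λ t e → trans (solve 8 (λ d d₁ d₂ r t t₁ t₂ t₃ →
           d₂ :* (t₂ :* t₃) :+ (d :* (t :* t₁) :+ ((:- d₁) :* (t₁ :* t₂) :+ ((:- r) :* (t :* t₃) :+ con (ℤ.+ 0))))
           := d :* (t :* t₁) :- d₁ :* (t₁ :* t₂) :+ d₂ :* (t₂ :* t₃) :- r :* (t :* t₃)) refl δ (σ δ) (σ² δ) ρ t (σ t) (σ² t) (σ³ t)) e))
      (quadratic-roots (σ² δ) (Fin.#_ 2) (Fin.#_ 3) ts 0# (σ-≢0 (σ-≢0 δ≢0)))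
      where
      ts = (δ , Fin.#_ 0 , Fin.#_ 1) ∷ (- σ δ , Fin.#_ 1 , Fin.#_ 2) ∷ (- ρ , Fin.#_ 0 , Fin.#_ 3) ∷ []

    #det-zero : # (λ t → det-numerator t ≟ 0#) ≤ q ℕ.^ 2 ℕ.+ q ℕ.^ 4
    #det-zero = ℕ.≤-trans (#-mono _ (λ t → quadratic ((σ² a - σ⁴ a , Fin.#_ 2 , Fin.#_ 4) ∷ ts) 0# t ≟ 0#)
      (λ t e → trans (solve 6 (λ a a₂ a₄ t t₂ t₄ →
           (a₂ :- a₄) :* (t₂ :* t₄) :+ ((a₄ :- a) :* (t :* t₄) :+ ((a :- a₂) :* (t :* t₂) :+ con (ℤ.+ 0)))
           := (t₂ :- t) :* t₄ :* (a₂ :- a₄) :- (a :- a₂) :* ((t₄ :- t₂) :* t)) refl a (σ² a) (σ⁴ a) t (σ² t) (σ⁴ t)) e))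
      (quadratic-roots (σ² a - σ⁴ a) (Fin.#_ 2) (Fin.#_ 4) ts 0# (λ e → a∉K₂ (sym (σ-injective (σ-injective (x-y≡0⇒x≡y e))))))
      where
      ts = (σ⁴ a - a , Fin.#_ 0 , Fin.#_ 4) ∷ (a - σ² a , Fin.#_ 0 , Fin.#_ 2) ∷ []

    -- From the `q⁵ - q⁴` isotropic vectors the four inequations remove at most 1, `q²`, `q² + q³`
    -- and `q² + q⁴`. The isotropic count carries a factor `q`, cancelled at the outset.
    #good-bound : q ℕ.^ 5 ≤ # good? ℕ.+ (2 ℕ.* q ℕ.^ 4 ℕ.+ q ℕ.^ 3 ℕ.+ 3 ℕ.* q ℕ.^ 2 ℕ.+ 1)
    #good-bound = ℕ.*-cancelʳ-≤ _ _ q (ℕ.+-cancelʳ-≤ (q ℕ.^ 5) _ _ (begin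
      q ℕ.^ 5 ℕ.* q ℕ.+ q ℕ.^ 5
        ≡⟨ cong (ℕ._+ q ℕ.^ 5) (ℕ.*-comm (q ℕ.^ 5) q) ⟩
      q ℕ.^ 6 ℕ.+ q ℕ.^ 5
        ≤⟨ ℕ.+-monoˡ-≤ (q ℕ.^ 5) (#isotropic-bound δ δ≢0) ⟩
      # δ-isotropic? ℕ.* q ℕ.+ q ℕ.^ 5 ℕ.+ q ℕ.^ 5
        ≤⟨ ℕ.+-monoˡ-≤ (q ℕ.^ 5) (ℕ.+-monoˡ-≤ (q ℕ.^ 5) (ℕ.*-monoˡ-≤ q chain)) ⟩
      (# good? ℕ.+ (q ℕ.^ 2 ℕ.+ q ℕ.^ 4) ℕ.+ (q ℕ.^ 2 ℕ.+ q ℕ.^ 3) ℕ.+ q ℕ.^ 2 ℕ.+ 1) ℕ.* q ℕ.+ q ℕ.^ 5 ℕ.+ q ℕ.^ 5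
        ≡⟨ N.solve 2 (λ g q → let q² = q N.:^ 2; q³ = q N.:^ 3; q⁴ = q N.:^ 4; q⁵ = q N.:^ 5 in
             (g N.:+ (q² N.:+ q⁴) N.:+ (q² N.:+ q³) N.:+ q² N.:+ N.con 1) N.:* q N.:+ q⁵ N.:+ q⁵
             N.:= (g N.:+ (N.con 2 N.:* q⁴ N.:+ q³ N.:+ N.con 3 N.:* q² N.:+ N.con 1)) N.:* q N.:+ q⁵) refl (# good?) q ⟩
      (# good? ℕ.+ (2 ℕ.* q ℕ.^ 4 ℕ.+ q ℕ.^ 3 ℕ.+ 3 ℕ.* q ℕ.^ 2 ℕ.+ 1)) ℕ.* q ℕ.+ q ℕ.^ 5 ∎))
      where
      open ℕ.≤-Reasoning
      module N = +-*-Solver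
      nonzero? = λ t → isotropic? δ δ≢0 t ×-dec ¬? (t ≟ 0#)
      disproportional? = λ t → nonzero? t ×-dec ¬? (σ δ * σ² t ≟ δ * t)
      ϖ-good? = λ t → disproportional? t ×-dec ¬? (ϖ-numerator t ≟ 0#)
      chain : # δ-isotropic? ≤ # good? ℕ.+ (q ℕ.^ 2 ℕ.+ q ℕ.^ 4) ℕ.+ (q ℕ.^ 2 ℕ.+ q ℕ.^ 3) ℕ.+ q ℕ.^ 2 ℕ.+ 1
      chain = ℕ.≤-trans (#-except δ-isotropic? (_≟ 0#)) (ℕ.+-mono-≤ (ℕ.≤-trans (#-except nonzero? (λ t → σ δ * σ² t ≟ δ * t)) (ℕ.+-mono-≤
        (ℕ.≤-trans (#-except disproportional? (λ t → ϖ-numerator t ≟ 0#)) (ℕ.+-mono-≤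
          (ℕ.≤-trans (#-except ϖ-good? (λ t → det-numerator t ≟ 0#)) (ℕ.+-monoʳ-≤ (# good?) #det-zero)) #ϖ-zero))
        (#-proportional δ δ≢0)))
        (#-singleton (_≟ 0#) (λ _ _ e f → trans e (sym f))))

    module _ (t : K) (good : Good t) where

      t≢0 : t ≢ 0#
      t≢0 = proj₂ (proj₁ (proj₁ (proj₁ good)))

      m ε τ s : K
      m = inv t
      ε = δ * (t * σ t)
      τ = proj₁ (+σ-surjective ε (proj₁ (proj₁ (proj₁ (proj₁ good)))))
      s = m * τ

      τ+στ : τ + σ τ ≡ ε
      τ+στ = proj₂ (+σ-surjective ε (proj₁ (proj₁ (proj₁ (proj₁ good)))))

      mt : m * t ≡ 1#
      mt = inverseˡ t≢0

      σ-unit : ∀ {x y} → x * y ≡ 1# → σ x * σ y ≡ 1#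
      σ-unit e = trans (sym (σ.φ-* _ _)) (trans (cong σ e) σ.φ-1)

      m₁t₁ : σ m * σ t ≡ 1#
      m₁t₁ = σ-unit mt

      m₃t₃ : σ³ m * σ³ t ≡ 1#
      m₃t₃ = σ-unit (σ-unit m₁t₁)

      tangent : m * σ s + σ m * s ≡ δ
      tangent = begin
        m * σ s + σ m * s                    ≡⟨ cong (λ z → m * z + σ m * s) (σ.φ-* m τ) ⟩
        m * (σ m * σ τ) + σ m * (m * τ)      ≡⟨ solve 4 (λ m m₁ τ τ₁ → m :* (m₁ :* τ₁) :+ m₁ :* (m :* τ) := m :* m₁ :* (τ :+ τ₁)) refl m (σ m) τ (σ τ) ⟩
        m * σ m * (τ + σ τ)                  ≡⟨ cong (m * σ m *_) τ+στ ⟩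
        m * σ m * (δ * (t * σ t))            ≡⟨ solve 5 (λ m m₁ d t t₁ → m :* m₁ :* (d :* (t :* t₁)) := d :* ((m :* t) :* (m₁ :* t₁))) refl m (σ m) δ t (σ t) ⟩
        δ * ((m * t) * (σ m * σ t))          ≡⟨ cong₂ (λ x y → δ * (x * y)) mt m₁t₁ ⟩
        δ * (1# * 1#)                        ≡⟨ solve 1 (λ d → d :* (con (ℤ.+ 1) :* con (ℤ.+ 1)) := d) refl δ ⟩
        δ                                    ∎
        where open ≡-Reasoning

      -- Otherwise `τ` would lie in `K₂`, and `ε = τ + σ τ` would be fixed by `σ`; written out and
      -- divided by `σ t`, this is the proportionality excluded for good `t`.
      s∉K₂m : ∀ {k} → K₂ k → s ≢ k * m
      s∉K₂m {k} hk e = proj₂ (proj₁ (proj₁ good)) (*-cancelˡ (σ-≢0 t≢0) (begin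
        σ t * (σ δ * σ² t)      ≡⟨ solve 3 (λ x y z → x :* (y :* z) := y :* (x :* z)) refl (σ t) (σ δ) (σ² t) ⟩
        σ δ * (σ t * σ² t)      ≡⟨ sym (trans (σ.φ-* δ _) (cong (σ δ *_) (σ.φ-* t (σ t)))) ⟩
        σ ε                     ≡⟨ cong σ (sym τ+στ) ⟩
        σ (τ + σ τ)             ≡⟨ σ.φ-+ τ (σ τ) ⟩
        σ τ + σ² τ              ≡⟨ cong (σ τ +_) (subst K₂ (sym τ≡k) hk) ⟩
        σ τ + τ                 ≡⟨ trans (+-comm _ _) τ+στ ⟩
        δ * (t * σ t)           ≡⟨ solve 3 (λ x y z → y :* (z :* x) := x :* (y :* z)) refl (σ t) δ t ⟩
        σ t * (δ * t)           ∎))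
        where
        open ≡-Reasoning
        τ≡k : τ ≡ k
        τ≡k = *-cancelˡ (inv≢0 t≢0) (trans e (*-comm k m))

      -- Up to the factor `- t σ³t` this is `ϖ-numerator t`: the sum `ε - σε + σ²ε` telescopes to
      -- `τ + σ³ τ`.
      ϖ≢0 : a * σ³ a - b - σ³ b - (s * σ³ m + σ³ s * m) ≢ 0#
      ϖ≢0 e = proj₂ (proj₁ good) (begin
        δ * (t * σ t) - σ δ * (σ t * σ² t) + σ² δ * (σ² t * σ³ t) - ρ * (t * σ³ t)
          ≡⟨ cong₂ (λ x (y , z) → x - y + z - ρ * (t * σ³ t)) (sym τ+στ) (cong₂ _,_ σε σ²ε) ⟩
        (τ + σ τ) - (σ τ + σ² τ) + (σ² τ + σ³ τ) - ρ * (t * σ³ t)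
          ≡⟨ solve 7 (λ u u₁ u₂ u₃ r t t₃ → let I = con (ℤ.+ 1) in (u :+ u₁) :- (u₁ :+ u₂) :+ (u₂ :+ u₃) :- r :* (t :* t₃) := :- (r :* (t :* t₃) :- (I :* I) :* (u :+ u₃))) refl
               τ (σ τ) (σ² τ) (σ³ τ) ρ t (σ³ t) ⟩
        - (ρ * (t * σ³ t) - (1# * 1#) * (τ + σ³ τ))
          ≡⟨ cong₂ (λ x y → - (ρ * (t * σ³ t) - (x * y) * (τ + σ³ τ))) (sym mt) (sym m₃t₃) ⟩
        - (ρ * (t * σ³ t) - ((m * t) * (σ³ m * σ³ t)) * (τ + σ³ τ))
          ≡⟨ solve 7 (λ r t t₃ m m₃ u u₃ → :- (r :* (t :* t₃) :- ((m :* t) :* (m₃ :* t₃)) :* (u :+ u₃)) := (:- (t :* t₃)) :* (r :- ((m :* u) :* m₃ :+ (m₃ :* u₃) :* m))) refl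
               ρ t (σ³ t) m (σ³ m) τ (σ³ τ) ⟩
        - (t * σ³ t) * (ρ - (s * σ³ m + (σ³ m * σ³ τ) * m))
          ≡⟨ cong (λ z → - (t * σ³ t) * (ρ - (s * σ³ m + z * m))) (sym (trans (cong σ (σ²-eval (v 0 :* v 1) (m ∷ τ ∷ []))) (σ.φ-* _ _))) ⟩
        - (t * σ³ t) * (ρ - (s * σ³ m + σ³ s * m))
          ≡⟨ cong (- (t * σ³ t) *_) e ⟩
        - (t * σ³ t) * 0#
          ≡⟨ zeroʳ _ ⟩
        0# ∎)
        where
        open ≡-Reasoning
        σε : σ δ * (σ t * σ² t) ≡ σ τ + σ² τ
        σε = trans (sym (trans (σ.φ-* δ _) (cong (σ δ *_) (σ.φ-* t (σ t))))) (trans (cong σ (sym τ+στ)) (σ.φ-+ τ (σ τ)))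
        σ²ε : σ² δ * (σ² t * σ³ t) ≡ σ² τ + σ³ τ
        σ²ε = trans (sym (trans (σ.φ-* _ _) (cong (σ² δ *_) (σ.φ-* _ _)))) (trans (cong σ σε) (σ.φ-+ _ _))

      det≢0 : det m a ≢ 0#
      det≢0 e = proj₂ good (begin
        (σ² t - t) * σ⁴ t * (σ² a - σ⁴ a) - (a - σ² a) * ((σ⁴ t - σ² t) * t)
          ≡⟨ solve 6 (λ a a₂ a₄ t t₂ t₄ → let I = con (ℤ.+ 1) in
               (t₂ :- t) :* t₄ :* (a₂ :- a₄) :- (a :- a₂) :* ((t₄ :- t₂) :* t)
               := (I :* t₂ :- I :* t) :* t₄ :* (a₂ :- a₄) :- (a :- a₂) :* ((I :* t₄ :- I :* t₂) :* t)) refl a (σ² a) (σ⁴ a) t (σ² t) (σ⁴ t) ⟩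
        (1# * σ² t - 1# * t) * σ⁴ t * (σ² a - σ⁴ a) - (a - σ² a) * ((1# * σ⁴ t - 1# * σ² t) * t)
          ≡⟨ cong₂ (λ x (y , z) → (x * σ² t - y * t) * σ⁴ t * (σ² a - σ⁴ a) - (a - σ² a) * ((y * σ⁴ t - z * σ² t) * t))
               (sym mt) (cong₂ _,_ (sym m₂t₂) (sym (σ-unit (σ-unit m₂t₂)))) ⟩
        ((m * t) * σ² t - (σ² m * σ² t) * t) * σ⁴ t * (σ² a - σ⁴ a) - (a - σ² a) * (((σ² m * σ² t) * σ⁴ t - (σ⁴ m * σ⁴ t) * σ² t) * t)
          ≡⟨ solve 9 (λ a a₂ a₄ t t₂ t₄ m m₂ m₄ →
               ((m :* t) :* t₂ :- (m₂ :* t₂) :* t) :* t₄ :* (a₂ :- a₄) :- (a :- a₂) :* (((m₂ :* t₂) :* t₄ :- (m₄ :* t₄) :* t₂) :* t)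
               := (t :* t₂ :* t₄) :* ((m :- m₂) :* (a₂ :- a₄) :- (a :- a₂) :* (m₂ :- m₄))) refl a (σ² a) (σ⁴ a) t (σ² t) (σ⁴ t) m (σ² m) (σ⁴ m) ⟩
        (t * σ² t * σ⁴ t) * det m a    ≡⟨ cong ((t * σ² t * σ⁴ t) *_) e ⟩
        (t * σ² t * σ⁴ t) * 0#         ≡⟨ zeroʳ _ ⟩
        0#                             ∎)
        where
        open ≡-Reasoning
        m₂t₂ : σ² m * σ² t ≡ 1#
        m₂t₂ = σ-unit m₁t₁

  -- Secants

  module _ (a b : K) where

    onH? : ∀ l ξ → Dec (ξ * σ ξ ≡ σ (b + l * (ξ - a)) + (b + l * (ξ - a)))
    onH? l ξ = ξ * σ ξ ≟ σ (b + l * (ξ - a)) + (b + l * (ξ - a))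

    meet : K → ℕ
    meet l = # (onH? l)

    meet≤q+1 : ∀ l → meet l ≤ q ℕ.+ 1
    meet≤q+1 l = ℕ.≤-trans (#-mono (onH? l) (λ ξ → 1# * (ξ * σ ξ) + - l * ξ + - σ l * σ ξ + k ≟ 0#) (λ ξ e →
        trans (solve 8 (λ ξ ξ₁ l l₁ a a₁ b b₁ → con (ℤ.+ 1) :* (ξ :* ξ₁) :+ (:- l) :* ξ :+ (:- l₁) :* ξ₁ :+ (l :* a :+ l₁ :* a₁ :- b :- b₁)
               := ξ :* ξ₁ :- ((b₁ :+ l₁ :* (ξ₁ :- a₁)) :+ (b :+ l :* (ξ :- a)))) refl ξ (σ ξ) l (σ l) a (σ a) b (σ b))
          (x≡y⇒x-y≡0 (trans e (cong (_+ (b + l * (ξ - a))) (σ-eval (v 0 :+ v 1 :* (v 2 :- v 3)) (b ∷ l ∷ ξ ∷ a ∷ [])))))))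
      (hermitian-roots 1# (- l) (- σ l) k (λ e → FinField.0≢1 F (sym e)))
      where
      k = l * a + σ l * σ a - b - σ b

    module Line (m s w x y k l : K) (m≢0 : m ≢ 0#) (tangent : m * σ s + σ m * s ≡ a * σ a - b - σ b)
      (s∉K₂m : ∀ {c} → K₂ c → s ≢ c * m)
      (w∈K₂ : K₂ w) (x∈K₂ : K₂ x) (y∈K₂ : K₂ y) (k∈K₂ : K₂ k)
      (linear-relation : a * x - b * w - y ≡ s + m * k)
      (norm-relation : x * σ x - y * σ w - σ y * w ≡ k + σ k)
      (direction≢0 : σ x - a * σ w ≢ 0#) (slope : l * (σ x - a * σ w) ≡ σ y - b * σ w) where

      d : K
      d = σ x - a * σ w

      -- The Hermitian form at the point α (a, b, 1) + (σ x, σ y, σ w) of the line.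
      H : K → K
      H α = (α * a + σ x) * (σ α * σ a + x) - (α * b + σ y) * (σ α + w) - (σ α * σ b + y) * (α + σ w)

      -- The hypotheses match the coefficients of both sides one by one: `tangent` at `α σα`,
      -- `linear-relation` at `α` and its conjugate at `σ α`, `norm-relation` at the constant term.
      H-split : ∀ α → H α ≡ (α * s + σ k) * (σ α * σ m + 1#) + (σ α * σ s + k) * (α * m + 1#)
      H-split α = begin
        (α * a + σ x) * (σ α * σ a + x) - (α * b + σ y) * (σ α + w) - (σ α * σ b + y) * (α + σ w)
          ≡⟨ solve 12 (λ α α₁ a a₁ b b₁ w w₁ x x₁ y y₁ →
               (α :* a :+ x₁) :* (α₁ :* a₁ :+ x) :- (α :* b :+ y₁) :* (α₁ :+ w) :- (α₁ :* b₁ :+ y) :* (α :+ w₁)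
               := α :* α₁ :* (a :* a₁ :- b :- b₁) :+ α :* (a :* x :- b :* w :- y) :+ α₁ :* (a₁ :* x₁ :- b₁ :* w₁ :- y₁) :+ (x :* x₁ :- y :* w₁ :- y₁ :* w)) refl
               α (σ α) a (σ a) b (σ b) w (σ w) x (σ x) y (σ y) ⟩
        α * σ α * (a * σ a - b - σ b) + α * (a * x - b * w - y) + σ α * (σ a * σ x - σ b * σ w - σ y) + (x * σ x - y * σ w - σ y * w)
          ≡⟨ cong₂ (λ (p , r) (u , z) → α * σ α * p + α * r + σ α * u + z) (cong₂ _,_ (sym tangent) linear-relation)
               (cong₂ _,_ (trans (sym (σ-eval (v 0 :* v 1 :- v 2 :* v 3 :- v 4) (a ∷ x ∷ b ∷ w ∷ y ∷ [])))
                  (trans (cong σ linear-relation) (σ-eval (v 0 :+ v 1 :* v 2) (s ∷ m ∷ k ∷ [])))) norm-relation) ⟩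
        α * σ α * (m * σ s + σ m * s) + α * (s + m * k) + σ α * (σ s + σ m * σ k) + (k + σ k)
          ≡⟨ solve 8 (λ α α₁ m m₁ s s₁ k k₁ → α :* α₁ :* (m :* s₁ :+ m₁ :* s) :+ α :* (s :+ m :* k) :+ α₁ :* (s₁ :+ m₁ :* k₁) :+ (k :+ k₁)
               := (α :* s :+ k₁) :* (α₁ :* m₁ :+ con (ℤ.+ 1)) :+ (α₁ :* s₁ :+ k) :* (α :* m :+ con (ℤ.+ 1))) refl
               α (σ α) m (σ m) s (σ s) k (σ k) ⟩
        (α * s + σ k) * (σ α * σ m + 1#) + (σ α * σ s + k) * (α * m + 1#) ∎
        where open ≡-Reasoning

      zero? : ∀ α → Dec (H α ≡ 0#)
      zero? α = H α ≟ 0#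

      σ-X : ∀ α → σ (α * s + σ k) ≡ σ α * σ s + k
      σ-X α = trans (σ-eval (v 0 :* v 1 :+ v 2) (α ∷ s ∷ σ k ∷ [])) (cong (σ α * σ s +_) k∈K₂)

      σ-Y : ∀ α → σ (α * m + 1#) ≡ σ α * σ m + 1#
      σ-Y α = σ-eval (v 0 :* v 1 :+ con (ℤ.+ 1)) (α ∷ m ∷ [])

      denominator≢0 : ∀ {ι} → Anti ι → s - ι * m ≢ 0#
      denominator≢0 h e = s∉K₂m (Anti⇒K₂ h) (x-y≡0⇒x≡y e)

      -- The solution `α` of `X = ι Y` with `X = α s + σ k` and `Y = α m + 1`. There the form equals
      -- `(ι + σ ι) Y σY`, which is zero when `σ ι = - ι`.
      parameter : K → K
      parameter ι = (ι - σ k) * inv (s - ι * m)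

      parameter-ratio : ∀ {ι} → Anti ι → parameter ι * s + σ k ≡ ι * (parameter ι * m + 1#)
      parameter-ratio {ι} h = x-y≡0⇒x≡y (begin
        p * s + σ k - ι * (p * m + 1#)       ≡⟨ solve 5 (λ p s k ι m → p :* s :+ k :- ι :* (p :* m :+ con (ℤ.+ 1)) := p :* (s :- ι :* m) :- (ι :- k)) refl p s (σ k) ι m ⟩
        p * (s - ι * m) - (ι - σ k)          ≡⟨ x≡y⇒x-y≡0 (trans (*-assoc _ _ _) (trans (cong ((ι - σ k) *_) (inverseˡ (denominator≢0 h))) (*-identityʳ _))) ⟩
        0#                                   ∎)
        where
        open ≡-Reasoning
        p = parameter ι

      proper : ∀ {ι} → Anti ι → parameter ι * m + 1# ≢ 0#
      proper {ι} h e = s∉K₂m (K₂-σ k∈K₂) (begin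
        s                          ≡⟨ solve 4 (λ p s k m → s := s :* (p :* m :+ con (ℤ.+ 1)) :- m :* (p :* s :+ k) :+ k :* m) refl p s (σ k) m ⟩
        s * (p * m + 1#) - m * (p * s + σ k) + σ k * m
                                   ≡⟨ cong₂ (λ x y → s * x - m * y + σ k * m) e (trans (parameter-ratio h) (trans (cong (ι *_) e) (zeroʳ ι))) ⟩
        s * 0# - m * 0# + σ k * m  ≡⟨ solve 3 (λ s m z → s :* con (ℤ.+ 0) :- m :* con (ℤ.+ 0) :+ z := z) refl s m (σ k * m) ⟩
        σ k * m                    ∎)
        where
        open ≡-Reasoning
        p = parameter ι

      parameter-zero : ∀ {ι} → Anti ι → H (parameter ι) ≡ 0#
      parameter-zero {ι} h = trans (H-split p) (begin
        (p * s + σ k) * (σ p * σ m + 1#) + (σ p * σ s + k) * (p * m + 1#)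
          ≡⟨ cong₂ (λ x y → x * (σ p * σ m + 1#) + y * (p * m + 1#)) (parameter-ratio h)
               (trans (sym (σ-X p)) (trans (cong σ (parameter-ratio h)) (trans (σ.φ-* ι _) (cong₂ _*_ h (σ-Y p))))) ⟩
        ι * (p * m + 1#) * (σ p * σ m + 1#) + (- ι) * (σ p * σ m + 1#) * (p * m + 1#)
          ≡⟨ solve 3 (λ i y z → i :* y :* z :+ (:- i) :* z :* y := con (ℤ.+ 0)) refl ι (p * m + 1#) (σ p * σ m + 1#) ⟩
        0# ∎)
        where
        open ≡-Reasoning
        p = parameter ι

      -- The remaining zero, at `Y = 0`. For `m = 1 / t` it is `- t`, and this is how `t` is
      -- recovered from the line.
      special : K
      special = - inv m

      special-Y : special * m + 1# ≡ 0#
      special-Y = trans (cong (_+ 1#) (trans (sym (-‿distribˡ-* _ _)) (cong -_ (inverseˡ m≢0)))) (-‿inverseˡ 1#)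

      special-zero : H special ≡ 0#
      special-zero = trans (H-split special) (begin
        (special * s + σ k) * (σ special * σ m + 1#) + (σ special * σ s + k) * (special * m + 1#)
          ≡⟨ cong₂ (λ x y → (special * s + σ k) * x + (σ special * σ s + k) * y) (trans (sym (σ-Y special)) (trans (cong σ special-Y) σ.φ-0)) special-Y ⟩
        (special * s + σ k) * 0# + (σ special * σ s + k) * 0#
          ≡⟨ solve 2 (λ x y → x :* con (ℤ.+ 0) :+ y :* con (ℤ.+ 0) := con (ℤ.+ 0)) refl _ _ ⟩
        0# ∎)
        where open ≡-Reasoning

      q+1≤#zero : q ℕ.+ 1 ≤ # zero?
      q+1≤#zero = ℕ.≤-trans (ℕ.+-mono-≤ (ℕ.≤-trans q≤#Anti
          (#-injective Anti? (λ α → zero? α ×-dec ¬? (α * m + 1# ≟ 0#)) parameter (λ ι h → parameter-zero h , proper h) injective))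
          (ℕ.≤-reflexive (sym (#-≡ special))))
        (#-disjoint (λ α → zero? α ×-dec ¬? (α * m + 1# ≟ 0#)) (special ≟_) zero? (λ _ → proj₁) (λ { _ refl → special-zero }) (λ { _ (_ , n) refl → n special-Y }))
        where
        injective : ∀ i j → Anti i → Anti j → parameter i ≡ parameter j → i ≡ j
        injective i j hi hj e = *-cancelˡ (proper hi) (trans (*-comm _ i) (trans (sym (parameter-ratio hi))
          (trans (cong (λ p → p * s + σ k) e) (trans (parameter-ratio hj) (trans (*-comm j _) (cong (λ p → (p * m + 1#) * j) (sym e)))))))

      -- Zeros of the form are affine points: if the third coordinate vanished, the first would be
      -- `d` and the form would reduce to the norm of `d`, which is nonzero.
      weight≢0 : ∀ {α} → H α ≡ 0# → α + σ w ≢ 0#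
      weight≢0 {α} h e = *-≢0 direction≢0 (σ-≢0 direction≢0) (begin
        d * σ d
          ≡⟨ cong (d *_) (trans (σ-eval (v 0 :- v 1 :* v 2) (σ x ∷ a ∷ σ w ∷ [])) (cong₂ (λ x w → x - σ a * w) x∈K₂ w∈K₂)) ⟩
        (σ x - a * σ w) * (x - σ a * w)
          ≡⟨ solve 12 (λ α α₁ a a₁ b b₁ w w₁ x x₁ y y₁ →
               let W = α :+ w₁; W₁ = α₁ :+ w in
               (x₁ :- a :* w₁) :* (x :- a₁ :* w) :=
               (α :* a :+ x₁) :* (α₁ :* a₁ :+ x) :- (α :* b :+ y₁) :* (α₁ :+ w) :- (α₁ :* b₁ :+ y) :* (α :+ w₁)
                 :- a :* W :* (α₁ :* a₁ :+ x) :- (x₁ :- a :* w₁) :* a₁ :* W₁ :+ (α :* b :+ y₁) :* W₁ :+ (α₁ :* b₁ :+ y) :* W) refl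
               α (σ α) a (σ a) b (σ b) w (σ w) x (σ x) y (σ y) ⟩
        H α - a * (α + σ w) * (σ α * σ a + x) - (σ x - a * σ w) * σ a * (σ α + w) + (α * b + σ y) * (σ α + w) + (σ α * σ b + y) * (α + σ w)
          ≡⟨ cong₂ (λ h (W , W₁) → h - a * W * (σ α * σ a + x) - (σ x - a * σ w) * σ a * W₁ + (α * b + σ y) * W₁ + (σ α * σ b + y) * W)
               h (cong₂ _,_ e (trans (sym (trans (σ.φ-+ α (σ w)) (cong (σ α +_) w∈K₂))) (trans (cong σ e) σ.φ-0))) ⟩
        0# - a * 0# * (σ α * σ a + x) - (σ x - a * σ w) * σ a * 0# + (α * b + σ y) * 0# + (σ α * σ b + y) * 0#
          ≡⟨ solve 6 (λ a p d a₁ r u → let O = con (ℤ.+ 0) in O :- a :* O :* p :- d :* a₁ :* O :+ r :* O :+ u :* O := O) refl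
               a (σ α * σ a + x) (σ x - a * σ w) (σ a) (α * b + σ y) (σ α * σ b + y) ⟩
        0# ∎)
        where open ≡-Reasoning

      -- The quotient `(α a + σ x) / (α + σ w)`, written so that injectivity in `α` is visible.
      abscissa : K → K
      abscissa α = a + d * inv (α + σ w)

      abscissa-onH : ∀ α → H α ≡ 0# → abscissa α * σ (abscissa α) ≡ σ (b + l * (abscissa α - a)) + (b + l * (abscissa α - a))
      abscissa-onH α h = *-cancelˡ (*-≢0 W≢0 (σ-≢0 W≢0)) (x-y≡0⇒x≡y (begin
        (W * σ W) * (ξ * σ ξ) - (W * σ W) * (σ η + η)
          ≡⟨ solve 6 (λ W W₁ x x₁ y y₁ → (W :* W₁) :* (x :* x₁) :- (W :* W₁) :* (y₁ :+ y) := (W :* x) :* (W₁ :* x₁) :- (W :* y) :* W₁ :- (W₁ :* y₁) :* W) refl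
               W (σ W) ξ (σ ξ) η (σ η) ⟩
        (W * ξ) * (σ W * σ ξ) - (W * η) * σ W - (σ W * σ η) * W
          ≡⟨ cong₂ (λ (X , X₁) (Y , Y₁ , W₁) → X * X₁ - Y * W₁ - Y₁ * W) (cong₂ _,_ Wξ (conjugate Wξ (trans (σ-eval (v 0 :* v 1 :+ v 2) (α ∷ a ∷ σ x ∷ [])) (cong (σ α * σ a +_) x∈K₂))))
               (cong₂ _,_ Wη (cong₂ _,_ (conjugate Wη (trans (σ-eval (v 0 :* v 1 :+ v 2) (α ∷ b ∷ σ y ∷ [])) (cong (σ α * σ b +_) y∈K₂)))
                 (trans (σ.φ-+ α (σ w)) (cong (σ α +_) w∈K₂)))) ⟩
        H α
          ≡⟨ h ⟩
        0# ∎))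
        where
        open ≡-Reasoning
        W = α + σ w
        W≢0 = weight≢0 h
        ξ = abscissa α
        η = b + l * (ξ - a)
        conjugate : ∀ {z z′ u} → W * z ≡ z′ → σ z′ ≡ u → σ W * σ z ≡ u
        conjugate e f = trans (sym (σ.φ-* W _)) (trans (cong σ e) f)
        Wd : W * (d * inv W) ≡ d
        Wd = trans (solve 3 (λ W d i → W :* (d :* i) := d :* (W :* i)) refl W d (inv W)) (trans (cong (d *_) (inverseʳ W≢0)) (*-identityʳ d))
        Wξ : W * ξ ≡ α * a + σ x
        Wξ = trans (distribˡ W a _) (trans (cong (W * a +_) Wd) (solve 4 (λ α a x w → (α :+ w) :* a :+ (x :- a :* w) := α :* a :+ x) refl α a (σ x) (σ w)))
        Wη : W * η ≡ α * b + σ y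
        Wη = begin
          W * (b + l * ((a + d * inv W) - a))    ≡⟨ solve 5 (λ W b l a D → W :* (b :+ l :* ((a :+ D) :- a)) := W :* b :+ l :* (W :* D)) refl W b l a (d * inv W) ⟩
          W * b + l * (W * (d * inv W))          ≡⟨ cong (λ z → W * b + l * z) Wd ⟩
          W * b + l * d                          ≡⟨ cong (W * b +_) slope ⟩
          W * b + (σ y - b * σ w)                ≡⟨ solve 4 (λ α b y w → (α :+ w) :* b :+ (y :- b :* w) := α :* b :+ y) refl α b (σ y) (σ w) ⟩
          α * b + σ y                            ∎

      abscissa-injective : ∀ i j → H i ≡ 0# → H j ≡ 0# → abscissa i ≡ abscissa j → i ≡ j
      abscissa-injective i j hi hj e = x-y≡0⇒x≡y (begin
        i - j                                         ≡⟨ solve 3 (λ i j w → i :- j := (i :+ w) :* con (ℤ.+ 1) :- (j :+ w) :* con (ℤ.+ 1)) refl i j (σ w) ⟩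
        (i + σ w) * 1# - (j + σ w) * 1#               ≡⟨ cong₂ (λ x y → (i + σ w) * x - (j + σ w) * y) (sym (inverseʳ (weight≢0 hj))) (sym (inverseʳ (weight≢0 hi))) ⟩
        (i + σ w) * ((j + σ w) * inv (j + σ w)) - (j + σ w) * ((i + σ w) * inv (i + σ w))
                                                      ≡⟨ cong (λ z → (i + σ w) * ((j + σ w) * inv (j + σ w)) - (j + σ w) * ((i + σ w) * z)) invs ⟩
        (i + σ w) * ((j + σ w) * inv (j + σ w)) - (j + σ w) * ((i + σ w) * inv (j + σ w))
                                                      ≡⟨ solve 3 (λ x y i → x :* (y :* i) :- y :* (x :* i) := con (ℤ.+ 0)) refl (i + σ w) (j + σ w) (inv (j + σ w)) ⟩
        0#                                            ∎)
        where
        open ≡-Reasoning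
        cancel : ∀ z → a + z - a ≡ z
        cancel z = solve 2 (λ a z → a :+ z :- a := z) refl a z
        invs : inv (i + σ w) ≡ inv (j + σ w)
        invs = *-cancelˡ direction≢0 (trans (sym (cancel _)) (trans (cong (_- a) e) (cancel _)))

      meet≡q+1 : meet l ≡ q ℕ.+ 1
      meet≡q+1 = ℕ.≤-antisym (meet≤q+1 l) (ℕ.≤-trans q+1≤#zero (#-injective zero? (onH? l) abscissa abscissa-onH abscissa-injective))

    secant? : ∀ l → Dec (meet l ≡ q ℕ.+ 1)
    secant? l = meet l ℕ.≟ q ℕ.+ 1

  -- Double counting of lines and pairs (t, w)

  module Incidence (a b : K) (a∉K₂ : σ² a ≢ a) (δ≢0 : a * σ a - b - σ b ≢ 0#) where

    open Good a b a∉K₂ δ≢0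

    -- (σ x, σ y, σ w) runs over the K₂-rational points of the line with slope l through (a, b).
    ordinate : K → K → K → K
    ordinate l w x = σ⁵ (l * (σ x - a * σ w) + b * σ w)

    -- The Hermitian form on the line evaluated at `α = - t`, which vanishes there since `- t` is
    -- the zero `special`. As a polynomial in `t` it has degree `q + 1`.
    incidence : K → K → K → K → K
    incidence x y w t = δ * (t * σ t) + - (a * x - b * w - y) * t + - σ (a * x - b * w - y) * σ t + (x * σ x - y * σ w - σ y * w)

    Rational : K → K → K → Set
    Rational l w x = K₂ x × K₂ (ordinate l w x)

    rational? : ∀ l w x → Dec (Rational l w x)
    rational? l w x = K₂? x ×-dec K₂? (ordinate l w x)

    touches? : ∀ l w t x → Dec (incidence x (ordinate l w x) w t ≡ 0#)
    touches? l w t x = incidence x (ordinate l w x) w t ≟ 0#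

    Tangential : K → K → K → Set
    Tangential l w t = ∃ λ x → Rational l w x × incidence x (ordinate l w x) w t ≡ 0#

    tangential? : ∀ l w t → Dec (Tangential l w t)
    tangential? l w t = Fin.any? (λ x → rational? l w x ×-dec touches? l w t x)

    #tangential : ∀ l w → # (tangential? l w) ≤ # (rational? l w) ℕ.* (q ℕ.+ 1)
    #tangential l w = #-cover (tangential? l w) (rational? l w) (touches? l w) (q ℕ.+ 1) (λ _ p → p)
      (λ x _ → hermitian-roots δ _ _ _ δ≢0)

    K₂*? : ∀ w → Dec (K₂ w × w ≢ 0#)
    K₂*? w = K₂? w ×-dec ¬? (w ≟ 0#)

    -- The only line through (a, b) that can contain two K₂-rational points.
    exceptional : K
    exceptional = (σ² b - b) * inv (σ² a - a)

    σ-ordinate : ∀ l w x → σ (ordinate l w x) ≡ l * (σ x - a * σ w) + b * σ w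
    σ-ordinate l w x = σ⁶ _

    -- Two such points with the same `w` would put the slope into `K₂`. The line would then also
    -- pass through the conjugate of `(a, b)` under `σ²`, and this fixes its slope.
    rational-unique : ∀ l w → K₂ w × w ≢ 0# → l ≢ exceptional → # (rational? l w) ≤ 1
    rational-unique l w (w∈K₂ , w≢0) l≢ = #-singleton (rational? l w) (λ i j hi hj → by i j hi hj (i ≟ j))
      where
      open ≡-Reasoning
      by : ∀ i j → Rational l w i → Rational l w j → Dec (i ≡ j) → i ≡ j
      by i j _ _ (yes e) = e
      by i j (hi , hyi) (hj , hyj) (no i≢j) = contradiction l≡ l≢
        where
        yi = ordinate l w i
        yj = ordinate l w j
        i-j≢0 : σ i - σ j ≢ 0#
        i-j≢0 e = i≢j (σ-injective (x-y≡0⇒x≡y e))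
        difference : l * (σ i - σ j) ≡ σ yi - σ yj
        difference = trans (solve 5 (λ l i j p r → l :* (i :- j) := (l :* (i :- p) :+ r) :- (l :* (j :- p) :+ r)) refl l (σ i) (σ j) (a * σ w) (b * σ w))
          (sym (cong₂ _-_ (σ-ordinate l w i) (σ-ordinate l w j)))
        l∈K₂ : K₂ l
        l∈K₂ = *-cancelˡ i-j≢0 (begin
          (σ i - σ j) * σ² l            ≡⟨ cong₂ (λ i j → (σ i - σ j) * σ² l) (sym hi) (sym hj) ⟩
          (σ³ i - σ³ j) * σ² l          ≡⟨ *-comm _ _ ⟩
          σ² l * (σ³ i - σ³ j)          ≡⟨ sym (σ²-eval (v 0 :* (v 1 :- v 2)) (l ∷ σ i ∷ σ j ∷ [])) ⟩
          σ² (l * (σ i - σ j))          ≡⟨ cong σ² difference ⟩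
          σ² (σ yi - σ yj)              ≡⟨ trans (σ²-eval (v 0 :- v 1) (σ yi ∷ σ yj ∷ [])) (cong₂ (λ x y → σ x - σ y) hyi hyj) ⟩
          σ yi - σ yj                   ≡⟨ sym difference ⟩
          l * (σ i - σ j)               ≡⟨ *-comm _ _ ⟩
          (σ i - σ j) * l               ∎)
        conjugate-line : l * (σ i - σ² a * σ w) + σ² b * σ w ≡ l * (σ i - a * σ w) + b * σ w
        conjugate-line = begin
          l * (σ i - σ² a * σ w) + σ² b * σ w             ≡⟨ cong₂ (λ l (i , w) → l * (σ i - σ² a * σ w) + σ² b * σ w) (sym l∈K₂) (cong₂ _,_ (sym hi) (sym w∈K₂)) ⟩
          σ² l * (σ³ i - σ² a * σ³ w) + σ² b * σ³ w       ≡⟨ sym (σ²-eval (v 0 :* (v 1 :- v 2 :* v 3) :+ v 4 :* v 3) (l ∷ σ i ∷ a ∷ σ w ∷ b ∷ [])) ⟩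
          σ² (l * (σ i - a * σ w) + b * σ w)              ≡⟨ cong σ² (sym (σ-ordinate l w i)) ⟩
          σ² (σ yi)                                       ≡⟨ cong σ hyi ⟩
          σ yi                                            ≡⟨ σ-ordinate l w i ⟩
          l * (σ i - a * σ w) + b * σ w                   ∎
        a₂-a≢0 : σ² a - a ≢ 0#
        a₂-a≢0 e = a∉K₂ (x-y≡0⇒x≡y e)
        product : (σ² a - a) * l ≡ σ² b - b
        product = x-y≡0⇒x≡y (xy≡0⇒ (begin
          σ w * ((σ² a - a) * l - (σ² b - b))
            ≡⟨ solve 7 (λ w i a a₂ b b₂ l → w :* ((a₂ :- a) :* l :- (b₂ :- b)) := (l :* (i :- a :* w) :+ b :* w) :- (l :* (i :- a₂ :* w) :+ b₂ :* w)) refl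
                 (σ w) (σ i) a (σ² a) b (σ² b) l ⟩
          (l * (σ i - a * σ w) + b * σ w) - (l * (σ i - σ² a * σ w) + σ² b * σ w)
            ≡⟨ x≡y⇒x-y≡0 (sym conjugate-line) ⟩
          0# ∎) (σ-≢0 w≢0))
        l≡ : l ≡ exceptional
        l≡ = *-cancelˡ a₂-a≢0 (trans product (sym (trans (solve 3 (λ p d i → p :* (d :* i) := d :* (p :* i)) refl (σ² a - a) (σ² b - b) (inv (σ² a - a)))
          (trans (cong ((σ² b - b) *_) (inverseʳ a₂-a≢0)) (*-identityʳ _)))))

    secant-number : ℕ
    secant-number = # (secant? a b)

    Witnessed : K → K → Set
    Witnessed t w = ∃ λ l → meet a b l ≡ q ℕ.+ 1 × Tangential l w t

    witnessed? : ∀ t w → Dec (Witnessed t w)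
    witnessed? t w = Fin.any? (λ l → secant? a b l ×-dec tangential? l w t)

    -- An ordinary secant has at most one rational point with this `w`, and each point admits at
    -- most `q + 1` values of `t`. On the exceptional line only the trivial bound `q²` for the
    -- number of `x` is available.
    #witnessed : ∀ w → K₂ w × w ≢ 0# → # (λ t → witnessed? t w) ≤ (secant-number ℕ.+ q ℕ.^ 2) ℕ.* (q ℕ.+ 1)
    #witnessed w hw = begin
      # (λ t → witnessed? t w)
        ≤⟨ #-⊎ (λ t → witnessed? t w) ordinary? (tangential? exceptional w) (λ t (l , p) → split t l p (l ≟ exceptional)) ⟩
      # ordinary? ℕ.+ # (tangential? exceptional w)
        ≤⟨ ℕ.+-mono-≤
             (#-cover ordinary? (secant? a b) (λ t l → ¬? (l ≟ exceptional) ×-dec tangential? l w t) (q ℕ.+ 1) (λ t (l , s , p) → l , s , p) (λ l _ → per-line l (l ≟ exceptional)))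
             (ℕ.≤-trans (#tangential exceptional w) (ℕ.*-monoˡ-≤ (q ℕ.+ 1) (ℕ.≤-trans (#-mono (rational? exceptional w) K₂? (λ _ → proj₁)) #K₂≤q²))) ⟩
      secant-number ℕ.* (q ℕ.+ 1) ℕ.+ q ℕ.^ 2 ℕ.* (q ℕ.+ 1)
        ≡⟨ ℕ.*-distribʳ-+ (q ℕ.+ 1) secant-number (q ℕ.^ 2) ⟨
      (secant-number ℕ.+ q ℕ.^ 2) ℕ.* (q ℕ.+ 1) ∎
      where
      open ℕ.≤-Reasoning
      Ordinary : K → Set
      Ordinary t = ∃ λ l → meet a b l ≡ q ℕ.+ 1 × l ≢ exceptional × Tangential l w t
      ordinary? : ∀ t → Dec (Ordinary t)
      ordinary? t = Fin.any? (λ l → secant? a b l ×-dec ¬? (l ≟ exceptional) ×-dec tangential? l w t)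
      split : ∀ t l → meet a b l ≡ q ℕ.+ 1 × Tangential l w t → Dec (l ≡ exceptional) → Ordinary t ⊎ Tangential exceptional w t
      split t l (_ , h) (yes e) = inj₂ (subst (λ l → Tangential l w t) e h)
      split t l (s , h) (no n)  = inj₁ (l , s , n , h)
      per-line : ∀ l → Dec (l ≡ exceptional) → # (λ t → ¬? (l ≟ exceptional) ×-dec tangential? l w t) ≤ q ℕ.+ 1
      per-line l (yes e) = ℕ.≤-trans (ℕ.≤-reflexive (#-none (λ t → ¬? (l ≟ exceptional) ×-dec tangential? l w t) (λ t (n , _) → n e))) z≤n
      per-line l (no n)  = ℕ.≤-trans (#-mono (λ t → ¬? (l ≟ exceptional) ×-dec tangential? l w t) (tangential? l w) (λ _ → proj₂)) (ℕ.≤-trans (#tangential l w)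
        (ℕ.≤-trans (ℕ.*-monoˡ-≤ (q ℕ.+ 1) (rational-unique l w hw n)) (ℕ.≤-reflexive (ℕ.*-identityˡ _))))

    module _ (t : K) (good : Good t) where

      open Touch a b (m t good) (s t good) (det≢0 t good) (tangent t good) (ϖ≢0 t good)

      private
        mₜ = m t good
        sₜ = s t good

      witness-from : ∀ w x y k → K₂ w → w ≢ 0# → (K₂ x × K₂ y × K₂ k) → a * x - b * w - y ≡ sₜ + mₜ * k →
                     x * σ x - y * σ w - σ y * w ≡ k + σ k → Witnessed t w
      witness-from w x y k w∈K₂ w≢0 (x∈K₂ , y∈K₂ , k∈K₂) linear-relation norm-relation =
        l , Line.meet≡q+1 a b mₜ sₜ w x y k l (inv≢0 (t≢0 t good)) (tangent t good) (s∉K₂m t good) w∈K₂ x∈K₂ y∈K₂ k∈K₂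
              linear-relation norm-relation direction≢0 slope ,
        x , (x∈K₂ , subst K₂ (sym ordinate≡y) y∈K₂) , trans (cong (λ y → incidence x y w t) ordinate≡y) incident
        where
        open ≡-Reasoning
        -- The line is not vertical: otherwise `a` would be the quotient `σ x / σ w` of elements of
        -- `K₂`. Dividing by `σ w` is the reason for demanding `w ≠ 0`.
        direction≢0 : σ x - a * σ w ≢ 0#
        direction≢0 e = a∉K₂ (subst K₂ (sym a≡) (K₂-* (K₂-σ x∈K₂) (K₂-inv (σ-≢0 w≢0) (K₂-σ w∈K₂))))
          where
          a≡ : a ≡ σ x * inv (σ w)
          a≡ = sym (trans (cong (_* inv (σ w)) (x-y≡0⇒x≡y e)) (trans (*-assoc a _ _) (trans (cong (a *_) (inverseʳ (σ-≢0 w≢0))) (*-identityʳ a))))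
        l : K
        l = (σ y - b * σ w) * inv (σ x - a * σ w)
        slope : l * (σ x - a * σ w) ≡ σ y - b * σ w
        slope = trans (*-assoc _ _ _) (trans (cong ((σ y - b * σ w) *_) (inverseˡ direction≢0)) (*-identityʳ _))
        ordinate≡y : ordinate l w x ≡ y
        ordinate≡y = trans (cong σ⁵ (trans (cong (_+ b * σ w) slope) (solve 2 (λ y z → y :- z :+ z := y) refl (σ y) (b * σ w))))
          (trans (cong (λ z → σ² (σ² z)) y∈K₂) (trans (cong σ² y∈K₂) y∈K₂))
        incident : incidence x y w t ≡ 0#
        incident = begin
          δ * (t * σ t) + - (a * x - b * w - y) * t + - σ (a * x - b * w - y) * σ t + (x * σ x - y * σ w - σ y * w)
            ≡⟨ cong₂ (λ d (β , ν) → d * (t * σ t) + - β * t + - σ β * σ t + ν) (sym (tangent t good)) (cong₂ _,_ linear-relation norm-relation) ⟩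
          (mₜ * σ sₜ + σ mₜ * sₜ) * (t * σ t) + - (sₜ + mₜ * k) * t + - σ (sₜ + mₜ * k) * σ t + (k + σ k)
            ≡⟨ cong (λ z → (mₜ * σ sₜ + σ mₜ * sₜ) * (t * σ t) + - (sₜ + mₜ * k) * t + - z * σ t + (k + σ k)) (σ-eval (v 0 :+ v 1 :* v 2) (sₜ ∷ mₜ ∷ k ∷ [])) ⟩
          (mₜ * σ sₜ + σ mₜ * sₜ) * (t * σ t) + - (sₜ + mₜ * k) * t + - (σ sₜ + σ mₜ * σ k) * σ t + (k + σ k)
            ≡⟨ solve 8 (λ m m₁ s s₁ t t₁ k k₁ → (m :* s₁ :+ m₁ :* s) :* (t :* t₁) :+ (:- (s :+ m :* k)) :* t :+ (:- (s₁ :+ m₁ :* k₁)) :* t₁ :+ (k :+ k₁)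
                 := s₁ :* t₁ :* (m :* t :- con (ℤ.+ 1)) :+ s :* t :* (m₁ :* t₁ :- con (ℤ.+ 1)) :- k :* (m :* t :- con (ℤ.+ 1)) :- k₁ :* (m₁ :* t₁ :- con (ℤ.+ 1))) refl
                 mₜ (σ mₜ) sₜ (σ sₜ) t (σ t) k (σ k) ⟩
          σ sₜ * σ t * (mₜ * t - 1#) + sₜ * t * (σ mₜ * σ t - 1#) - k * (mₜ * t - 1#) - σ k * (σ mₜ * σ t - 1#)
            ≡⟨ cong₂ (λ x y → σ sₜ * σ t * x + sₜ * t * y - k * x - σ k * y) (x≡y⇒x-y≡0 (mt t good)) (x≡y⇒x-y≡0 (m₁t₁ t good)) ⟩
          σ sₜ * σ t * 0# + sₜ * t * 0# - k * 0# - σ k * 0#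
            ≡⟨ solve 4 (λ p r k k₁ → let O = con (ℤ.+ 0) in p :* O :+ r :* O :- k :* O :- k₁ :* O := O) refl (σ sₜ * σ t) (sₜ * t) k (σ k) ⟩
          0# ∎

      -- The circle has at least `q` points, one of which may be the discarded `w = 0`.
      many-witnesses : ℕ.pred q ≤ # (λ w → K₂*? w ×-dec witnessed? t w)
      many-witnesses = ℕ.pred-mono-≤ (ℕ.≤-trans q≤#tangentCircle (ℕ.≤-trans (#-except onTangentCircle? (_≟ 0#))
        (ℕ.≤-trans (ℕ.+-mono-≤ (#-mono (λ w → onTangentCircle? w ×-dec ¬? (w ≟ 0#)) (λ w → K₂*? w ×-dec witnessed? t w) (λ w (h , w≢0) → (proj₁ h , w≢0) , witness w h w≢0))
            (#-singleton (_≟ 0#) (λ _ _ e f → trans e (sym f))))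
          (ℕ.≤-reflexive (ℕ.+-comm _ 1)))))
        where
        witness : ∀ w → OnCircle α κ γ α∈Fq κ∈Fq γ∈K₂ nondegenerate w → w ≢ 0# → Witnessed t w
        witness w h w≢0 = let (x , y , k , rational , linear-relation , norm-relation) = tangent-point h in
          witness-from w x y k (proj₁ h) w≢0 rational linear-relation norm-relation

    -- Each good `t` has at least `q - 1` witnesses `w`, while at most `q² - 1 = (q - 1)(q + 1)`
    -- values of `w` are available. Cancelling `q - 1` leaves one factor `q + 1` from `w` and
    -- another from the choice of `t` on a line.
    #good≤ : # good? ≤ (q ℕ.+ 1) ℕ.* (q ℕ.+ 1) ℕ.* (secant-number ℕ.+ q ℕ.^ 2)
    #good≤ = ℕ.*-cancelʳ-≤ _ _ p {{ℕ.>-nonZero (ℕ.pred-mono-≤ 1<q)}} (begin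
      # good? ℕ.* p                                   ≤⟨ #-double good? K₂*? witnessed? p _ (λ t g → many-witnesses t g) #witnessed ⟩
      # K₂*? ℕ.* (M ℕ.* (q ℕ.+ 1))                    ≤⟨ ℕ.*-monoˡ-≤ (M ℕ.* (q ℕ.+ 1)) #K₂*≤ ⟩
      p ℕ.* (q ℕ.+ 1) ℕ.* (M ℕ.* (q ℕ.+ 1))           ≡⟨ N.solve 3 (λ p q M → p N.:* (q N.:+ N.con 1) N.:* (M N.:* (q N.:+ N.con 1)) N.:= (q N.:+ N.con 1) N.:* (q N.:+ N.con 1) N.:* M N.:* p) refl p q M ⟩
      (q ℕ.+ 1) ℕ.* (q ℕ.+ 1) ℕ.* M ℕ.* p             ∎)
      where
      open ℕ.≤-Reasoning
      module N = +-*-Solver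
      p = ℕ.pred q
      M = secant-number ℕ.+ q ℕ.^ 2
      #K₂*≤ : # K₂*? ≤ p ℕ.* (q ℕ.+ 1)
      #K₂*≤ = ℕ.+-cancelʳ-≤ 1 _ _ (begin
        # K₂*? ℕ.+ 1                       ≡⟨ cong (# K₂*? ℕ.+_) (sym (#-≡ 0#)) ⟩
        # K₂*? ℕ.+ # (0# ≟_)               ≤⟨ #-disjoint K₂*? (0# ≟_) K₂? (λ _ → proj₁) (λ { _ refl → Fq⇒K₂ Fq-0 }) (λ _ (_ , h) e → h (sym e)) ⟩
        # K₂?                              ≤⟨ #K₂≤q² ⟩
        q ℕ.^ 2                            ≡⟨ subst (λ q → q ℕ.^ 2 ≡ p ℕ.* (q ℕ.+ 1) ℕ.+ 1) (ℕ.suc-pred q)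
                                               (N.solve 1 (λ p → (N.con 1 N.:+ p) N.:^ 2 N.:= p N.:* ((N.con 1 N.:+ p) N.:+ N.con 1) N.:+ N.con 1) refl p) ⟩
        p ℕ.* (q ℕ.+ 1) ℕ.+ 1              ∎)

    secants-bound : q ℕ.^ 3 ≤ secant-number ℕ.+ 9 ℕ.* q ℕ.^ 2
    secants-bound = cubic-bound q (# good?) secant-number (ℕ.<⇒≤ 1<q) #good-bound #good≤

-- Passage from a FiniteField to Fin

private variable
  c ℓ : Level

module Transport {n : ℕ} (F : FiniteField c ℓ n) where
  open FiniteField F renaming (refl to ≈-refl; sym to ≈-sym; trans to ≈-trans)
  open Inverse enum using (to; from; to-cong; from-cong; strictlyInverseˡ; strictlyInverseʳ)
  open import Algebra.Definitions.RawSemiring (Semiring.rawSemiring semiring) using () renaming (_^_ to _^F_)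

  to-injective : ∀ {i j} → to i ≈ to j → i ≡ j
  to-injective {i} {j} e = trans (sym (strictlyInverseʳ i)) (trans (from-cong e) (strictlyInverseʳ j))

  rawRing′ : RawRing _ _
  rawRing′ = record
    { Carrier = Fin n ; _≈_ = _≡_
    ; _+_ = λ i j → from (to i + to j) ; _*_ = λ i j → from (to i * to j) ; -_ = λ i → from (- to i)
    ; 0# = from 0# ; 1# = from 1#
    }

  -- The enumeration carries the operations over to `Fin n`, where equality is propositional and
  -- elements can be counted; a monomorphism pulls the ring axioms back along it.
  to-monomorphism : IsRingMonomorphism rawRing′ (CommutativeRing.rawRing commRing) to
  to-monomorphism = record
    { isRingHomomorphism = record
      { isSemiringHomomorphism = record
        { isNearSemiringHomomorphism = record
          { +-isMonoidHomomorphism = record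
            { isMagmaHomomorphism = record
              { isRelHomomorphism = record { cong = to-cong }
              ; homo = λ _ _ → strictlyInverseˡ _ }
            ; ε-homo = strictlyInverseˡ _ }
          ; *-homo = λ _ _ → strictlyInverseˡ _ }
        ; 1#-homo = strictlyInverseˡ _ }
      ; -‿homo = λ _ → strictlyInverseˡ _ }
    ; injective = to-injective }

  open IsRingMonomorphism to-monomorphism public using (+-homo; *-homo; -‿homo; 0#-homo; 1#-homo)

  finField : FinField n
  finField = record
    { isCommutativeRing = RingMonomorphism.isCommutativeRing to-monomorphism (CommutativeRing.isCommutativeRing commRing)
    ; 0≢1 = λ e → 0≉1 (≈-trans (≈-sym (strictlyInverseˡ 0#)) (≈-trans (to-cong e) (strictlyInverseˡ 1#)))
    ; recip = λ x h → from (proj₁ (inv (to x) (to≉0 h))) , from-cong (≈-trans (*-cong ≈-refl (strictlyInverseˡ _)) (proj₂ (inv (to x) (to≉0 h))))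
    }
    where
    to≉0 : ∀ {x} → x ≢ from 0# → ¬ (to x ≈ 0#)
    to≉0 h e = h (to-injective (≈-trans e (≈-sym (strictlyInverseˡ 0#))))

  module K = FieldOps finField

  ^-homo : ∀ x k → to (x K.^ k) ≈ to x ^F k
  ^-homo x zero    = 1#-homo
  ^-homo x (suc k) = ≈-trans (*-homo x _) (*-cong ≈-refl (^-homo x k))

  minus-homo : ∀ x y → to (x K.- y) ≈ to x - to y
  minus-homo x y = ≈-trans (+-homo x _) (+-cong ≈-refl (-‿homo y))

  ^-congˡ : ∀ {x y} k → x ≈ y → x ^F k ≈ y ^F k
  ^-congˡ zero    e = ≈-refl
  ^-congˡ (suc k) e = *-cong e (^-congˡ k e)

-- The curve, its lines and A expressed through σ

module Descent (q : ℕ) (1<q : 1 < q) (F : FiniteField c ℓ (q ℕ.^ 6))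
  (σ-hom : FieldOps.RingHom (Transport.finField F) (λ x → FieldOps._^_ (Transport.finField F) x q)) where

  open FiniteField F renaming (refl to ≈-refl; sym to ≈-sym; trans to ≈-trans)
  open Inverse enum using (to; from; to-cong; from-cong; strictlyInverseˡ; strictlyInverseʳ)
  open Hermitian F q
  open Transport F
  open import Algebra.Definitions.RawSemiring (Semiring.rawSemiring semiring) using () renaming (_^_ to _^F_)

  private
    fermat′ : ∀ x → x K.^ (q ℕ.^ 6) ≡ x
    fermat′ = FrobeniusProperties.fermat finField

  open Conjugates q 1<q finField σ-hom fermat′ using (σ; σ²; σ⁴; σ⁶; σ-eval; conj≡powers; module σ; onH?; meet; secant?; module Incidence)

  σ²-power : ∀ x → σ² x ≡ x K.^ (q ℕ.^ 2)
  σ²-power x = cong (λ c → lookup c (Fin.#_ 2)) (conj≡powers x)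

  σ⁴-power : ∀ x → σ⁴ x ≡ x K.^ (q ℕ.^ 4)
  σ⁴-power x = cong (λ c → lookup c (Fin.#_ 4)) (conj≡powers x)

  norm-power : ∀ x → x K.* σ x ≡ x K.^ (q ℕ.+ 1)
  norm-power x = sym (trans (K.^-homo-* x q 1) (trans (cong (σ x K.*_) (K.*-identityʳ x)) (K.*-comm (σ x) x)))

  module _ (a b : Carrier) where

    a′ b′ : K.K
    a′ = from a
    b′ = from b

    to-line : ∀ l ξ → to (b′ K.+ l K.* (ξ K.- a′)) ≈ b + to l * (to ξ - a)
    to-line l ξ = ≈-trans (+-homo _ _) (+-cong (strictlyInverseˡ b) (≈-trans (*-homo _ _) (*-cong ≈-refl
      (≈-trans (minus-homo ξ a′) (+-cong ≈-refl (-‿cong (strictlyInverseˡ a)))))))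

    to-norm : ∀ ξ → to (ξ K.* σ ξ) ≈ to ξ ^F (q ℕ.+ 1)
    to-norm ξ = ≈-trans (to-cong (norm-power ξ)) (^-homo ξ (q ℕ.+ 1))

    to-trace : ∀ l ξ → let η = b′ K.+ l K.* (ξ K.- a′); y = b + to l * (to ξ - a) in to (σ η K.+ η) ≈ y ^F q + y
    to-trace l ξ = ≈-trans (+-homo _ _) (+-cong (≈-trans (^-homo _ q) (^-congˡ q (to-line l ξ))) (to-line l ξ))

    lineMeet≡meet : ∀ l → lineMeet a b (to l) ≡ meet a′ b′ l
    lineMeet≡meet l = trans (length-filter (λ ξ → (to ξ ^F (q ℕ.+ 1)) ≟ ((b + (to l * (to ξ - a))) ^F q + (b + (to l * (to ξ - a))))))
      (#-cong _ (onH? a′ b′ l)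
        (λ ξ e → to-injective (≈-trans (to-norm ξ) (≈-trans e (≈-sym (to-trace l ξ)))))
        (λ ξ e → ≈-trans (≈-sym (to-norm ξ)) (≈-trans (to-cong e) (to-trace l ξ))))

    -- Only lines with a slope were constructed; the vertical line can only increase the right side.
    secants≤ : # (secant? a′ b′) ≤ secantsThrough a b
    secants≤ = ℕ.≤-trans (#-mono (secant? a′ b′) (λ i → lineMeet a b (to i) ℕ.≟ (q ℕ.+ 1)) (λ l → trans (lineMeet≡meet l)))
      (ℕ.≤-trans (ℕ.≤-reflexive (sym (length-filter (λ i → lineMeet a b (to i) ℕ.≟ (q ℕ.+ 1))))) (ℕ.m≤m+n _ _))

    T : K.K
    T = a′ K.* σ a′ K.- σ a′ K.* σ² a′

    to-T : to T ≈ (a ^F (q ℕ.+ 1)) - (a ^F ((q ℕ.^ 2) ℕ.+ q))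
    to-T = ≈-trans (minus-homo _ _) (+-cong (≈-trans (to-norm a′) (^-congˡ (q ℕ.+ 1) (strictlyInverseˡ a)))
      (-‿cong (≈-trans (to-cong power) (≈-trans (^-homo a′ (q ℕ.^ 2 ℕ.+ q)) (^-congˡ (q ℕ.^ 2 ℕ.+ q) (strictlyInverseˡ a))))))
      where
      power : σ a′ K.* σ² a′ ≡ a′ K.^ (q ℕ.^ 2 ℕ.+ q)
      power = trans (K.*-comm _ _) (trans (cong (K._* σ a′) (σ²-power a′)) (sym (K.^-homo-* a′ (q ℕ.^ 2) q)))

    to-A : to (T K.+ σ² T K.+ σ⁴ T) ≈ Aval a
    to-A = ≈-trans (+-homo _ _) (+-cong (≈-trans (+-homo _ _) (+-cong to-T (power (q ℕ.^ 2) (σ²-power T)))) (power (q ℕ.^ 4) (σ⁴-power T)))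
      where
      power : ∀ k {z} → z ≡ T K.^ k → to z ≈ ((a ^F (q ℕ.+ 1)) - (a ^F ((q ℕ.^ 2) ℕ.+ q))) ^F k
      power k e = ≈-trans (to-cong e) (≈-trans (^-homo T k) (^-congˡ k to-T))

    A≡0⇒ : T K.+ σ² T K.+ σ⁴ T ≡ K.0# → Aval a ≈ 0#
    A≡0⇒ e = ≈-trans (≈-sym to-A) (≈-trans (to-cong e) 0#-homo)

    a∈K₂⇒A≈0 : σ² a′ ≡ a′ → Aval a ≈ 0#
    a∈K₂⇒A≈0 e = A≡0⇒ (trans (cong (λ t → t K.+ σ² t K.+ σ⁴ t) T≡0) (trans (cong₂ (λ x y → K.0# K.+ x K.+ y) σ²0 (trans (cong σ² σ²0) σ²0))
        (K.solve 0 (O K.:+ O K.:+ O K.:= O) refl)))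
      where
      O : ∀ {n} → K.Polynomial n
      O = K.con (ℤ.+ 0)
      σ²0 : σ² K.0# ≡ K.0#
      σ²0 = trans (cong σ σ.φ-0) σ.φ-0
      T≡0 : T ≡ K.0#
      T≡0 = K.x≡y⇒x-y≡0 (trans (K.*-comm a′ (σ a′)) (cong (σ a′ K.*_) (sym e)))

    -- If `δ` vanishes then `a σa = b + σb`, so that `T = b - σ² b`, and the sum of its conjugates
    -- over `K₂` telescopes to zero.
    δ≡0⇒A≈0 : a′ K.* σ a′ K.- b′ K.- σ b′ ≡ K.0# → Aval a ≈ 0#
    δ≡0⇒A≈0 e = A≡0⇒ (begin
      T K.+ σ² T K.+ σ⁴ T
        ≡⟨ cong (λ t → t K.+ σ² t K.+ σ⁴ t) T≡ ⟩
      (b′ K.- σ² b′) K.+ σ² (b′ K.- σ² b′) K.+ σ⁴ (b′ K.- σ² b′)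
        ≡⟨ cong₂ (λ x y → (b′ K.- σ² b′) K.+ x K.+ y) (shift b′) (trans (cong σ² (shift b′)) (trans (shift (σ² b′)) (cong (λ z → σ⁴ b′ K.- z) (σ⁶ b′)))) ⟩
      (b′ K.- σ² b′) K.+ (σ² b′ K.- σ⁴ b′) K.+ (σ⁴ b′ K.- b′)
        ≡⟨ K.solve 3 (λ x y z → (x K.:- y) K.:+ (y K.:- z) K.:+ (z K.:- x) K.:= K.con (ℤ.+ 0)) refl b′ (σ² b′) (σ⁴ b′) ⟩
      K.0# ∎)
      where
      open ≡-Reasoning
      shift : ∀ x → σ² (x K.- σ² x) ≡ σ² x K.- σ⁴ x
      shift x = trans (cong σ (σ-eval (K.v 0 K.:- K.v 1) (x ∷ σ² x ∷ []))) (σ-eval (K.v 0 K.:- K.v 1) (σ x ∷ σ (σ² x) ∷ []))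
      aσa : a′ K.* σ a′ ≡ b′ K.+ σ b′
      aσa = K.x-y≡0⇒x≡y (trans (K.solve 3 (λ x b c → x K.:- (b K.:+ c) K.:= x K.:- b K.:- c) refl _ b′ (σ b′)) e)
      T≡ : T ≡ b′ K.- σ² b′
      T≡ = trans (cong₂ K._-_ aσa (trans (sym (σ.φ-* a′ (σ a′))) (trans (cong σ aσa) (σ.φ-+ b′ (σ b′)))))
        (K.solve 3 (λ b c d → (b K.:+ c) K.:- (c K.:+ d) K.:= b K.:- d) refl b′ (σ b′) (σ² b′))

    secants-lower-bound : ¬ (Aval a ≈ 0#) → q ℕ.^ 3 ≤ secantsThrough a b ℕ.+ 9 ℕ.* q ℕ.^ 2
    secants-lower-bound h = ℕ.≤-trans (Incidence.secants-bound a′ b′ (λ e → h (a∈K₂⇒A≈0 e)) (λ e → h (δ≡0⇒A≈0 e)))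
      (ℕ.+-monoˡ-≤ (9 ℕ.* q ℕ.^ 2) secants≤)

prime-power-secants : ∀ q → IsPrimePower q → (F : FiniteField c ℓ (q ℕ.^ 6)) → let open FiniteField F; open Hermitian F q in
  ∀ a b → ¬ (Aval a ≈ 0#) → q ℕ.^ 3 ≤ secantsThrough a b ℕ.+ 9 ℕ.* q ℕ.^ 2
prime-power-secants q (zero  , k , pr , _) = contradiction pr ¬prime[0]
prime-power-secants q (suc m , k , pr , 1≤k , refl) F = Descent.secants-lower-bound q 1<q F
  -- With `q = p ^ k` the field has `p ^ (6 k)` elements, hence characteristic `p`, and `σ` is the
  -- `k`-th iterate of the `p`-th power map.
  (frobenius-power m pr (char (suc m) (k ℕ.* 6) (ℕ.^-*-assoc (suc m) k 6)) k)
  where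
  open FrobeniusProperties (Transport.finField F)
  1<q : 1 < suc m ℕ.^ k
  1<q = ℕ.^-monoʳ-< (suc m) (ℕ.nonTrivial⇒n>1 (suc m) {{prime⇒nonTrivial pr}}) 1≤k

-- The rational estimate

toℚᵘ-ℕ→ℚ : ∀ n → toℚᵘ (ℕ→ℚ n) ℚᵘ.≃ mkℚᵘ (ℤ.+ n) 0
toℚᵘ-ℕ→ℚ n = ℚ.toℚᵘ-fromℚᵘ (mkℚᵘ (ℤ.+ n) 0)

ℕ→ℚ-+ : ∀ m n → ℕ→ℚ (m ℕ.+ n) ≡ ℕ→ℚ m ℚ.+ ℕ→ℚ n
ℕ→ℚ-+ m n = ℚ.toℚᵘ-injective (begin-equality
  toℚᵘ (ℕ→ℚ (m ℕ.+ n))                   ≃⟨ toℚᵘ-ℕ→ℚ (m ℕ.+ n) ⟩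
  mkℚᵘ (ℤ.+ (m ℕ.+ n)) 0                   ≃⟨ ℚᵘ.*≡* (cong (ℤ._* ℤ.+ 1) (sym (cong₂ ℤ._+_ (ℤ.*-identityʳ (ℤ.+ m)) (ℤ.*-identityʳ (ℤ.+ n))))) ⟩
  mkℚᵘ (ℤ.+ m) 0 ℚᵘ.+ mkℚᵘ (ℤ.+ n) 0         ≃⟨ ℚᵘ.+-cong (toℚᵘ-ℕ→ℚ m) (toℚᵘ-ℕ→ℚ n) ⟨
  toℚᵘ (ℕ→ℚ m) ℚᵘ.+ toℚᵘ (ℕ→ℚ n)         ≃⟨ ℚ.toℚᵘ-homo-+ (ℕ→ℚ m) (ℕ→ℚ n) ⟨
  toℚᵘ (ℕ→ℚ m ℚ.+ ℕ→ℚ n)                 ∎)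
  where open ℚᵘ.≤-Reasoning

ℕ→ℚ-* : ∀ m n → ℕ→ℚ (m ℕ.* n) ≡ ℕ→ℚ m ℚ.* ℕ→ℚ n
ℕ→ℚ-* m n = ℚ.toℚᵘ-injective (begin-equality
  toℚᵘ (ℕ→ℚ (m ℕ.* n))                   ≃⟨ toℚᵘ-ℕ→ℚ (m ℕ.* n) ⟩
  mkℚᵘ (ℤ.+ (m ℕ.* n)) 0                   ≃⟨ ℚᵘ.*≡* (cong (ℤ._* ℤ.+ 1) (ℤ.pos-* m n)) ⟩
  mkℚᵘ (ℤ.+ m) 0 ℚᵘ.* mkℚᵘ (ℤ.+ n) 0         ≃⟨ ℚᵘ.*-cong (toℚᵘ-ℕ→ℚ m) (toℚᵘ-ℕ→ℚ n) ⟨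
  toℚᵘ (ℕ→ℚ m) ℚᵘ.* toℚᵘ (ℕ→ℚ n)         ≃⟨ ℚ.toℚᵘ-homo-* (ℕ→ℚ m) (ℕ→ℚ n) ⟨
  toℚᵘ (ℕ→ℚ m ℚ.* ℕ→ℚ n)                 ∎)
  where open ℚᵘ.≤-Reasoning

ℕ→ℚ-mono : ∀ {m n} → m ≤ n → ℕ→ℚ m ℚ.≤ ℕ→ℚ n
ℕ→ℚ-mono {m} {n} h = ℚ.toℚᵘ-cancel-≤ (begin
  toℚᵘ (ℕ→ℚ m)      ≃⟨ toℚᵘ-ℕ→ℚ m ⟩
  mkℚᵘ (ℤ.+ m) 0      ≤⟨ ℚᵘ.*≤* (ℤ.*-monoʳ-≤-nonNeg (ℤ.+ 1) (ℤ.+≤+ h)) ⟩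
  mkℚᵘ (ℤ.+ n) 0      ≃⟨ toℚᵘ-ℕ→ℚ n ⟨
  toℚᵘ (ℕ→ℚ n)      ∎)
  where open ℚᵘ.≤-Reasoning

*-nonNeg : ∀ {x y} → ℚ.0ℚ ℚ.≤ x → ℚ.0ℚ ℚ.≤ y → ℚ.0ℚ ℚ.≤ x ℚ.* y
*-nonNeg {x} {y} hx hy = subst (ℚ._≤ x ℚ.* y) (ℚ.*-zeroʳ x) (ℚ.*-monoˡ-≤-nonNeg x {{ℚ.nonNegative hx}} hy)

+-nonNeg : ∀ {x y} → ℚ.0ℚ ℚ.≤ x → ℚ.0ℚ ℚ.≤ y → ℚ.0ℚ ℚ.≤ x ℚ.+ y
+-nonNeg = ℚ.+-mono-≤

ℕ→ℚ-nonNeg : ∀ n → ℚ.0ℚ ℚ.≤ ℕ→ℚ n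
ℕ→ℚ-nonNeg n = ℕ→ℚ-mono {0} {n} ℕ.z≤n

-- Supplies the signs of the two approximate cube roots: a nonpositive `t` would have a nonpositive
-- cube.
cube-nonNeg : ∀ {t} → ℕ→ℚ 1 ℚ.≤ t ℚ.* t ℚ.* t → ℚ.0ℚ ℚ.≤ t
cube-nonNeg {t} h with ℚ.≤-total ℚ.0ℚ t
... | inj₁ p = p
... | inj₂ p = contradiction (ℚ.≤-trans h t³≤0) λ { (ℚ.*≤* (ℤ.+≤+ ())) }
  where
  0≤t² : ℚ.0ℚ ℚ.≤ t ℚ.* t
  0≤t² = subst (ℚ._≤ t ℚ.* t) (ℚ.*-zeroʳ t) (ℚ.*-monoˡ-≤-nonPos t {{ℚ.nonPositive p}} p)
  t³≤0 : t ℚ.* t ℚ.* t ℚ.≤ ℚ.0ℚ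
  t³≤0 = subst (t ℚ.* t ℚ.* t ℚ.≤_) (ℚ.*-zeroʳ (t ℚ.* t)) (ℚ.*-monoˡ-≤-nonNeg (t ℚ.* t) {{ℚ.nonNegative 0≤t²}} p)

x-y≤x : ∀ x {y} → ℚ.0ℚ ℚ.≤ y → x ℚ.- y ℚ.≤ x
x-y≤x x h = subst (x ℚ.- _ ℚ.≤_) (ℚ.+-identityʳ x) (ℚ.+-monoʳ-≤ x (ℚ.neg-antimono-≤ h))

bound-≤ : ∀ q n s t u → ℚ.0ℚ ℚ.≤ s → ℚ.0ℚ ℚ.≤ t → ℚ.0ℚ ℚ.≤ u → q ℕ.^ 3 ≤ n ℕ.+ 9 ℕ.* q ℕ.^ 2 → bound q s t u ℚ.≤ ℕ→ℚ n
bound-≤ q n s t u hs ht hu h = begin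
  bound q s t u
    ≤⟨ x-y≤x _ (ℕ→ℚ-nonNeg (q ℕ.+ 1)) ⟩
  Q³ ℚ.- ℕ→ℚ 3422 ℚ.* Q² ℚ.* s ℚ.- ℕ→ℚ 5 ℚ.* t ℚ.* Q² ℚ.- ℕ→ℚ 9 ℚ.* Q² ℚ.- (Q² ℚ.+ ℕ→ℚ (1499 ℕ.* 1500) ℚ.* s ℚ.+ ℕ→ℚ 5 ℚ.* u ℚ.* ℕ→ℚ q)
    ≤⟨ x-y≤x _ (+-nonNeg (+-nonNeg (ℕ→ℚ-nonNeg (q ℕ.^ 2)) (*-nonNeg (ℕ→ℚ-nonNeg (1499 ℕ.* 1500)) hs)) (*-nonNeg (*-nonNeg (ℕ→ℚ-nonNeg 5) hu) (ℕ→ℚ-nonNeg q))) ⟩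
  Q³ ℚ.- ℕ→ℚ 3422 ℚ.* Q² ℚ.* s ℚ.- ℕ→ℚ 5 ℚ.* t ℚ.* Q² ℚ.- ℕ→ℚ 9 ℚ.* Q²
    ≤⟨ ℚ.+-monoˡ-≤ (ℚ.- (ℕ→ℚ 9 ℚ.* Q²)) (ℚ.≤-trans (x-y≤x (Q³ ℚ.- ℕ→ℚ 3422 ℚ.* Q² ℚ.* s) (*-nonNeg (*-nonNeg (ℕ→ℚ-nonNeg 5) ht) (ℕ→ℚ-nonNeg (q ℕ.^ 2))))
         (x-y≤x Q³ (*-nonNeg (*-nonNeg (ℕ→ℚ-nonNeg 3422) (ℕ→ℚ-nonNeg (q ℕ.^ 2))) hs))) ⟩
  -- All the other subtracted terms, being nonnegative, have been dropped; the natural-number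
  -- estimate now applies to the `9 q²` kept here.
  Q³ ℚ.- ℕ→ℚ 9 ℚ.* Q²
    ≤⟨ ℚ.+-monoˡ-≤ (ℚ.- (ℕ→ℚ 9 ℚ.* Q²)) (ℕ→ℚ-mono h) ⟩
  ℕ→ℚ (n ℕ.+ 9 ℕ.* q ℕ.^ 2) ℚ.- ℕ→ℚ 9 ℚ.* Q²
    ≡⟨ cong (ℚ._- ℕ→ℚ 9 ℚ.* Q²) (trans (ℕ→ℚ-+ n (9 ℕ.* q ℕ.^ 2)) (cong (ℕ→ℚ n ℚ.+_) (ℕ→ℚ-* 9 (q ℕ.^ 2)))) ⟩
  ℕ→ℚ n ℚ.+ ℕ→ℚ 9 ℚ.* Q² ℚ.- ℕ→ℚ 9 ℚ.* Q²
    ≡⟨ trans (ℚ.+-assoc (ℕ→ℚ n) _ _) (trans (cong (ℕ→ℚ n ℚ.+_) (ℚ.+-inverseʳ (ℕ→ℚ 9 ℚ.* Q²))) (ℚ.+-identityʳ (ℕ→ℚ n))) ⟩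
  ℕ→ℚ n ∎
  where
  open ℚ.≤-Reasoning
  Q² = ℕ→ℚ (q ℕ.^ 2)
  Q³ = ℕ→ℚ (q ℕ.^ 3)

theorem3p7 : {c ℓ : Level} (q : ℕ) → IsPrimePower q →
    (F : FiniteField c ℓ (q ℕ.^ 6)) →
    (a b : FiniteField.Carrier F) →
    ¬ (FiniteField._≈_ F (Hermitian.Aval F q a) (FiniteField.0# F)) →
    (s t u : ℚ) →
    ℚ.0ℚ ℚ.≤ s → ℕ→ℚ q ℚ.≤ s ℚ.* s →
    ℕ→ℚ (60 ℕ.^ 13) ℚ.≤ t ℚ.* t ℚ.* t →
    ℕ→ℚ (1500 ℕ.^ 13) ℚ.≤ u ℚ.* u ℚ.* u →
    bound q s t u ℚ.≤ ℕ→ℚ (Hermitian.secantsThrough F q a b)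
theorem3p7 q pp F a b A≉0 s t u 0≤s _ t-large u-large = bound-≤ q (Hermitian.secantsThrough F q a b) s t u 0≤s
  (cube-nonNeg (ℚ.≤-trans (ℕ→ℚ-mono (ℕ.m^n>0 60 13)) t-large)) (cube-nonNeg (ℚ.≤-trans (ℕ→ℚ-mono (ℕ.m^n>0 1500 13)) u-large))
  (prime-power-secants q pp F a b A≉0)
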